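{- There is a nondeterministic logarithmic-space Turing machine which, given the canonical encoding of a finite ordered graph $(G,<)$ and (indices of) two vertices $v,w$ of $G$, accepts if and only if $v\prec_B w$.
   Context: A finite ordered graph $(G,<)$ is a finite undirected graph with a linear order on its vertices; its canonical encoding is the standard string encoding relative to $<$. The canonical breadth-first order $\prec_B$: for vertices $v,w$ let $v_0,w_0$ be the $<$-least vertices of the connected components of $v$ and $w$ respectively. Let $<^\star$ be the order on finite sequences of vertices comparing first by length and then lexicographically with respect to $<$. Let $\vec v$ denote the $<^\star$-least path from $v_0$ to $v$ (and similarly $\vec w$). Then: if $v_0\ne w_0$, $v\prec_B w$ iff $v_0<w_0$; if $v_0=w_0$, $v\prec_B w$ iff $\vec v<^\star\vec w$. -}

module Defs where

open import Data.Bool.Base using (Bool; if_then_else_)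
open import Data.Fin.Base as Fin using (Fin; toℕ)
open import Data.List.Base using (List; []; _∷_; _++_; _∷ʳ_; length; map; concatMap; replicate; allFin; head; last)
open import Data.List.Membership.Propositional using (_∈_)
open import Data.List.Relation.Binary.Lex.Strict using (Lex-<)
open import Data.List.Relation.Unary.Linked using (Linked)
open import Data.List.Relation.Unary.Unique.Propositional using (Unique)
open import Data.Maybe.Base using (just)
open import Data.Nat.Base as ℕ using (ℕ; zero; suc; _+_; _*_; _≤_; _⊓_; pred)
open import Data.Nat.DivMod using (_/_; _%_)
open import Data.Nat.Logarithm using (⌈log₂_⌉)
open import Data.Product.Base using (_×_; ∃-syntax; _,_)
open import Data.Sum.Base using (_⊎_)
open import Data.Vec.Base as Vec using (Vec)
open import Function.Bundles using (_↔_; Inverse)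
open import Level using (0ℓ)
open import Relation.Binary.Construct.Closure.ReflexiveTransitive using (Star)
open import Relation.Binary.Core using (Rel)
open import Relation.Binary.Definitions using (Decidable; Symmetric)
open import Relation.Binary.PropositionalEquality.Core using (_≡_; _≢_)
open import Relation.Binary.Structures using (IsStrictTotalOrder)
open import Relation.Nullary.Decidable.Core using (does)

data Move : Set where
  left stay right : Move

data InputSymbol (A : Set) : Set where
  ⊢ ⊣ : InputSymbol A
  sym : A → InputSymbol A

-- The input tape is read-only and two-way; only work tapes count as space.
record NTM (A : Set) : Set₁ where
  field
    State        : Set
    #states      : ℕ
    finiteState  : State ↔ Fin #states

    Γ            : Set
    #Γ           : ℕ
    finiteΓ      : Γ ↔ Fin #Γ
    blank        : Γ

    #tapes       : ℕ
    start accept : State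

  -- New state, input head move, and for every work tape the symbol
  -- written and the head move.
  Action : Set
  Action = State × Move × Vec (Γ × Move) #tapes

  -- The list of permitted actions: several mean a nondeterministic
  -- choice, none means that the machine halts.
  field
    δ : State → InputSymbol A → Vec Γ #tapes → List Action

module _ {A : Set} where

  -- The input is read as  ⊢ x ⊣, with ⊢ at position 0.
  readInput : List A → ℕ → InputSymbol A
  readInput x       zero          = ⊢
  readInput []      (suc i)       = ⊣
  readInput (a ∷ x) (suc zero)    = sym a
  readInput (a ∷ x) (suc (suc i)) = readInput x (suc i)

  -- The input head cannot leave the two end markers; otherwise its
  -- position would be an unbounded counter not charged as space.
  moveInput : List A → Move → ℕ → ℕ
  moveInput x left  i = pred i
  moveInput x stay  i = i
  moveInput x right i = suc i ⊓ suc (length x)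

module Computation {A : Set} (M : NTM A) where
  open NTM M

  -- The visited part of a two-way infinite tape; cells outside it are
  -- blank. The list `before` is in reverse order, nearest cell first.
  record Tape : Set where
    constructor tape
    field
      before  : List Γ
      scanned : Γ
      after   : List Γ

  open Tape public

  visited : Tape → ℕ
  visited (tape ls _ rs) = length ls + suc (length rs)

  moveHead : Move → Tape → Tape
  moveHead left  (tape []       c rs)       = tape [] blank (c ∷ rs)
  moveHead left  (tape (l ∷ ls) c rs)       = tape ls l (c ∷ rs)
  moveHead stay  t                          = t
  moveHead right (tape ls       c [])       = tape (c ∷ ls) blank []
  moveHead right (tape ls       c (r ∷ rs)) = tape (c ∷ ls) r rs

  writeMove : Γ × Move → Tape → Tape
  writeMove (s , m) (tape ls _ rs) = moveHead m (tape ls s rs)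

  record Config : Set where
    constructor config
    field
      state     : State
      inputHead : ℕ
      work      : Vec Tape #tapes

  open Config public

  initial : Config
  initial = config start 0 (Vec.replicate #tapes (tape [] blank []))

  enabled : List A → Config → List Action
  enabled x (config q i ts) = δ q (readInput x i) (Vec.map scanned ts)

  perform : List A → Action → Config → Config
  perform x (q′ , m , ws) (config q i ts) =
    config q′ (moveInput x m i) (Vec.zipWith writeMove ws ts)

  data Step (x : List A) (c : Config) : Config → Set where
    step : ∀ {a} → a ∈ enabled x c → Step x c (perform x a c)

  Reachable : List A → Config → Set
  Reachable x c = Star (Step x) initial c

  space : Config → ℕ
  space c = Vec.sum (Vec.map visited (work c))

Accepts : {A : Set} → NTM A → List A → Set
Accepts M x = ∃[ c ] Reachable x c × state c ≡ NTM.accept M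
  where open Computation M

-- Every computation on every input uses O(log |x|) work-tape cells. The
-- successor accounts for inputs of length at most 1.
LogSpace : {A : Set} → NTM A → Set
LogSpace {A} M =
  ∃[ k ] ∀ (x : List A) c → Reachable x c → space c ≤ k * suc ⌈log₂ length x ⌉
  where open Computation M

record OrderedGraph : Set₁ where
  infix 4 _<_ _~_
  field
    Vertex             : Set

    _<_                : Rel Vertex 0ℓ
    isStrictTotalOrder : IsStrictTotalOrder _≡_ _<_

    -- Finiteness is witnessed by the increasing enumeration of the
    -- vertices, which is unique for a given finite linear order.
    size               : ℕ
    enumeration        : Fin size ↔ Vertex
    increasing         : ∀ {i j} → i Fin.< j →
                         Inverse.to enumeration i < Inverse.to enumeration j

    _~_                : Rel Vertex 0ℓ
    ~-sym              : Symmetric _~_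
    _~?_               : Decidable _~_

  vertexAt : Fin size → Vertex
  vertexAt = Inverse.to enumeration

  index : Vertex → Fin size
  index = Inverse.from enumeration

module BreadthFirst (G : OrderedGraph) where
  open OrderedGraph G

  infix 4 _<⋆_ _≺B_

  _<⋆_ : Rel (List Vertex) 0ℓ
  p <⋆ q = length p ℕ.< length q
         ⊎ (length p ≡ length q × Lex-< _≡_ _<_ p q)

  record IsPath (u v : Vertex) (p : List Vertex) : Set where
    field
      from     : head p ≡ just u
      to       : last p ≡ just v
      adjacent : Linked _~_ p
      distinct : Unique p

  Connected : Rel Vertex 0ℓ
  Connected u v = ∃[ p ] IsPath u v p

  record IsLeastInComponent (v v₀ : Vertex) : Set where
    field
      connected : Connected v v₀
      least     : ∀ u → Connected v u → v₀ ≡ u ⊎ v₀ < u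

  record IsLeastPath (u v : Vertex) (p : List Vertex) : Set where
    field
      isPath : IsPath u v p
      least  : ∀ q → IsPath u v q → p ≡ q ⊎ p <⋆ q

  -- v₀, w₀ and the two least paths exist and are unique, so the
  -- existential quantifiers only serve to name them.
  _≺B_ : Rel Vertex 0ℓ
  v ≺B w =
    ∃[ v₀ ] ∃[ w₀ ] IsLeastInComponent v v₀ × IsLeastInComponent w w₀ ×
      ( (v₀ ≢ w₀ × v₀ < w₀)
      ⊎ (v₀ ≡ w₀ × ∃[ p ] ∃[ q ] IsLeastPath v₀ v p × IsLeastPath w₀ w q × p <⋆ q))

data Symbol : Set where
  𝟎 𝟏 # : Symbol

bit : Bool → Symbol
bit b = if b then 𝟏 else 𝟎

-- The k least significant binary digits, most significant first.
binary : ℕ → ℕ → List Symbol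
binary zero    m = []
binary (suc k) m = binary k (m / 2) ∷ʳ bit (m % 2 ℕ.≡ᵇ 1)

module Encoding (G : OrderedGraph) where
  open OrderedGraph G

  -- 0ⁿ 1 followed by the adjacency matrix relative to <, row by row.
  encodeGraph : List Symbol
  encodeGraph = replicate size 𝟎 ++ 𝟏 ∷ concatMap row (allFin size)
    where
    row : Fin size → List Symbol
    row i = map (λ j → bit (does (vertexAt i ~? vertexAt j))) (allFin size)

  -- Vertices are numbered from 0 in increasing order; ⌈log₂ n⌉ digits
  -- suffice for a number below n.
  encodeVertex : Vertex → List Symbol
  encodeVertex v = binary ⌈log₂ size ⌉ (toℕ (index v))

  encode : Vertex → Vertex → List Symbol
  encode v w = encodeGraph ++ # ∷ encodeVertex v ++ # ∷ encodeVertex w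

{-# OPTIONS --safe #-}

-- Write |u v| ≤ d if a walk of length ≤ d leads from u to v. The vertex v
-- precedes w iff v₀ < w₀, or v₀ = w₀ and some walk from w₀ to v precedes the
-- least path from w₀ to w. The latter path is traced greedily: from a vertex c
-- at distance d + 1 from w it continues to the least neighbour c′ of c with
-- |c′ w| ≤ d. A walk to v that comes first either is shorter or leaves the path
-- at some c for a neighbour a < c′ with |a v| ≤ d. Everything is therefore
-- expressible by statements |u v| ≤ d, which are verified by guessing a walk,
-- and their negations, which are verified by inductive counting
-- (Immerman, Szelepcsényi): the number of vertices u with |u w| ≤ d is
-- computed from that for d − 1.
--
-- The algorithm is written as a formula of a logic with addition, access to
-- the input, existential quantification over numbers of O(log |x|) bits, and
-- iteration of a relation on pairs of numbers. Evaluating a formula needs a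
-- register for every bound variable; the registers are the tracks of a single
-- work tape, and guessing, copying or adding registers is one sweep of a
-- transducer over this tape.
module Submission where

open import Defs
open import Data.Bool.Base using (Bool; true; false; _xor_; _∧_; _∨_; if_then_else_)
open import Data.Bool.Properties using () renaming (_≟_ to _≟ᵇ_)
open import Data.Empty using (⊥; ⊥-elim)
open import Data.Fin.Base as Fin using (Fin; zero; suc; toℕ; fromℕ<; _↑ʳ_)
open import Data.Fin.Patterns using (0F; 1F; 2F; 3F; 4F; 9F)
open import Data.Fin.Properties using (+↔⊎; *↔×; 2↔Bool; 1↔⊤; toℕ-injective; toℕ<n; toℕ-fromℕ<; fromℕ<-toℕ; injective⇒≤)
open import Data.List.Base as List using (List; []; _∷_; _++_; _∷ʳ_; _ʳ++_; length; map; replicate; concatMap; tabulate; allFin; head; last)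
open import Data.List.Membership.Propositional using (_∈_)
open import Data.List.Membership.Propositional.Properties using (∈-map⁺; ∈-map⁻; ∈-lookup)
open import Data.List.Properties using (length-map; length-++; length-replicate; length-tabulate; map-++; ++-assoc; ++-identityʳ; ʳ++-ʳ++)
open import Data.List.Relation.Binary.Lex.Core using (base; this; next)
open import Data.List.Relation.Binary.Lex.Strict using (Lex-<; <-transitive; <-irreflexive)
import Data.List.Relation.Binary.Pointwise as Pointwise
open import Data.List.Relation.Unary.All as All using (All; []; _∷_)
open import Data.List.Relation.Unary.AllPairs using ([]; _∷_)
open import Data.List.Relation.Unary.Any using (here; there)
open import Data.List.Relation.Unary.Linked using (Linked; []; [-]; _∷_)
open import Data.List.Relation.Unary.Unique.Propositional using (Unique)
open import Data.Maybe.Base using (Maybe; just; nothing)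
open import Data.Nat.Base using (ℕ; zero; suc; _+_; _*_; _^_; _∸_; _⊓_; _⊔_; _≤_; _<_; z≤n; s≤s; _≡ᵇ_; ⌈_/2⌉; ⌊_/2⌋)
open import Data.Nat.DivMod using (_/_; _%_; m≡m%n+[m/n]*n; m%n<n; m<n*o⇒m/o<n)
open import Data.Nat.Induction using (<-rec)
open import Data.Nat.Logarithm using (⌈log₂_⌉; ⌈log₂⌉-mono-≤; ⌈log₂2*n⌉≡1+⌈log₂n⌉; ⌈log₂2^n⌉≡n; ⌈log₂⌈n/2⌉⌉≡⌈log₂n⌉∸1)
open import Data.Nat.Properties
open import Data.Nat.Solver using (module +-*-Solver)
open import Data.Product.Base using (_×_; _,_; proj₁; proj₂; ∃-syntax; Σ-syntax)
open import Data.Product.Function.NonDependent.Propositional using (_×-↔_)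
open import Data.Sum.Base using (_⊎_; inj₁; inj₂)
open import Data.Sum.Function.Propositional using (_⊎-↔_)
open import Data.Unit.Base using (⊤; tt)
open import Data.Vec.Base as Vec using (Vec; []; _∷_; lookup)
open import Function.Base using (_∘_; id)
open import Function.Bundles using (_⇔_; mk⇔; Equivalence; _↔_; mk↔ₛ′; Inverse)
open import Function.Construct.Composition using (_↔-∘_)
open import Function.Construct.Identity using (↔-id)
open import Function.Construct.Symmetry using (↔-sym)
open import Relation.Binary.Construct.Closure.ReflexiveTransitive using (Star; ε; _◅_; _◅◅_; gmap)
open import Relation.Binary.Definitions using (tri<; tri≈; tri>)
open import Relation.Binary.PropositionalEquality using (_≡_; _≢_; refl; trans; cong; cong₂; subst; subst₂; module ≡-Reasoning) renaming (sym to ≡-sym)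
open import Relation.Binary.Structures using (IsStrictTotalOrder)
open import Relation.Nullary.Decidable using (Dec; yes; no; does; _×-dec_; _⊎-dec_; ¬?; dec-true)
open import Relation.Nullary.Negation.Core using (¬_)
open import Relation.Unary using (Decidable)
open +-*-Solver using (solve; _:+_; _:*_; con; _:=_)

-- Finite types

-- The space bound covers every reachable configuration, also those of computations that have
-- guessed wrongly. Hence the strip gets its width before the program starts and no instruction
-- changes it; a sum that overflows it has no continuation. Sequence, choice, guessing and loops of
-- nondeterministic programs give ∧, ∨, ∃ and iteration but no negation, so every negative statement
-- needs a positive certificate of its own. For numbers and input symbols one is at hand, and a loop
-- that visits all numbers below a bound serves as a bounded ∀; unreachability is the one case that
-- requires counting. The range B of the registers is not visible to a formula. The truth of the
-- final formula is therefore shown to be the right one for every B > |x| + 1. Walks may pause at a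
-- vertex, so that exactly d steps stand for distance at most d and all loops have a prescribed
-- number of rounds.

Finite : Set → Set
Finite A = ∃[ n ] (A ↔ Fin n)

finite-↔ : {A B : Set} → A ↔ B → Finite B → Finite A
finite-↔ f (n , g) = n , (g ↔-∘ f)

finite-⊤ : Finite ⊤
finite-⊤ = 1 , ↔-sym 1↔⊤

finite-Bool : Finite Bool
finite-Bool = 2 , ↔-sym 2↔Bool

finite-⊎ : {A B : Set} → Finite A → Finite B → Finite (A ⊎ B)
finite-⊎ (m , f) (n , g) = m + n , (↔-sym +↔⊎ ↔-∘ (f ⊎-↔ g))

finite-× : {A B : Set} → Finite A → Finite B → Finite (A × B)
finite-× (m , f) (n , g) = m * n , (↔-sym *↔× ↔-∘ (f ×-↔ g))

finite-Maybe : {A : Set} → Finite A → Finite (Maybe A)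
finite-Maybe {A} f = finite-↔
  (mk↔ₛ′ (λ { nothing → inj₁ tt ; (just a) → inj₂ a })
         (λ { (inj₁ tt) → nothing ; (inj₂ a) → just a })
         (λ { (inj₁ tt) → refl ; (inj₂ a) → refl })
         (λ { nothing → refl ; (just a) → refl }))
  (finite-⊎ finite-⊤ f)

finite-Vec : {A : Set} → Finite A → ∀ n → Finite (Vec A n)
finite-Vec f zero = finite-↔
  (mk↔ₛ′ (λ _ → tt) (λ _ → Vec.[]) (λ { tt → refl }) (λ { Vec.[] → refl })) finite-⊤
finite-Vec f (suc n) = finite-↔
  (mk↔ₛ′ (λ { (a Vec.∷ v) → a , v }) (λ { (a , v) → a Vec.∷ v })
         (λ { (a , v) → refl }) (λ { (a Vec.∷ v) → refl }))
  (finite-× f (finite-Vec f n))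

-- A work tape carries  ⊲ c₁ … c_L ⊳, where the columns cᵢ are bit vectors;
-- track r of the columns holds register r in binary, least digit first.
Column : ℕ → Set
Column R = Vec Bool R

Cell : ℕ → Set
Cell R = Maybe (Maybe (Maybe (Column R)))

pattern empty = nothing
pattern ⊲     = just nothing
pattern ⊳     = just (just nothing)
pattern col c = just (just (just c))

-- A copy of `Tape`, which exists only relative to a machine, whereas programs receive their
-- semantics before a machine is built from them.
record Strip (R : ℕ) : Set where
  constructor strip
  field
    lefts  : List (Cell R)
    under  : Cell R
    rights : List (Cell R)

open Strip

shift : ∀ {R} → Move → Strip R → Strip R
shift left  (strip []       c rs)       = strip [] empty (c ∷ rs)
shift left  (strip (l ∷ ls) c rs)       = strip ls l (c ∷ rs)
shift stay  t                           = t
shift right (strip ls       c [])       = strip (c ∷ ls) empty []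
shift right (strip ls       c (r ∷ rs)) = strip (c ∷ ls) r rs

Store : ℕ → Set
Store R = ℕ × Strip R

Effect : ℕ → Set
Effect R = Move × Cell R × Move

apply : ∀ {R} → List Symbol → Effect R → Store R → Store R
apply x (m , c , d) (i , t) = moveInput x m i , shift d (strip (lefts t) c (rights t))

extent : ∀ {R} → Strip R → ℕ
extent t = length (lefts t) + suc (length (rights t))

-- The Boolean is the state carried from column to column, in an addition the carry. Several results
-- are a nondeterministic choice, none is a rejection.
Transducer : ℕ → Set
Transducer R = Bool → Column R → List (Bool × Column R)

infixr 6 _⨾_
infixr 5 _⊕_
infix 7 _✶

-- The control structure is that of regular expressions. `inp` is a test of the scanned input symbol
-- and a move at once; an instruction whose test fails has no continuation, so a conditional is a
-- choice between tests.
data Prog (R : ℕ) : Set where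
  sweep   : Transducer R → Bool → Prog R
  inp     : (InputSymbol Symbol → Bool) → Move → Prog R
  _⨾_ _⊕_ : Prog R → Prog R → Prog R
  _✶      : Prog R → Prog R

pattern ready = nothing
pattern back  = just nothing
pattern fwd k = just (just k)

Loc : ∀ {R} → Prog R → Set
Loc (sweep f k) = Maybe (Maybe Bool)
Loc (inp f m)   = ⊤
Loc (P ⨾ Q)     = Loc P ⊎ Loc Q
Loc (P ⊕ Q)     = ⊤ ⊎ (Loc P ⊎ Loc Q)
Loc (P ✶)       = ⊤ ⊎ Loc P

finite-Loc : ∀ {R} (P : Prog R) → Finite (Loc P)
finite-Loc (sweep f k) = finite-Maybe (finite-Maybe finite-Bool)
finite-Loc (inp f m)   = finite-⊤
finite-Loc (P ⨾ Q)     = finite-⊎ (finite-Loc P) (finite-Loc Q)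
finite-Loc (P ⊕ Q)     = finite-⊎ finite-⊤ (finite-⊎ (finite-Loc P) (finite-Loc Q))
finite-Loc (P ✶)       = finite-⊎ finite-⊤ (finite-Loc P)

entry : ∀ {R} (P : Prog R) → Loc P
entry (sweep f k) = ready
entry (inp f m)   = tt
entry (P ⨾ Q)     = inj₁ (entry P)
entry (P ⊕ Q)     = inj₁ tt
entry (P ✶)       = inj₁ tt

-- The target `nothing` is the exit.
Transition : ℕ → Set → Set
Transition R L = Maybe L × Effect R

retarget : ∀ {R} {L L′ : Set} → (Maybe L → Maybe L′) → Transition R L → Transition R L′
retarget g (e , a) = g e , a

⨾-first : ∀ {R} (P Q : Prog R) → Maybe (Loc P) → Maybe (Loc (P ⨾ Q))
⨾-first P Q nothing  = just (inj₂ (entry Q))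
⨾-first P Q (just l) = just (inj₁ l)

⨾-second : ∀ {R} (P Q : Prog R) → Maybe (Loc Q) → Maybe (Loc (P ⨾ Q))
⨾-second P Q nothing  = nothing
⨾-second P Q (just l) = just (inj₂ l)

⊕-first : ∀ {R} (P Q : Prog R) → Maybe (Loc P) → Maybe (Loc (P ⊕ Q))
⊕-first P Q nothing  = nothing
⊕-first P Q (just l) = just (inj₂ (inj₁ l))

⊕-second : ∀ {R} (P Q : Prog R) → Maybe (Loc Q) → Maybe (Loc (P ⊕ Q))
⊕-second P Q nothing  = nothing
⊕-second P Q (just l) = just (inj₂ (inj₂ l))

✶-body : ∀ {R} (P : Prog R) → Maybe (Loc P) → Maybe (Loc (P ✶))
✶-body P nothing  = just (inj₁ tt)
✶-body P (just l) = just (inj₂ l)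

emit : ∀ {R} → Bool × Column R → Transition R (Maybe (Maybe Bool))
emit (k , c) = just (fwd k) , stay , col c , right

transitions : ∀ {R} (P : Prog R) → Loc P → InputSymbol Symbol → Cell R → List (Transition R (Loc P))
transitions (sweep f k) ready       σ ⊲       = (just (fwd k) , stay , ⊲ , right) ∷ []
transitions (sweep f k) ready       σ _       = []
transitions (sweep f k) (fwd k′)    σ (col c) = map emit (f k′ c)
-- With a carry left over at the right end there is no transition: this rejects sums that do not fit
-- into the strip.
transitions (sweep f k) (fwd false) σ ⊳       = (just back , stay , ⊳ , left) ∷ []
transitions (sweep f k) (fwd _)     σ _       = []
transitions (sweep f k) back        σ (col c) = (just back , stay , col c , left) ∷ []
transitions (sweep f k) back        σ ⊲       = (nothing , stay , ⊲ , stay) ∷ []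
transitions (sweep f k) back        σ _       = []
transitions (inp f m)   tt          σ c       = if f σ then (nothing , m , c , stay) ∷ [] else []
transitions (P ⨾ Q) (inj₁ l) σ c = map (retarget (⨾-first P Q)) (transitions P l σ c)
transitions (P ⨾ Q) (inj₂ l) σ c = map (retarget (⨾-second P Q)) (transitions Q l σ c)
transitions (P ⊕ Q) (inj₁ tt) σ c =
  (just (inj₂ (inj₁ (entry P))) , stay , c , stay) ∷ (just (inj₂ (inj₂ (entry Q))) , stay , c , stay) ∷ []
transitions (P ⊕ Q) (inj₂ (inj₁ l)) σ c = map (retarget (⊕-first P Q)) (transitions P l σ c)
transitions (P ⊕ Q) (inj₂ (inj₂ l)) σ c = map (retarget (⊕-second P Q)) (transitions Q l σ c)
transitions (P ✶) (inj₁ tt) σ c =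
  (nothing , stay , c , stay) ∷ (just (inj₂ (entry P)) , stay , c , stay) ∷ []
transitions (P ✶) (inj₂ l) σ c = map (retarget (✶-body P)) (transitions P l σ c)

State↓ : ∀ {R} → Prog R → Set
State↓ {R} P = Maybe (Loc P) × Store R

data LStep {R} (P : Prog R) (x : List Symbol) : State↓ P → State↓ P → Set where
  lstep : ∀ {l s e a} → (e , a) ∈ transitions P l (readInput x (proj₁ s)) (under (proj₂ s)) →
          LStep P x (just l , s) (e , apply x a s)

-- Between two instructions the head rests on the left end of the strip.
Memory : ℕ → Set
Memory R = ℕ × List (Column R)

body : ∀ {R} → List (Column R) → List (Cell R)
body cs = map (λ c → col c) cs ++ ⊳ ∷ []

parked : ∀ {R} → List (Column R) → Strip R
parked cs = strip [] ⊲ (body cs)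

↑_ : ∀ {R} → Memory R → Store R
↑ (i , cs) = i , parked cs

-- Input-output semantics of programs and its agreement with the transitions

data Sweeps {R} (f : Transducer R) : Bool → List (Column R) → List (Column R) → Set where
  []  : Sweeps f false [] []
  _∷_ : ∀ {k k′ c c′ cs cs′} → (k′ , c′) ∈ f k c → Sweeps f k′ cs cs′ → Sweeps f k (c ∷ cs) (c′ ∷ cs′)

-- Forgets everything between two parked positions of the work head. `within-step` and `runs⇒steps`
-- show that nothing is lost with respect to the transitions.
data Runs {R} (x : List Symbol) : Prog R → Memory R → Memory R → Set where
  sweep : ∀ {f k i cs cs′} → Sweeps f k cs cs′ → Runs x (sweep f k) (i , cs) (i , cs′)
  inp   : ∀ {f m i cs} → f (readInput x i) ≡ true → Runs x (inp f m) (i , cs) (moveInput x m i , cs)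
  _⨾_   : ∀ {P Q h h₁ h₂} → Runs x P h h₁ → Runs x Q h₁ h₂ → Runs x (P ⨾ Q) h h₂
  ⊕ˡ    : ∀ {P Q h h₁} → Runs x P h h₁ → Runs x (P ⊕ Q) h h₁
  ⊕ʳ    : ∀ {P Q h h₁} → Runs x Q h h₁ → Runs x (P ⊕ Q) h h₁
  _✶    : ∀ {P h h₁} → Star (Runs x P) h h₁ → Runs x (P ✶) h h₁

width : ∀ {R} → Memory R → ℕ
width h = length (proj₂ h)

sweeps-width : ∀ {R} {f : Transducer R} {k cs cs′} → Sweeps f k cs cs′ → length cs′ ≡ length cs
sweeps-width []       = refl
sweeps-width (_ ∷ sw) = cong suc (sweeps-width sw)

mutual
  -- The source of the space bound: transducers replace columns one by one, so the strip keeps the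
  -- length it had at the start.
  runs-width : ∀ {R x} {P : Prog R} {h h′} → Runs x P h h′ → width h′ ≡ width h
  runs-width (sweep sw) = sweeps-width sw
  runs-width (inp _)    = refl
  runs-width (r ⨾ r₁)   = trans (runs-width r₁) (runs-width r)
  runs-width (⊕ˡ r)     = runs-width r
  runs-width (⊕ʳ r)     = runs-width r
  runs-width (rs ✶)     = runs✶-width rs

  runs✶-width : ∀ {R x} {P : Prog R} {h h′} → Star (Runs x P) h h′ → width h′ ≡ width h
  runs✶-width ε        = refl
  runs✶-width (r ◅ rs) = trans (runs✶-width rs) (runs-width r)

-- The head inside the strip: `ds` are the columns to its left, nearest first.
focus : ∀ {R} → List (Cell R) → List (Cell R) → Strip R
focus ls []       = strip ls empty []
focus ls (c ∷ rs) = strip ls c rs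

prefix : ∀ {R} → List (Column R) → List (Cell R)
prefix ds = map (λ c → col c) ds ++ ⊲ ∷ []

ahead : ∀ {R} → List (Column R) → List (Column R) → Strip R
ahead ds cs = focus (prefix ds) (body cs)

focus-left : ∀ {R} → List (Column R) → List (Cell R) → Strip R
focus-left []       rs = strip [] ⊲ rs
focus-left (d ∷ ds) rs = strip (prefix ds) (col d) rs

behind : ∀ {R} → List (Column R) → List (Column R) → Strip R
behind ds cs = focus-left ds (body cs)

shift-right : ∀ {R} (ls : List (Cell R)) c cs → shift right (strip ls c (body cs)) ≡ focus (c ∷ ls) (body cs)
shift-right ls c []      = refl
shift-right ls c (_ ∷ _) = refl

shift-left : ∀ {R} (ds : List (Column R)) c rs →
             shift left (strip (prefix ds) c rs) ≡ focus-left ds (c ∷ rs)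
shift-left []      c rs = refl
shift-left (_ ∷ _) c rs = refl

-- The stores that may occur at a location when P is started with memory h.
Within : ∀ {R} → List Symbol → (P : Prog R) → Memory R → Loc P → Store R → Set
Within x (sweep f k) h ready    s = s ≡ ↑ h
Within {R} x (sweep f k) h (fwd k′) s =
  ∃[ ds ] ∃[ cs ] s ≡ (proj₁ h , ahead ds cs) × length ds + length cs ≡ width h ×
    -- A derivation of `Sweeps` grows at its front, the processed part of the strip at its end. The
    -- invariant therefore says how any completion of the sweep extends to the whole strip.
    (∀ cs′ → Sweeps f k′ cs cs′ → Sweeps f k (proj₂ h) (ds ʳ++ cs′))
Within x (sweep f k) h back     s =
  ∃[ ds ] ∃[ cs ] s ≡ (proj₁ h , behind ds cs) × length ds + length cs ≡ width h ×
    Sweeps f k (proj₂ h) (ds ʳ++ cs)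
Within x (inp f m) h tt s = s ≡ ↑ h
Within x (P ⨾ Q) h (inj₁ l) s = Within x P h l s
Within x (P ⨾ Q) h (inj₂ l) s = ∃[ h₁ ] Runs x P h h₁ × Within x Q h₁ l s
Within x (P ⊕ Q) h (inj₁ tt) s = s ≡ ↑ h
Within x (P ⊕ Q) h (inj₂ (inj₁ l)) s = Within x P h l s
Within x (P ⊕ Q) h (inj₂ (inj₂ l)) s = Within x Q h l s
Within x (P ✶) h (inj₁ tt) s = ∃[ h₁ ] Star (Runs x P) h h₁ × s ≡ ↑ h₁
Within x (P ✶) h (inj₂ l) s = ∃[ h₁ ] Star (Runs x P) h h₁ × Within x P h₁ l s

Within⁺ : ∀ {R} → List Symbol → (P : Prog R) → Memory R → Maybe (Loc P) → Store R → Set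
Within⁺ x P h (just l) s = Within x P h l s
Within⁺ x P h nothing  s = ∃[ h′ ] Runs x P h h′ × s ≡ ↑ h′

within-entry : ∀ {R} x (P : Prog R) h → Within x P h (entry P) (↑ h)
within-entry x (sweep f k) h = refl
within-entry x (inp f m) h = refl
within-entry x (P ⨾ Q) h = within-entry x P h
within-entry x (P ⊕ Q) h = refl
within-entry x (P ✶) h = h , ε , refl

-- Since the invariant survives every choice, the exit is reached only with memories that `Runs`
-- permits, and `within-extent` applies to unsuccessful computations as well.
within-step : ∀ {R} x (P : Prog R) h l s {e a} → Within x P h l s →
              (e , a) ∈ transitions P l (readInput x (proj₁ s)) (under (proj₂ s)) →
              Within⁺ x P h e (apply x a s)
within-step x (sweep f k) (i , cs) ready _ refl (here refl) =
  [] , cs , cong (i ,_) (shift-right [] ⊲ cs) , refl , λ _ sw → sw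
within-step x (sweep f k) h (fwd k′) _ (ds , c ∷ cs , refl , len , hyp) e∈
  with (k″ , c′) , f∈ , refl ← ∈-map⁻ emit e∈ =
  c′ ∷ ds , cs , cong (proj₁ h ,_) (shift-right _ _ cs) , trans (≡-sym (+-suc _ _)) len , λ cs′ sw → hyp (c′ ∷ cs′) (f∈ ∷ sw)
within-step x (sweep f k) h (fwd false) _ (ds , [] , refl , len , hyp) (here refl) =
  ds , [] , cong (proj₁ h ,_) (shift-left ds _ _) , len , hyp [] []
within-step x (sweep f k) h back _ ([] , cs , refl , len , sw) (here refl) = (proj₁ h , cs) , sweep sw , refl
within-step x (sweep f k) h back _ (d ∷ ds , cs , refl , len , sw) (here refl) =
  ds , d ∷ cs , cong (proj₁ h ,_) (shift-left ds _ _) , trans (+-suc _ _) len , sw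
within-step x (inp f m) h tt _ refl e∈ with f (readInput x (proj₁ h)) in eq
within-step x (inp f m) h tt _ refl (here refl) | true = _ , inp eq , refl
within-step x (P ⨾ Q) h (inj₁ l) s w e∈ with ∈-map⁻ (retarget (⨾-first P Q)) e∈
... | (just l′ , a) , p∈ , refl = within-step x P h l s w p∈
... | (nothing , a) , p∈ , refl with h₁ , r , eq ← within-step x P h l s w p∈ =
  h₁ , r , subst (Within x Q h₁ (entry Q)) (≡-sym eq) (within-entry x Q h₁)
within-step x (P ⨾ Q) h (inj₂ l) s (h₁ , r , w) e∈ with ∈-map⁻ (retarget (⨾-second P Q)) e∈
... | (just l′ , a) , p∈ , refl = h₁ , r , within-step x Q h₁ l s w p∈
... | (nothing , a) , p∈ , refl with h₂ , r₂ , eq ← within-step x Q h₁ l s w p∈ = h₂ , (r ⨾ r₂) , eq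
within-step x (P ⊕ Q) h (inj₁ tt) _ refl (here refl) = within-entry x P h
within-step x (P ⊕ Q) h (inj₁ tt) _ refl (there (here refl)) = within-entry x Q h
within-step x (P ⊕ Q) h (inj₂ (inj₁ l)) s w e∈ with ∈-map⁻ (retarget (⊕-first P Q)) e∈
... | (just l′ , a) , p∈ , refl = within-step x P h l s w p∈
... | (nothing , a) , p∈ , refl with h₁ , r , eq ← within-step x P h l s w p∈ = h₁ , ⊕ˡ r , eq
within-step x (P ⊕ Q) h (inj₂ (inj₂ l)) s w e∈ with ∈-map⁻ (retarget (⊕-second P Q)) e∈
... | (just l′ , a) , p∈ , refl = within-step x Q h l s w p∈
... | (nothing , a) , p∈ , refl with h₁ , r , eq ← within-step x Q h l s w p∈ = h₁ , ⊕ʳ r , eq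
within-step x (P ✶) h (inj₁ tt) _ (h₁ , rs , refl) (here refl) = h₁ , (rs ✶) , refl
within-step x (P ✶) h (inj₁ tt) _ (h₁ , rs , refl) (there (here refl)) = h₁ , rs , within-entry x P h₁
within-step x (P ✶) h (inj₂ l) s (h₁ , rs , w) e∈ with ∈-map⁻ (retarget (✶-body P)) e∈
... | (just l′ , a) , p∈ , refl = h₁ , rs , within-step x P h₁ l s w p∈
... | (nothing , a) , p∈ , refl with h₂ , r , eq ← within-step x P h₁ l s w p∈ = h₂ , (rs ◅◅ (r ◅ ε)) , eq

length-body : ∀ {R} (cs : List (Column R)) → length (body cs) ≡ suc (length cs)
length-body cs = trans (length-++ (map _ cs)) (trans (+-comm _ 1) (cong suc (length-map _ cs)))

length-prefix : ∀ {R} (ds : List (Column R)) → length (prefix ds) ≡ suc (length ds)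
length-prefix ds = trans (length-++ (map _ ds)) (trans (+-comm _ 1) (cong suc (length-map _ ds)))

extent-parked : ∀ {R} (cs : List (Column R)) → extent (parked cs) ≡ 2 + length cs
extent-parked cs = cong suc (length-body cs)

extent-ahead : ∀ {R} (ds cs : List (Column R)) → extent (ahead ds cs) ≡ 2 + (length ds + length cs)
extent-ahead ds []       = trans (cong (_+ 1) (length-prefix ds)) (cong suc (+-suc _ 0))
extent-ahead ds (c ∷ cs) =
  trans (cong₂ _+_ (length-prefix ds) (cong suc (length-body cs))) (cong suc (+-suc _ _))

extent-behind : ∀ {R} (ds cs : List (Column R)) → extent (behind ds cs) ≡ 2 + (length ds + length cs)
extent-behind []       cs = extent-parked cs
extent-behind (d ∷ ds) cs =
  trans (cong₂ _+_ (length-prefix ds) (cong suc (length-body cs)))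
        (cong suc (trans (+-suc _ _) (cong suc (+-suc _ _))))

within-extent : ∀ {R} x (P : Prog R) h l s → Within x P h l s → extent (proj₂ s) ≡ 2 + width h
within-extent x (sweep f k) h ready _ refl = extent-parked (proj₂ h)
within-extent x (sweep f k) h (fwd k′) _ (ds , cs , refl , len , _) = trans (extent-ahead ds cs) (cong (2 +_) len)
within-extent x (sweep f k) h back _ (ds , cs , refl , len , _) = trans (extent-behind ds cs) (cong (2 +_) len)
within-extent x (inp f m) h tt _ refl = extent-parked (proj₂ h)
within-extent x (P ⨾ Q) h (inj₁ l) s w = within-extent x P h l s w
within-extent x (P ⨾ Q) h (inj₂ l) s (h₁ , r , w) = trans (within-extent x Q h₁ l s w) (cong (2 +_) (runs-width r))
within-extent x (P ⊕ Q) h (inj₁ tt) _ refl = extent-parked (proj₂ h)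
within-extent x (P ⊕ Q) h (inj₂ (inj₁ l)) s w = within-extent x P h l s w
within-extent x (P ⊕ Q) h (inj₂ (inj₂ l)) s w = within-extent x Q h l s w
within-extent x (P ✶) h (inj₁ tt) _ (h₁ , rs , refl) =
  trans (extent-parked (proj₂ h₁)) (cong (2 +_) (runs✶-width rs))
within-extent x (P ✶) h (inj₂ l) s (h₁ , rs , w) =
  trans (within-extent x P h₁ l s w) (cong (2 +_) (runs✶-width rs))

within⁺-extent : ∀ {R} x (P : Prog R) h e s → Within⁺ x P h e s → extent (proj₂ s) ≡ 2 + width h
within⁺-extent x P h (just l) s w = within-extent x P h l s w
within⁺-extent x P h nothing _ (h₁ , r , refl) = trans (extent-parked (proj₂ h₁)) (cong (2 +_) (runs-width r))

-- Embeds the computations of a part into the whole program. The map `g` sends the exit of the part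
-- to whatever comes next, which may be a location of the whole.
retarget-steps : ∀ {R} (P Q : Prog R) {x} (g : Maybe (Loc P) → Maybe (Loc Q)) →
  (∀ l → ∃[ l′ ] g (just l) ≡ just l′ ×
    (∀ σ c → transitions Q l′ σ c ≡ map (retarget g) (transitions P l σ c))) →
  ∀ {e s e′ s′} → Star (LStep P x) (e , s) (e′ , s′) → Star (LStep Q x) (g e , s) (g e′ , s′)
retarget-steps P Q {x} g hyp = gmap (λ (e , s) → g e , s) one
  where
  one : ∀ {t t′} → LStep P x t t′ → LStep Q x (g (proj₁ t) , proj₂ t) (g (proj₁ t′) , proj₂ t′)
  one (lstep {l} {s} e∈) with l′ , eq , same ← hyp l rewrite eq =
    lstep (subst (_ ∈_) (≡-sym (same _ _)) (∈-map⁺ (retarget g) e∈))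

sweep-forth : ∀ {R x} {f : Transducer R} {k₀ k cs cs′} → Sweeps f k cs cs′ → ∀ i ds →
  Star (LStep (sweep f k₀) x) (just (fwd k) , i , ahead ds cs) (just back , i , behind (cs′ ʳ++ ds) [])
sweep-forth [] i []       = lstep (here refl) ◅ ε
sweep-forth [] i (d ∷ ds) = lstep (here refl) ◅ ε
sweep-forth {cs = c ∷ []}     (f∈ ∷ sw) i ds = lstep (∈-map⁺ emit f∈) ◅ sweep-forth sw i (_ ∷ ds)
sweep-forth {cs = c ∷ _ ∷ cs} (f∈ ∷ sw) i ds = lstep (∈-map⁺ emit f∈) ◅ sweep-forth sw i (_ ∷ ds)

sweep-back : ∀ {R x} {f : Transducer R} {k₀} i ds cs →
  Star (LStep (sweep f k₀) x) (just back , i , behind ds cs) (nothing , i , parked (ds ʳ++ cs))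
sweep-back i []           cs = lstep (here refl) ◅ ε
sweep-back i (d ∷ [])     cs = lstep (here refl) ◅ sweep-back i [] (d ∷ cs)
sweep-back i (d ∷ e ∷ ds) cs = lstep (here refl) ◅ sweep-back i (e ∷ ds) (d ∷ cs)

∈-if : {A : Set} {a : A} {b : Bool} → b ≡ true → a ∈ (if b then a ∷ [] else [])
∈-if refl = here refl

mutual
  runs⇒steps : ∀ {R x} {P : Prog R} {h h′} → Runs x P h h′ →
               Star (LStep P x) (just (entry P) , ↑ h) (nothing , ↑ h′)
  runs⇒steps {x = x} (sweep {f} {k} {i} {cs} {cs′} sw) =
    lstep (here refl) ◅ subst (λ t → Star _ (_ , i , t) _) (≡-sym (shift-right [] ⊲ cs))
      (subst (λ cs″ → Star _ _ (nothing , i , parked cs″)) (rev-rev cs′)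
        (sweep-forth sw i [] ◅◅ sweep-back i (cs′ ʳ++ []) []))
    where
    rev-rev : ∀ cs → (cs ʳ++ []) ʳ++ [] ≡ cs
    rev-rev cs = trans (ʳ++-ʳ++ cs) (++-identityʳ cs)
  runs⇒steps {x = x} (inp eq) = lstep (∈-if eq) ◅ ε
  runs⇒steps (_⨾_ {P} {Q} r r₁) =
    retarget-steps P (P ⨾ Q) (⨾-first P Q) (λ l → _ , refl , λ _ _ → refl) (runs⇒steps r) ◅◅
    retarget-steps Q (P ⨾ Q) (⨾-second P Q) (λ l → _ , refl , λ _ _ → refl) (runs⇒steps r₁)
  runs⇒steps (⊕ˡ {P} {Q} r) =
    lstep (here refl) ◅ retarget-steps P (P ⊕ Q) (⊕-first P Q) (λ l → _ , refl , λ _ _ → refl) (runs⇒steps r)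
  runs⇒steps (⊕ʳ {P} {Q} r) =
    lstep (there (here refl)) ◅
    retarget-steps Q (P ⊕ Q) (⊕-second P Q) (λ l → _ , refl , λ _ _ → refl) (runs⇒steps r)
  runs⇒steps (rs ✶) = runs✶⇒steps rs

  runs✶⇒steps : ∀ {R x} {P : Prog R} {h h′} → Star (Runs x P) h h′ →
                Star (LStep (P ✶) x) (just (inj₁ tt) , ↑ h) (nothing , ↑ h′)
  runs✶⇒steps ε = lstep (here refl) ◅ ε
  runs✶⇒steps {P = P} (r ◅ rs) =
    lstep (there (here refl)) ◅
    (retarget-steps P (P ✶) (✶-body P) (λ l → _ , refl , λ _ _ → refl) (runs⇒steps r) ◅◅ runs✶⇒steps rs)

-- Registers and machines

digit : Bool → ℕ
digit false = 0
digit true  = 1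

-- Registers are named by natural numbers, and a missing one reads as 0. So `compile` works for any
-- number of tracks, and only the proofs ask for enough of them.
bitAt : ∀ {R} → ℕ → Column R → Bool
bitAt r       Vec.[]       = false
bitAt zero    (b Vec.∷ _)  = b
bitAt (suc r) (_ Vec.∷ bs) = bitAt r bs

get : ∀ {R} → ℕ → List (Column R) → ℕ
get r []       = 0
get r (c ∷ cs) = digit (bitAt r c) + 2 * get r cs

digit≤1 : ∀ b → digit b ≤ 1
digit≤1 false = z≤n
digit≤1 true  = s≤s z≤n

get<2^ : ∀ {R} r (cs : List (Column R)) → get r cs < 2 ^ length cs
get<2^ r []       = s≤s z≤n
get<2^ r (c ∷ cs) = begin-strict
  digit (bitAt r c) + 2 * get r cs ≤⟨ +-monoˡ-≤ _ (digit≤1 (bitAt r c)) ⟩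
  1 + 2 * get r cs                 <⟨ n<1+n _ ⟩
  2 + 2 * get r cs                 ≡⟨ ≡-sym (*-suc 2 (get r cs)) ⟩
  2 * suc (get r cs)               ≤⟨ *-monoʳ-≤ 2 (get<2^ r cs) ⟩
  2 ^ length (c ∷ cs)              ∎
  where open ≤-Reasoning

readInput-inside : ∀ {A : Set} (x : List A) i → i ≤ length x → readInput x i ≢ ⊣
readInput-inside x       zero          _         ()
readInput-inside (a ∷ x) (suc zero)    _         ()
readInput-inside (a ∷ x) (suc (suc i)) (s≤s i≤n) eq = readInput-inside x (suc i) i≤n eq

readInput-outside : ∀ {A : Set} (x : List A) i → length x ≤ i → readInput x (suc i) ≡ ⊣
readInput-outside []      i       _         = refl
readInput-outside (a ∷ x) (suc i) (s≤s n≤i) = readInput-outside x i n≤i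

-- For n ≥ 1 the hypothesis gives 2 ^ L ≤ 2n + 3 ≤ 8n, hence the 3; for n = 0 the number 8n is
-- useless, but 2 ^ L ≤ 3 suffices.
log-bound : ∀ L n → 2 ^ L ≤ suc (2 * suc n) → L ≤ 3 + ⌈log₂ n ⌉
log-bound L zero 2^L≤3 = begin
  L              ≡⟨ ≡-sym (⌈log₂2^n⌉≡n L) ⟩
  ⌈log₂ 2 ^ L ⌉  ≤⟨ ⌈log₂⌉-mono-≤ 2^L≤3 ⟩
  2              ≤⟨ n≤1+n 2 ⟩
  3              ∎
  where open ≤-Reasoning
log-bound L n@(suc m) 2^L≤ = begin
  L                          ≡⟨ ≡-sym (⌈log₂2^n⌉≡n L) ⟩
  ⌈log₂ 2 ^ L ⌉              ≤⟨ ⌈log₂⌉-mono-≤ (≤-trans 2^L≤ 2n+3≤8n) ⟩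
  ⌈log₂ 2 * (2 * (2 * n)) ⌉  ≡⟨ ⌈log₂2*n⌉≡1+⌈log₂n⌉ (2 * (2 * n)) ⟩
  1 + ⌈log₂ 2 * (2 * n) ⌉    ≡⟨ cong suc (⌈log₂2*n⌉≡1+⌈log₂n⌉ (2 * n)) ⟩
  2 + ⌈log₂ 2 * n ⌉          ≡⟨ cong (2 +_) (⌈log₂2*n⌉≡1+⌈log₂n⌉ n) ⟩
  3 + ⌈log₂ n ⌉              ∎
  where
  open ≤-Reasoning
  2n+3≤8n : suc (2 * suc n) ≤ 2 * (2 * (2 * n))
  2n+3≤8n = begin
    suc (2 * suc n)            ≡⟨ solve 1 (λ m → con 1 :+ con 2 :* (con 2 :+ m) := con 5 :+ con 2 :* m) refl m ⟩
    5 + 2 * m                  ≤⟨ m≤m+n _ (3 + 6 * m) ⟩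
    5 + 2 * m + (3 + 6 * m)    ≡⟨ solve 1 (λ m → con 5 :+ con 2 :* m :+ (con 3 :+ con 6 :* m) := con 2 :* (con 2 :* (con 2 :* (con 1 :+ m)))) refl m ⟩
    2 * (2 * (2 * n))          ∎

-- The first bound makes each input position a register value, including |x| + 1 for the right end
-- marker; the second one keeps the strip logarithmic.
Adequate : ∀ {R} → List Symbol → Memory R → Set
Adequate x h = suc (length x) < 2 ^ width h × 2 ^ width h ≤ suc (2 * suc (length x))

pattern lay    = zero
pattern extend = suc zero
pattern carry  = suc (suc zero)
pattern return = suc (suc (suc zero))

-- Before running P, the machine counts the input positions in binary on
-- track 0. The resulting counter is the strip of registers: it is wide
-- enough for all numbers up to |x| + 1 and has O(log |x|) columns.
State : ∀ {R} → Prog R → Set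
State P = Fin 4 ⊎ Maybe (Loc P)

module _ {r : ℕ} (P : Prog (suc r)) where

  -- The work head is back at the left end. The input head moves in step with each increment of the
  -- counter, so the counter shows its position until ⊣ is met and the program can start.
  rewound : InputSymbol Symbol → List (State P × Effect (suc r))
  rewound ⊣ = (inj₂ (just (entry P)) , stay , ⊲ , stay) ∷ []
  rewound _ = (inj₁ carry , right , ⊲ , right) ∷ []

  moves : State P → InputSymbol Symbol → Cell (suc r) → List (State P × Effect (suc r))
  moves (inj₁ lay)    σ _                        = (inj₁ extend , stay , ⊲ , right) ∷ []
  moves (inj₁ extend) σ _                        = (inj₁ return , stay , ⊳ , left) ∷ []
  moves (inj₁ carry)  σ (col (true  Vec.∷ c))    = (inj₁ carry , stay , col (false Vec.∷ c) , right) ∷ []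
  moves (inj₁ carry)  σ (col (false Vec.∷ c))    = (inj₁ return , stay , col (true Vec.∷ c) , left) ∷ []
  -- The counter overflows: the end marker becomes a new leading digit, and `extend` sets the marker
  -- one cell further.
  moves (inj₁ carry)  σ ⊳                        = (inj₁ extend , stay , col (true Vec.∷ Vec.replicate r false) , right) ∷ []
  moves (inj₁ carry)  σ _                        = []
  moves (inj₁ return) σ (col c)                  = (inj₁ return , stay , col c , left) ∷ []
  moves (inj₁ return) σ ⊲                        = rewound σ
  moves (inj₁ return) σ _                        = []
  moves (inj₂ (just l)) σ c                      = map (λ (e , a) → inj₂ e , a) (transitions P l σ c)
  moves (inj₂ nothing)  σ c                      = []

  data GStep (x : List Symbol) : State P × Store (suc r) → State P × Store (suc r) → Set where
    gstep : ∀ {q s q′ a} → (q′ , a) ∈ moves q (readInput x (proj₁ s)) (under (proj₂ s)) →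
            GStep x (q , s) (q′ , apply x a s)

  Inv : List Symbol → State P → Store (suc r) → Set
  Inv x (inj₁ lay) (i , t) = i ≡ 0 × t ≡ strip [] empty []
  Inv x (inj₁ extend) (i , t) = ∃[ ds ] t ≡ strip (prefix ds) empty [] × i ≤ suc (length x) ×
    get 0 (ds ʳ++ []) ≡ i × 2 ^ length ds ≤ suc (2 * i)
  Inv x (inj₁ carry) (i , t) = ∃[ ds ] ∃[ cs ] t ≡ ahead ds cs × i ≤ suc (length x) ×
    2 ^ length ds * suc (get 0 cs) ≡ i × (∀ cs′ → get 0 (ds ʳ++ cs′) ≡ 2 ^ length ds * get 0 cs′) ×
    2 ^ (length ds + length cs) ≤ 2 * i
  Inv x (inj₁ return) (i , t) = ∃[ ds ] ∃[ cs ] t ≡ behind ds cs × i ≤ suc (length x) ×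
    get 0 (ds ʳ++ cs) ≡ i × 2 ^ (length ds + length cs) ≤ suc (2 * i)
  Inv x (inj₂ e) s = ∃[ h ] Adequate x h × Within⁺ x P h e s

  double-out : ∀ a b → a * suc (digit true + 2 * b) ≡ 2 * a * suc b
  double-out a b = solve 2 (λ a b → a :* (con 2 :+ con 2 :* b) := con 2 :* a :* (con 1 :+ b)) refl a b

  double-swap : ∀ a b → a * (2 * b) ≡ 2 * a * b
  double-swap a b = solve 2 (λ a b → a :* (con 2 :* b) := con 2 :* a :* b) refl a b

  rewound-inside : ∀ x i → i ≤ length x → rewound (readInput x i) ≡ (inj₁ carry , right , ⊲ , right) ∷ []
  rewound-inside x i i≤n with readInput x i | readInput-inside x i i≤n
  ... | ⊢     | _  = refl
  ... | ⊣     | ≢⊣ = ⊥-elim (≢⊣ refl)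
  ... | sym _ | _  = refl

  inv-step : ∀ x q s {q′ a} → Inv x q s →
             (q′ , a) ∈ moves q (readInput x (proj₁ s)) (under (proj₂ s)) → Inv x q′ (apply x a s)
  inv-step x (inj₁ lay) _ (refl , refl) (here refl) = [] , refl , z≤n , refl , s≤s z≤n
  inv-step x (inj₁ extend) (i , _) (ds , refl , i≤ , val , wid) (here refl) =
    ds , [] , shift-left ds ⊳ [] , i≤ , val , subst (λ k → 2 ^ k ≤ suc (2 * i)) (≡-sym (+-identityʳ (length ds))) wid
  inv-step x (inj₁ carry) (i , _) (ds , (true Vec.∷ c) ∷ cs , refl , i≤ , val , zeros , wid) (here refl) =
    _ ∷ ds , cs , shift-right _ _ cs , i≤ , trans (≡-sym (double-out (2 ^ length ds) _)) val ,
    (λ cs′ → trans (zeros _) (double-swap (2 ^ length ds) _)) ,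
    subst (λ k → 2 ^ k ≤ 2 * i) (+-suc (length ds) (length cs)) wid
  inv-step x (inj₁ carry) (i , _) (ds , (false Vec.∷ c) ∷ cs , refl , i≤ , val , zeros , wid) (here refl) =
    ds , _ ∷ cs , shift-left ds _ _ , i≤ , trans (zeros _) val , m≤n⇒m≤1+n wid
  -- The carry leaves a strip of L columns only if i = 2 ^ L, so the new column gives 2 ^ (L + 1) =
  -- 2i.
  inv-step x (inj₁ carry) (i , _) (ds , [] , refl , i≤ , val , zeros , wid) (here refl) =
    _ ∷ ds , refl , i≤ , trans (zeros _) val ,
    m≤n⇒m≤1+n (*-monoʳ-≤ 2 (≤-reflexive (trans (≡-sym (*-identityʳ (2 ^ length ds))) val)))
  inv-step x (inj₁ return) (i , _) (d ∷ ds , cs , refl , i≤ , val , wid) (here refl) =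
    ds , d ∷ cs , shift-left ds _ _ , i≤ , val ,
    subst (λ k → 2 ^ k ≤ suc (2 * i)) (≡-sym (+-suc (length ds) (length cs))) wid
  inv-step x (inj₁ return) (i , _) ([] , cs , refl , i≤ , val , wid) q∈ with i ≤? length x
  ... | yes i≤n rewrite rewound-inside x i i≤n with here refl ← q∈ =
    [] , cs , shift-right [] ⊲ cs , m⊓n≤n (suc i) _ ,
    trans (+-identityʳ _) (trans (cong suc val) (≡-sym (m≤n⇒m⊓n≡m (s≤s i≤n)))) , (λ _ → ≡-sym (+-identityʳ _)) ,
    subst (λ j → 2 ^ length cs ≤ 2 * j) (≡-sym (m≤n⇒m⊓n≡m (s≤s i≤n)))
      (≤-trans wid (≤-trans (n≤1+n _) (≤-reflexive (≡-sym (*-suc 2 i)))))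
  -- The counter shows |x| + 1, and whatever it shows is below 2 ^ width: the first half of
  -- `Adequate`.
  ... | no i≰n with refl ← ≤-antisym i≤ (≰⇒> i≰n) rewrite readInput-outside x (length x) ≤-refl with here refl ← q∈ =
    (suc (length x) , cs) , (subst (_< 2 ^ length cs) val (get<2^ 0 cs) , wid) , within-entry x P _
  inv-step x (inj₂ (just l)) s (h , ok , w) q∈ with (e , a) , e∈ , refl ← ∈-map⁻ _ q∈ =
    h , ok , within-step x P h l s w e∈

  inv-steps : ∀ x {p p′} → Star (GStep x) p p′ → Inv x (proj₁ p) (proj₂ p) → Inv x (proj₁ p′) (proj₂ p′)
  inv-steps x ε inv = inv
  inv-steps x (gstep {q} {s} q∈ ◅ steps) inv = inv-steps x steps (inv-step x q s inv q∈)

  inv-extent : ∀ x q s → Inv x q s → ∃[ L ] extent (proj₂ s) ≤ 2 + L × 2 ^ L ≤ suc (2 * suc (length x))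
  inv-extent x (inj₁ lay) _ (refl , refl) = 0 , s≤s z≤n , s≤s z≤n
  inv-extent x (inj₁ extend) _ (ds , refl , i≤ , _ , wid) =
    length ds , ≤-reflexive (trans (cong (_+ 1) (length-prefix ds)) (+-comm _ 1)) ,
    ≤-trans wid (s≤s (*-monoʳ-≤ 2 i≤))
  inv-extent x (inj₁ carry) _ (ds , cs , refl , i≤ , _ , _ , wid) =
    _ , ≤-reflexive (extent-ahead ds cs) , m≤n⇒m≤1+n (≤-trans wid (*-monoʳ-≤ 2 i≤))
  inv-extent x (inj₁ return) _ (ds , cs , refl , i≤ , _ , wid) =
    _ , ≤-reflexive (extent-behind ds cs) , ≤-trans wid (s≤s (*-monoʳ-≤ 2 i≤))
  inv-extent x (inj₂ e) s (h , (_ , wid) , w) = width h , ≤-reflexive (within⁺-extent x P h e s w) , wid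

  returns : ∀ x i ds cs → Star (GStep x) (inj₁ return , i , behind ds cs) (inj₁ return , i , parked (ds ʳ++ cs))
  returns x i []           cs = ε
  returns x i (d ∷ [])     cs = gstep (here refl) ◅ ε
  returns x i (d ∷ e ∷ ds) cs = gstep (here refl) ◅ returns x i (e ∷ ds) (d ∷ cs)

  carries : ∀ x i ds cs → ∃[ ds′ ] ∃[ cs′ ]
            Star (GStep x) (inj₁ carry , i , ahead ds cs) (inj₁ return , i , behind ds′ cs′)
  carries x i ds [] = (true Vec.∷ Vec.replicate r false) ∷ ds , [] , gstep (here refl) ◅ gstep (here refl) ◅ ε
  carries x i ds ((false Vec.∷ c) ∷ cs) = ds , (true Vec.∷ c) ∷ cs ,
    gstep (here refl) ◅ subst (λ t → Star (GStep x) (_ , i , t) (_ , i , behind ds ((true Vec.∷ c) ∷ cs))) (≡-sym (shift-left ds _ _)) ε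
  carries x i ds ((true Vec.∷ c) ∷ cs) with _ , _ , steps ← carries x i (_ ∷ ds) cs = _ , _ ,
    gstep (here refl) ◅ subst (λ t → Star (GStep x) (_ , i , t) _) (≡-sym (shift-right _ _ cs)) steps

  counts : ∀ x j i cs → j + i ≡ suc (length x) → ∃[ cs′ ]
           Star (GStep x) (inj₁ return , i , parked cs) (inj₂ (just (entry P)) , suc (length x) , parked cs′)
  counts x zero _ cs refl = cs , gstep last∈ ◅ ε
    where
    last∈ : (inj₂ (just (entry P)) , stay , ⊲ , stay) ∈ rewound (readInput x (suc (length x)))
    last∈ rewrite readInput-outside x (length x) ≤-refl = here refl
  counts x (suc j) i cs eq
    with ds′ , cs′ , steps ← carries x (suc i) [] cs
    with cs″ , rest ← counts x j (suc i) (ds′ ʳ++ cs′) (trans (+-suc j i) eq) =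
    cs″ , gstep first∈ ◅ subst
      (λ s → Star (GStep x) (inj₁ carry , s) (inj₂ (just (entry P)) , suc (length x) , parked cs″))
      (≡-sym (cong₂ _,_ (m≤n⇒m⊓n≡m (s≤s i≤n)) (shift-right [] ⊲ cs))) (steps ◅◅ (returns x _ ds′ cs′ ◅◅ rest))
    where
    i≤n : i ≤ length x
    i≤n = ≤-trans (m≤n+m i j) (≤-reflexive (suc-injective eq))
    first∈ : (inj₁ carry , right , ⊲ , right) ∈ rewound (readInput x i)
    first∈ rewrite rewound-inside x i i≤n = here refl

  blankState : State P × Store (suc r)
  blankState = inj₁ lay , 0 , strip [] empty []

  prepares : ∀ x → ∃[ h ] Adequate x h × Star (GStep x) blankState (inj₂ (just (entry P)) , ↑ h)
  prepares x with cs , steps ← counts x (suc (length x)) 0 [] (+-identityʳ _) = _ , adequate , all-steps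
    where
    all-steps : Star (GStep x) blankState (inj₂ (just (entry P)) , ↑ (suc (length x) , cs))
    all-steps = gstep (here refl) ◅ gstep (here refl) ◅ steps
    -- The width reached by this particular run is not computed; the invariant of all runs bounds
    -- it.
    adequate : Adequate x (suc (length x) , cs)
    adequate with h , ok , w ← inv-steps x all-steps (refl , refl) =
      subst (λ L → suc (length x) < 2 ^ L × 2 ^ L ≤ suc (2 * suc (length x)))
        (+-cancelˡ-≡ 2 _ _ (trans (≡-sym (within-extent x P h _ _ w)) (extent-parked cs))) ok

  runs⇒gsteps : ∀ {x h h′} → Runs x P h h′ → Star (GStep x) (inj₂ (just (entry P)) , ↑ h) (inj₂ nothing , ↑ h′)
  runs⇒gsteps r = gmap (λ (e , s) → inj₂ e , s) (λ { (lstep e∈) → gstep (∈-map⁺ _ e∈) }) (runs⇒steps r)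

  machine : NTM Symbol
  machine = record
    { State       = State P
    ; #states     = proj₁ finite-State
    ; finiteState = proj₂ finite-State
    ; Γ           = Cell (suc r)
    ; #Γ          = proj₁ finite-Cell
    ; finiteΓ     = proj₂ finite-Cell
    ; blank       = empty
    ; #tapes      = 1
    ; start       = inj₁ lay
    ; accept      = inj₂ nothing
    ; δ           = λ q σ cs → map (λ (q′ , m , c , d) → q′ , m , (c , d) Vec.∷ Vec.[]) (moves q σ (Vec.head cs))
    }
    where
    finite-State : Finite (State P)
    finite-State = finite-⊎ (4 , ↔-id _) (finite-Maybe (finite-Loc P))
    finite-Cell : Finite (Cell (suc r))
    finite-Cell = finite-Maybe (finite-Maybe (finite-Maybe (finite-Vec finite-Bool (suc r))))

  open Computation machine

  strip↓ : Tape → Strip (suc r)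
  strip↓ (tape ls c rs) = strip ls c rs

  tape↑ : Strip (suc r) → Tape
  tape↑ (strip ls c rs) = tape ls c rs

  config↓ : Config → State P × Store (suc r)
  config↓ (config q i (t Vec.∷ Vec.[])) = q , i , strip↓ t

  config↑ : State P × Store (suc r) → Config
  config↑ (q , i , t) = config q i (tape↑ t Vec.∷ Vec.[])

  strip↓-writeMove : ∀ c d t → strip↓ (writeMove (c , d) t) ≡ shift d (strip (before t) c (after t))
  strip↓-writeMove c left  (tape []       _ rs)      = refl
  strip↓-writeMove c left  (tape (_ ∷ _)  _ rs)      = refl
  strip↓-writeMove c stay  (tape ls       _ rs)      = refl
  strip↓-writeMove c right (tape ls       _ [])      = refl
  strip↓-writeMove c right (tape ls       _ (_ ∷ _)) = refl

  step↓ : ∀ {x c c′} → Step x c c′ → GStep x (config↓ c) (config↓ c′)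
  step↓ {x} {config q i (t Vec.∷ Vec.[])} (step a∈) with (q′ , m , c , d) , q∈ , refl ← ∈-map⁻ _ a∈ =
    subst (λ t′ → GStep x _ (q′ , moveInput x m i , t′)) (≡-sym (strip↓-writeMove c d t)) (gstep q∈)

  step↑ : ∀ {x p p′} → GStep x p p′ → Step x (config↑ p) (config↑ p′)
  step↑ {x} (gstep {q} {i , t} {q′} {m , c , d} q∈) =
    subst (λ t′ → Step x _ (config q′ (moveInput x m i) (t′ Vec.∷ Vec.[])))
      (cong tape↑ (strip↓-writeMove c d (tape↑ t))) (step (∈-map⁺ _ q∈))

  reachable-inv : ∀ {x c} → Reachable x c → Inv x (proj₁ (config↓ c)) (proj₂ (config↓ c))
  reachable-inv {x} steps = inv-steps x (gmap config↓ step↓ steps) (refl , refl)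

  accepts⇒runs : ∀ {x} → Accepts machine x → ∃[ h ] ∃[ h′ ] Adequate x h × Runs x P h h′
  accepts⇒runs (config _ i (t Vec.∷ Vec.[]) , steps , refl) with h , ok , h′ , r , _ ← reachable-inv steps =
    h , h′ , ok , r

  runs⇒accepts : ∀ {x} → (∀ h → Adequate x h → ∃[ h′ ] Runs x P h h′) → Accepts machine x
  runs⇒accepts {x} runs with h , ok , steps ← prepares x with h′ , r ← runs h ok =
    _ , gmap config↑ step↑ (steps ◅◅ runs⇒gsteps r) , refl

  logSpace : LogSpace machine
  -- 5 counts the two end markers and the 3 of `log-bound`.
  logSpace = 5 , λ x c steps → bound x c (reachable-inv steps)
    where
    bound : ∀ x c → Inv x (proj₁ (config↓ c)) (proj₂ (config↓ c)) → space c ≤ 5 * suc ⌈log₂ length x ⌉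
    bound x (config q i (t Vec.∷ Vec.[])) inv with L , ext , wid ← inv-extent x q _ inv = begin
      visited t + 0                               ≡⟨ +-identityʳ _ ⟩
      extent (strip↓ t)                           ≤⟨ ext ⟩
      2 + L                                       ≤⟨ +-monoʳ-≤ 2 (log-bound L (length x) wid) ⟩
      5 + ⌈log₂ length x ⌉                        ≤⟨ +-monoʳ-≤ 5 (m≤n*m _ 5) ⟩
      5 + 5 * ⌈log₂ length x ⌉                    ≡⟨ ≡-sym (*-suc 5 _) ⟩
      5 * suc ⌈log₂ length x ⌉                    ∎
      where open ≤-Reasoning

-- Operations on registers

setBit : ∀ {R} → ℕ → Bool → Column R → Column R
setBit r       b Vec.[]       = Vec.[]
setBit zero    b (_ Vec.∷ bs) = b Vec.∷ bs
setBit (suc r) b (a Vec.∷ bs) = a Vec.∷ setBit r b bs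

bitAt-setBit : ∀ {R} r b (c : Column R) → r < R → bitAt r (setBit r b c) ≡ b
bitAt-setBit zero    b (_ Vec.∷ c) _         = refl
bitAt-setBit (suc r) b (_ Vec.∷ c) (s≤s r<R) = bitAt-setBit r b c r<R

bitAt-setBit-other : ∀ {R} r q b (c : Column R) → q ≢ r → bitAt q (setBit r b c) ≡ bitAt q c
bitAt-setBit-other r       q       b Vec.[]      _   = refl
bitAt-setBit-other zero    zero    b (_ Vec.∷ c) q≢r = ⊥-elim (q≢r refl)
bitAt-setBit-other zero    (suc q) b (_ Vec.∷ c) q≢r = refl
bitAt-setBit-other (suc r) zero    b (_ Vec.∷ c) q≢r = refl
bitAt-setBit-other (suc r) (suc q) b (_ Vec.∷ c) q≢r = bitAt-setBit-other r q b c (q≢r ∘ cong suc)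

reg : ∀ {R} → ℕ → Memory R → ℕ
reg r h = get r (proj₂ h)

bit-unique : ∀ p q m n → digit p + 2 * m ≡ digit q + 2 * n → p ≡ q × m ≡ n
bit-unique false false m n eq = refl , *-cancelˡ-≡ m n 2 eq
bit-unique true  true  m n eq = refl , *-cancelˡ-≡ m n 2 (suc-injective eq)
bit-unique false true  m n eq = ⊥-elim (even≢odd m n eq)
bit-unique true  false m n eq = ⊥-elim (even≢odd n m (≡-sym eq))

bit-split : ∀ m → ∃[ b ] ∃[ n ] m ≡ digit b + 2 * n
bit-split zero = false , 0 , refl
bit-split (suc m) with bit-split m
... | false , n , refl = true , n , refl
... | true  , n , refl = false , suc n , ≡-sym (*-suc 2 n)

guessᵗ : ∀ {R} → ℕ → Transducer R
guessᵗ r k c = (k , setBit r false c) ∷ (k , setBit r true c) ∷ []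

copyᵗ : ∀ {R} → ℕ → ℕ → Transducer R
copyᵗ r q k c = (k , setBit r (bitAt q c) c) ∷ []

_⊞_⊞_ : Bool → Bool → Bool → Bool
a ⊞ b ⊞ c = a xor (b xor c)

majority : Bool → Bool → Bool → Bool
majority false b c = b ∧ c
majority true  b c = b ∨ c

full-adder : ∀ a b c → digit a + digit b + digit c ≡ digit (a ⊞ b ⊞ c) + 2 * digit (majority a b c)
full-adder false false false = refl
full-adder false false true  = refl
full-adder false true  false = refl
full-adder false true  true  = refl
full-adder true  false false = refl
full-adder true  false true  = refl
full-adder true  true  false = refl
full-adder true  true  true  = refl

-- A full adder that compares its sum digit with the one on track `a` instead of writing it. Results
-- are guessed beforehand, so this one test yields addition, subtraction, order and successor.
checkᵗ : ∀ {R} → ℕ → ℕ → ℕ → Transducer R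
checkᵗ a b c k v =
  if does (bitAt a v ≟ᵇ (bitAt b v ⊞ bitAt c v ⊞ k)) then (majority (bitAt b v) (bitAt c v) k , v) ∷ [] else []

guess : ∀ {R} → ℕ → Prog R
guess r = sweep (guessᵗ r) false

copy : ∀ {R} → ℕ → ℕ → Prog R
copy r q = sweep (copyᵗ r q) false

check : ∀ {R} → ℕ → ℕ → ℕ → Bool → Prog R
check a b c = sweep (checkᵗ a b c)

guess-frame : ∀ {R x r} {h h′ : Memory R} → Runs x (guess r) h h′ → ∀ {q} → q ≢ r → reg q h′ ≡ reg q h
guess-frame {r = r} (sweep sw) {q} q≢r = go sw
  where
  go : ∀ {cs cs′ k} → Sweeps (guessᵗ r) k cs cs′ → get q cs′ ≡ get q cs
  go [] = refl
  go (_∷_ {c = c} (here refl) sw)         = cong₂ (λ b n → digit b + 2 * n) (bitAt-setBit-other r q _ c q≢r) (go sw)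
  go (_∷_ {c = c} (there (here refl)) sw) = cong₂ (λ b n → digit b + 2 * n) (bitAt-setBit-other r q _ c q≢r) (go sw)

guess-sweeps : ∀ {R r} → r < R → ∀ (cs : List (Column R)) y → y < 2 ^ length cs →
               ∃[ cs′ ] Sweeps (guessᵗ r) false cs cs′ × get r cs′ ≡ y
guess-sweeps r<R []       zero    _        = [] , [] , refl
guess-sweeps r<R []       (suc y) (s≤s ())
guess-sweeps {r = r} r<R (c ∷ cs) y y< with b , n , refl ← bit-split y
  with cs′ , sw , eq ← guess-sweeps r<R cs n (*-cancelˡ-< 2 n _ (≤-<-trans (m≤n+m _ (digit b)) y<)) =
  setBit r b c ∷ cs′ , member b ∷ sw , cong₂ (λ b n → digit b + 2 * n) (bitAt-setBit r b c r<R) eq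
  where
  member : ∀ b → (false , setBit r b c) ∈ guessᵗ r false c
  member false = here refl
  member true  = there (here refl)

guess-any : ∀ {R x r} → r < R → ∀ (h : Memory R) y → y < 2 ^ width h → ∃[ h′ ] Runs x (guess r) h h′ × reg r h′ ≡ y
guess-any r<R (i , cs) y y< with cs′ , sw , eq ← guess-sweeps r<R cs y y< = _ , sweep sw , eq

copy-frame : ∀ {R x r p} {h h′ : Memory R} → Runs x (copy r p) h h′ → ∀ {q} → q ≢ r → reg q h′ ≡ reg q h
copy-frame {r = r} {p} (sweep sw) {q} q≢r = go sw
  where
  go : ∀ {cs cs′ k} → Sweeps (copyᵗ r p) k cs cs′ → get q cs′ ≡ get q cs
  go [] = refl
  go (_∷_ {c = c} (here refl) sw) = cong₂ (λ b n → digit b + 2 * n) (bitAt-setBit-other r q _ c q≢r) (go sw)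

copy-value : ∀ {R x r p} {h h′ : Memory R} → r < R → Runs x (copy r p) h h′ → reg r h′ ≡ reg p h
copy-value {r = r} {p} r<R (sweep sw) = go sw
  where
  go : ∀ {cs cs′ k} → Sweeps (copyᵗ r p) k cs cs′ → get r cs′ ≡ get p cs
  go [] = refl
  go (_∷_ {c = c} (here refl) sw) = cong₂ (λ b n → digit b + 2 * n) (bitAt-setBit r _ c r<R) (go sw)

copy-sweeps : ∀ {R} r p (cs : List (Column R)) → ∃[ cs′ ] Sweeps (copyᵗ r p) false cs cs′
copy-sweeps r p []       = [] , []
copy-sweeps r p (c ∷ cs) with cs′ , sw ← copy-sweeps r p cs = _ , here refl ∷ sw

copy-runs : ∀ {R x r p} (h : Memory R) → ∃[ h′ ] Runs x (copy r p) h h′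
copy-runs {r = r} {p} (i , cs) with cs′ , sw ← copy-sweeps r p cs = _ , sweep sw

add-digits : ∀ b c k m n → digit b + 2 * m + (digit c + 2 * n) + digit k ≡
                           digit (b ⊞ c ⊞ k) + 2 * (m + n + digit (majority b c k))
add-digits b c k m n = begin
  digit b + 2 * m + (digit c + 2 * n) + digit k
    ≡⟨ solve 5 (λ b c k m n → b :+ con 2 :* m :+ (c :+ con 2 :* n) :+ k := b :+ c :+ k :+ con 2 :* (m :+ n))
         refl (digit b) (digit c) (digit k) m n ⟩
  digit b + digit c + digit k + 2 * (m + n)
    ≡⟨ cong (_+ 2 * (m + n)) (full-adder b c k) ⟩
  digit (b ⊞ c ⊞ k) + 2 * digit (majority b c k) + 2 * (m + n)
    ≡⟨ solve 3 (λ s t u → s :+ con 2 :* t :+ con 2 :* u := s :+ con 2 :* (u :+ t))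
         refl (digit (b ⊞ c ⊞ k)) (digit (majority b c k)) (m + n) ⟩
  digit (b ⊞ c ⊞ k) + 2 * (m + n + digit (majority b c k)) ∎
  where open ≡-Reasoning

check-sweeps : ∀ {R a b c k} {cs cs′ : List (Column R)} → Sweeps (checkᵗ a b c) k cs cs′ →
               cs′ ≡ cs × get a cs ≡ get b cs + get c cs + digit k
check-sweeps [] = refl , refl
check-sweeps {a = a} {b} {c} {k} (_∷_ {c = v} v∈ sw) with bitAt a v ≟ᵇ (bitAt b v ⊞ bitAt c v ⊞ k)
check-sweeps {a = a} {b} {c} {k} (_∷_ {c = v} {cs = cs} (here refl) sw) | yes eq with refl , val ← check-sweeps {a = a} sw =
  refl , trans (cong₂ (λ b n → digit b + 2 * n) eq val)
               (≡-sym (add-digits (bitAt b v) (bitAt c v) k (get b cs) (get c cs)))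

check-sound : ∀ {R x a b c β} {h h′ : Memory R} → Runs x (check a b c β) h h′ →
              h′ ≡ h × reg a h ≡ reg b h + reg c h + digit β
check-sound {a = a} (sweep {i = i} sw) with eq , val ← check-sweeps {a = a} sw = cong (i ,_) eq , val

check-runs : ∀ {R x a b c} β (h : Memory R) → reg a h ≡ reg b h + reg c h + digit β → Runs x (check a b c β) h h
check-runs {a = a} {b} {c} β (i , cs) val = sweep (go cs β val)
  where
  go : ∀ cs k → get a cs ≡ get b cs + get c cs + digit k → Sweeps (checkᵗ a b c) k cs cs
  go []       false _ = []
  go (v ∷ cs) k val
    with eq , val′ ← bit-unique _ _ _ _ (trans val (add-digits (bitAt b v) (bitAt c v) k (get b cs) (get c cs))) =
    member ∷ go cs _ val′
    where
    member : (majority (bitAt b v) (bitAt c v) k , v) ∈ checkᵗ a b c k v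
    member = ∈-if (dec-true (bitAt a v ≟ᵇ (bitAt b v ⊞ bitAt c v ⊞ k)) eq)

-- Formulas and their evaluation

infixr 6 _∧′_
infixr 5 _∨′_

-- Positive existential logic with iteration over an input word. The variables
-- range over numbers below a bound B; the two variables of `iter` are
-- initialised by the first formula, updated by the second (new values before
-- old ones) and finally tested by the third.
data Form (k : ℕ) : Set where
  sum  : (a b c : Fin k) → Bool → Form k
  at   : Fin k → (InputSymbol Symbol → Bool) → Form k
  _∧′_ : Form k → Form k → Form k
  _∨′_ : Form k → Form k → Form k
  ex   : Form (1 + k) → Form k
  iter : Form (2 + k) → Form (4 + k) → Form (2 + k) → Form k

module Truth (x : List Symbol) (B : ℕ) where

  ⟦_⟧ : ∀ {k} → Form k → Vec ℕ k → Set
  ⟦ sum a b c β ⟧ ρ = lookup ρ a ≡ lookup ρ b + lookup ρ c + digit β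
  ⟦ at a f ⟧ ρ      = f (readInput x (lookup ρ a)) ≡ true
  ⟦ φ ∧′ ψ ⟧ ρ      = ⟦ φ ⟧ ρ × ⟦ ψ ⟧ ρ
  ⟦ φ ∨′ ψ ⟧ ρ      = ⟦ φ ⟧ ρ ⊎ ⟦ ψ ⟧ ρ
  ⟦ ex φ ⟧ ρ        = ∃[ y ] y < B × ⟦ φ ⟧ (y Vec.∷ ρ)
  ⟦ iter φ ψ χ ⟧ ρ  = ∃[ y ] ∃[ z ] y < B × z < B × ⟦ φ ⟧ (y Vec.∷ z Vec.∷ ρ) ×
    ∃[ y′ ] ∃[ z′ ]
      Star (λ (y , z) (y′ , z′) → y′ < B × z′ < B × ⟦ ψ ⟧ (y′ Vec.∷ z′ Vec.∷ y Vec.∷ z Vec.∷ ρ)) (y , z) (y′ , z′) ×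
      ⟦ χ ⟧ (y′ Vec.∷ z′ Vec.∷ ρ)

-- The variable bound at depth k lives in register k.
var : ∀ {k} → Fin k → ℕ
var {suc k} zero    = k
var {suc k} (suc i) = var i

var< : ∀ {k} (i : Fin k) → var i < k
var< zero    = ≤-refl
var< (suc i) = m≤n⇒m≤1+n (var< i)

-- Registers needed above those of the k free variables. Apart from bound variables only `at` takes
-- some, the three of `advance`; the parts of a formula run one after the other and reuse the same
-- registers, hence the maxima.
scratch : ∀ {k} → Form k → ℕ
scratch (sum a b c β) = 0
scratch (at a f)      = 3
scratch (φ ∧′ ψ)      = scratch φ ⊔ scratch ψ
scratch (φ ∨′ ψ)      = scratch φ ⊔ scratch ψ
scratch (ex φ)        = 1 + scratch φ
scratch (iter φ ψ χ)  = (2 + scratch φ) ⊔ ((4 + scratch ψ) ⊔ (2 + scratch χ))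

anything : InputSymbol Symbol → Bool
anything _ = true

is⊢ : InputSymbol Symbol → Bool
is⊢ ⊢ = true
is⊢ _ = false

-- The input head stands wherever the previous access left it. Too many moves to the left are
-- harmless, too few fail the test.
rewind : ∀ {R} → Prog R
rewind = inp anything left ✶ ⨾ inp is⊢ stay

-- Registers k, k+1, k+2 hold a counter, its old value, and zero.
advance : ∀ {R} → ℕ → Prog R
advance k = inp anything right ⨾ copy (1 + k) k ⨾ guess k ⨾ check k (1 + k) (2 + k) true

-- The new pair is guessed beside the old one, because the update formula relates the two; it
-- replaces the old pair only after the test.
transfer : ∀ {R} → ℕ → Prog R → Prog R
transfer k P = guess (2 + k) ⨾ guess (3 + k) ⨾ P ⨾ copy k (2 + k) ⨾ copy (1 + k) (3 + k)

compile : ∀ {R k} → Form k → Prog R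
compile (sum a b c β) = check (var a) (var b) (var c) β
compile {k = k} (at a f) =
  -- Zero is obtained as the only number z with z = z + z; `isZero` uses the same equation.
  rewind ⨾ guess (2 + k) ⨾ check (2 + k) (2 + k) (2 + k) false ⨾ copy k (2 + k) ⨾
  -- The loop may stop anywhere, but only a stop at the value of `a` passes the check that follows
  -- it.
  advance k ✶ ⨾ check (var a) k (2 + k) false ⨾ inp f stay
compile (φ ∧′ ψ) = compile φ ⨾ compile ψ
compile (φ ∨′ ψ) = compile φ ⊕ compile ψ
compile {k = k} (ex φ) = guess k ⨾ compile φ
compile {k = k} (iter φ ψ χ) =
  guess k ⨾ guess (1 + k) ⨾ compile φ ⨾ transfer k (compile ψ) ✶ ⨾ compile χ

-- Correctness of the compilation of formulas

record Agree {R} (k : ℕ) (h h′ : Memory R) : Set where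
  constructor agree
  field agreed : ∀ {q} → q < k → reg q h′ ≡ reg q h

open Agree

Matches : ∀ {R k} → Vec ℕ k → Memory R → Set
Matches Vec.[]              h = ⊤
Matches {k = suc k} (y Vec.∷ ρ) h = reg k h ≡ y × Matches ρ h

matches-lookup : ∀ {R k} {ρ : Vec ℕ k} {h : Memory R} → Matches ρ h → ∀ i → reg (var i) h ≡ lookup ρ i
matches-lookup {ρ = _ Vec.∷ _} (eq , m) zero    = eq
matches-lookup {ρ = _ Vec.∷ _} (eq , m) (suc i) = matches-lookup m i

matches-agree : ∀ {R k} {ρ : Vec ℕ k} {h h′ : Memory R} → Agree k h h′ → Matches ρ h → Matches ρ h′
matches-agree {ρ = Vec.[]}    ag m        = tt
matches-agree {ρ = _ Vec.∷ _} ag (eq , m) =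
  trans (agreed ag ≤-refl) eq , matches-agree (agree (λ q< → agreed ag (m≤n⇒m≤1+n q<))) m

agree-trans : ∀ {R k} {h h₁ h₂ : Memory R} → Agree k h h₁ → Agree k h₁ h₂ → Agree k h h₂
agree-trans ag ag₁ = agree λ q< → trans (agreed ag₁ q<) (agreed ag q<)

agree-weaken : ∀ {R} j {k} {h h′ : Memory R} → Agree (j + k) h h′ → Agree k h h′
agree-weaken j ag = agree λ q< → agreed ag (≤-trans q< (m≤n+m _ j))

guess-agree : ∀ {R x r k} {h h′ : Memory R} → k ≤ r → Runs x (guess r) h h′ → Agree k h h′
guess-agree k≤r run = agree λ q< → guess-frame run (<⇒≢ (≤-trans q< k≤r))

copy-agree : ∀ {R x r p k} {h h′ : Memory R} → k ≤ r → Runs x (copy r p) h h′ → Agree k h h′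
copy-agree k≤r run = agree λ q< → copy-frame run (<⇒≢ (≤-trans q< k≤r))

⊓-step : ∀ t n → suc (t ⊓ suc n) ⊓ suc n ≡ suc t ⊓ suc n
⊓-step t n = cong suc (trans (⊓-assoc t (suc n) n) (cong (t ⊓_) (m≥n⇒m⊓n≡n (n≤1+n n))))

readInput-⊓ : ∀ (x : List Symbol) i → readInput x (i ⊓ suc (length x)) ≡ readInput x i
readInput-⊓ x i with ≤-total i (suc (length x))
... | inj₁ i≤ = cong (readInput x) (m≤n⇒m⊓n≡m i≤)
readInput-⊓ x (suc i) | inj₂ (s≤s n≤i) = trans (cong (readInput x) (m≥n⇒m⊓n≡n (s≤s n≤i)))
  (trans (readInput-outside x (length x) ≤-refl) (≡-sym (readInput-outside x i n≤i)))

is⊢-position : ∀ (x : List Symbol) i → is⊢ (readInput x i) ≡ true → i ≡ 0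
is⊢-position x       zero          _  = refl
is⊢-position (a ∷ x) (suc (suc i)) eq with () ← is⊢-position x (suc i) eq

rewind-sound : ∀ {R x} {h h′ : Memory R} → Runs x rewind h h′ → proj₁ h′ ≡ 0 × proj₂ h′ ≡ proj₂ h
rewind-sound {x = x} ((rs ✶) ⨾ inp {i = i} eq) = is⊢-position x i eq , go rs
  where
  go : ∀ {R} {h h′ : Memory R} → Star (Runs x (inp anything left)) h h′ → proj₂ h′ ≡ proj₂ h
  go ε            = refl
  go (inp _ ◅ rs) = go rs

rewind-runs : ∀ {R x} i (cs : List (Column R)) → Runs x rewind (i , cs) (0 , cs)
rewind-runs {R} {x} i cs = (go i ✶) ⨾ inp refl
  where
  go : ∀ i → Star (Runs {R} x (inp anything left)) (i , cs) (0 , cs)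
  go zero    = ε
  go (suc i) = inp refl ◅ go i

k≢1+k : ∀ {k} → k ≢ suc k
k≢1+k {k} = <⇒≢ (n<1+n k)

-- The head stops at ⊣ while the counter may go on to any register value. Beyond the input
-- `readInput` yields ⊣ too, so this truncation is invisible to `at`.
Counting : ∀ {R} → List Symbol → ℕ → Memory R → Set
Counting x k h = reg (2 + k) h ≡ 0 × proj₁ h ≡ reg k h ⊓ suc (length x)

advance-sound : ∀ {R x k} {h h′ : Memory R} → 3 + k ≤ R → Runs x (advance k) h h′ → Counting x k h →
                Counting x k h′ × reg k h′ ≡ suc (reg k h) × Agree k h h′
advance-sound {x = x} {k} {h} k<R (inp {i = i} {cs = cs} _ ⨾ c@(sweep _) ⨾ g@(sweep _) ⨾ ch) (z0 , pos)
  with refl , val ← check-sound {a = k} {1 + k} {2 + k} ch =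
  (zero′ , trans (cong (λ j → suc j ⊓ suc (length x)) pos) (trans (⊓-step _ _) (cong (_⊓ suc (length x)) (≡-sym count)))) ,
  count , agree λ q< → agreed (agree-trans (copy-agree (n≤1+n k) c) (guess-agree ≤-refl g)) q<
  where
  zero′ : _
  zero′ = trans (guess-frame g (<⇒≢ (≤-trans (n<1+n k) (n≤1+n _)) ∘ ≡-sym)) (trans (copy-frame c (k≢1+k ∘ ≡-sym)) z0)
  count : _
  count = trans val (trans (cong₂ (λ u v → u + v + 1)
            (trans (guess-frame g (k≢1+k ∘ ≡-sym)) (copy-value (≤-trans (n≤1+n _) k<R) c)) zero′)
            (trans (cong (_+ 1) (+-identityʳ _)) (+-comm _ 1)))

advance-runs : ∀ {R x k} (h : Memory R) → 3 + k ≤ R → suc (reg k h) < 2 ^ width h → Counting x k h →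
               ∃[ h′ ] Runs x (advance k) h h′
advance-runs {x = x} {k} h k<R t< (z0 , _)
  with h₁ , c ← copy-runs {x = x} {1 + k} {k} (moveInput x right (proj₁ h) , proj₂ h)
  with h₂ , g , val ← guess-any {x = x} {k} (≤-trans (m≤n+m _ 2) k<R) h₁ (suc (reg k h))
                        (subst (λ L → _ < 2 ^ L) (≡-sym (runs-width c)) t<) =
  h₂ , (inp refl ⨾ c ⨾ g ⨾ check-runs true h₂ (trans val (≡-sym (trans
    (cong₂ (λ u v → u + v + 1) (trans (guess-frame g (k≢1+k ∘ ≡-sym)) (copy-value (≤-trans (n≤1+n _) k<R) c))
       (trans (guess-frame g (<⇒≢ (≤-trans (n<1+n k) (n≤1+n _)) ∘ ≡-sym)) (trans (copy-frame c (k≢1+k ∘ ≡-sym)) z0)))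
    (trans (cong (_+ 1) (+-identityʳ _)) (+-comm _ 1))))))

advances-sound : ∀ {R x k} {h h′ : Memory R} → 3 + k ≤ R → Star (Runs x (advance k)) h h′ → Counting x k h →
                 Counting x k h′ × Agree k h h′
advances-sound k<R ε        cnt = cnt , agree λ _ → refl
advances-sound k<R (r ◅ rs) cnt with cnt₁ , _ , ag ← advance-sound k<R r cnt
  with cnt₂ , ag₁ ← advances-sound k<R rs cnt₁ = cnt₂ , agree-trans ag ag₁

advances-run : ∀ {R x k} j (h : Memory R) → 3 + k ≤ R → j + reg k h < 2 ^ width h → Counting x k h →
               ∃[ h′ ] Star (Runs x (advance k)) h h′ × Counting x k h′ × reg k h′ ≡ j + reg k h × Agree k h h′
advances-run zero    h k<R j< cnt = h , ε , cnt , refl , agree λ _ → refl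
advances-run {k = k} (suc j) h k<R j< cnt
  with h₁ , r ← advance-runs h k<R (≤-trans (s≤s (s≤s (m≤n+m _ j))) j<) cnt
  with cnt₁ , val , ag ← advance-sound k<R r cnt
  with h₂ , rs , cnt₂ , val₂ , ag₂ ← advances-run j h₁ k<R
         (subst (λ L → j + reg k h₁ < 2 ^ L) (≡-sym (runs-width r))
           (subst (_< 2 ^ width h) (≡-sym (trans (cong (j +_) val) (+-suc j _))) j<)) cnt₁ =
  h₂ , r ◅ rs , cnt₂ , trans val₂ (trans (cong (j +_) val) (+-suc j _)) , agree-trans ag ag₂

self-sum : ∀ z → z ≡ z + z + 0 → z ≡ 0
self-sum z eq = +-cancelˡ-≡ z _ _ (trans (≡-sym (trans eq (+-identityʳ _))) (≡-sym (+-identityʳ z)))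

module Evaluation {R : ℕ} (x : List Symbol) (L : ℕ) where
  open Truth x (2 ^ L)

  reg<bound : ∀ r (h : Memory R) → width h ≡ L → reg r h < 2 ^ L
  reg<bound r h w = subst (λ L → reg r h < 2 ^ L) w (get<2^ r (proj₂ h))

  guess-below : ∀ {r} → r < R → ∀ (h : Memory R) → width h ≡ L → ∀ {y} → y < 2 ^ L →
                ∃[ h′ ] Runs x (guess r) h h′ × reg r h′ ≡ y × width h′ ≡ L
  guess-below r<R h refl {y} y< with h′ , g , val ← guess-any r<R h y y< = h′ , g , val , runs-width g

  at-sound : ∀ {k} a f (ρ : Vec ℕ k) (h h′ : Memory R) → 3 + k ≤ R → Matches ρ h → Runs x (compile (at a f)) h h′ →
             ⟦ at a f ⟧ ρ × Agree k h h′
  at-sound {k} a f ρ h _ k<R m (rw ⨾ g@(sweep _) ⨾ z ⨾ c@(sweep _) ⨾ (rs ✶) ⨾ ch ⨾ inp {i = i} {cs = cs} ok)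
    with refl , refl ← rewind-sound rw
    with refl , z≡z+z ← check-sound {a = 2 + k} {2 + k} {2 + k} z
    with z≡0 ← self-sum _ z≡z+z
    with cnt , ag ← advances-sound k<R rs
           (trans (copy-frame c (<⇒≢ (≤-trans (n<1+n k) (n≤1+n _)) ∘ ≡-sym)) z≡0 ,
            cong (_⊓ suc (length x)) (≡-sym (trans (copy-value (≤-trans (m≤n+m _ 2) k<R) c) z≡0)))
    with refl , val ← check-sound {a = var a} {k} {2 + k} ch =
    trans (cong f (trans (≡-sym (readInput-⊓ x (lookup ρ a))) (cong (readInput x) (≡-sym position)))) ok , all
    where
    all : Agree k h _
    all = agree λ q< → agreed (agree-trans (agree-trans (guess-agree (m≤n+m k 2) g) (copy-agree ≤-refl c)) ag) q<
    position : i ≡ lookup ρ a ⊓ suc (length x)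
    position = trans (proj₂ cnt) (cong (_⊓ suc (length x)) (≡-sym
      (trans (≡-sym (matches-lookup m a)) (trans (≡-sym (agreed all (var< a)))
        (trans val (trans (cong (λ z → get k cs + z + 0) (proj₁ cnt)) (trans (+-identityʳ _) (+-identityʳ _))))))))

  at-runs : ∀ {k} a f (ρ : Vec ℕ k) (h : Memory R) → 3 + k ≤ R → width h ≡ L → Matches ρ h → ⟦ at a f ⟧ ρ →
            ∃[ h′ ] Runs x (compile (at a f)) h h′
  at-runs {k} a f ρ (i , cs) k<R w m tr
    with h₁ , g@(sweep _) , z≡0 , w₁ ← guess-below {2 + k} k<R (0 , cs) w (m^n>0 2 L)
    with h₂ , c@(sweep _) ← copy-runs {x = x} {k} {2 + k} h₁
    with t≡0 ← trans (copy-value (≤-trans (m≤n+m _ 2) k<R) c) z≡0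
    with h₃ , rs , (z₃ , pos) , val , ag ← advances-run (lookup ρ a) h₂ k<R
           (subst (λ t → lookup ρ a + t < 2 ^ width h₂) (≡-sym t≡0) (subst (_< 2 ^ width h₂) (≡-sym (+-identityʳ _))
             (subst (λ L → lookup ρ a < 2 ^ L) (≡-sym (trans (runs-width c) w₁))
               (subst (_< 2 ^ L) (matches-lookup m a) (reg<bound (var a) (i , cs) w)))))
           (trans (copy-frame c (<⇒≢ (≤-trans (n<1+n k) (n≤1+n _)) ∘ ≡-sym)) z≡0 ,
            ≡-sym (cong (_⊓ suc (length x)) t≡0)) =
    h₃ , (rewind-runs i cs ⨾ g ⨾ check-runs false h₁ (trans z≡0 (≡-sym (cong (λ z → z + z + 0) z≡0))) ⨾ c ⨾ (rs ✶) ⨾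
      check-runs false h₃ (trans value (trans (≡-sym val′)
        (≡-sym (trans (cong (λ z → reg k h₃ + z + 0) z₃) (trans (+-identityʳ _) (+-identityʳ _)))))) ⨾
      inp (trans (cong f (trans (cong (readInput x) (trans pos (cong (_⊓ suc (length x)) val′))) (readInput-⊓ x (lookup ρ a)))) tr))
    where
    all : Agree k (i , cs) h₃
    all = agree λ q< → agreed (agree-trans (agree-trans (guess-agree (m≤n+m k 2) g) (copy-agree ≤-refl c)) ag) q<
    value : reg (var a) h₃ ≡ lookup ρ a
    value = trans (agreed all (var< a)) (matches-lookup m a)
    val′ : reg k h₃ ≡ lookup ρ a
    val′ = trans val (trans (cong (lookup ρ a +_) t≡0) (+-identityʳ _))

  -- Includes that the registers of the free variables survive. `Complete` asserts only that some
  -- run exists; what that run leaves behind is then known from soundness.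
  Sound : ∀ {k} → Form k → Set
  Sound {k} φ = ∀ ρ (h h′ : Memory R) → width h ≡ L → Matches ρ h → Runs x (compile φ) h h′ → ⟦ φ ⟧ ρ × Agree k h h′

  Complete : ∀ {k} → Form k → Set
  Complete φ = ∀ ρ (h : Memory R) → width h ≡ L → Matches ρ h → ⟦ φ ⟧ ρ → ∃[ h′ ] Runs x (compile φ) h h′

  Update : ∀ {k} → Form (4 + k) → Vec ℕ k → ℕ × ℕ → ℕ × ℕ → Set
  Update ψ ρ (y , z) (y′ , z′) = y′ < 2 ^ L × z′ < 2 ^ L × ⟦ ψ ⟧ (y′ Vec.∷ z′ Vec.∷ y Vec.∷ z Vec.∷ ρ)

  transfer-sound : ∀ {k} (ψ : Form (4 + k)) → 4 + k ≤ R → Sound ψ →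
    ∀ ρ (h h′ : Memory R) → width h ≡ L → Matches ρ h → Runs x (transfer k (compile ψ)) h h′ →
    Update ψ ρ (reg (1 + k) h , reg k h) (reg (1 + k) h′ , reg k h′) × Agree k h h′
  transfer-sound {k} ψ k<R sound ρ h h′ w m (_⨾_ {h₁ = h₁} g₁ (_⨾_ {h₁ = h₂} g₂ (_⨾_ {h₁ = h₃} r (_⨾_ {h₁ = h₄} c₁ c₂))))
    with guesses ← agree-trans (guess-agree {k = 2 + k} ≤-refl g₁) (guess-agree (n≤1+n _) g₂)
    with w₂ ← trans (runs-width g₂) (trans (runs-width g₁) w)
    with tr , ag ← sound (reg (3 + k) h₂ Vec.∷ reg (2 + k) h₂ Vec.∷ reg (1 + k) h Vec.∷ reg k h Vec.∷ ρ) h₂ h₃ w₂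
           (refl , refl , agreed guesses (n<1+n _) , agreed guesses (n≤1+n _) , matches-agree (agree-weaken 2 guesses) m) r =
    subst (λ yz → Update ψ ρ (reg (1 + k) h , reg k h) yz) (≡-sym (cong₂ _,_ y′ z′))
      (reg<bound _ h₂ w₂ , reg<bound _ h₂ w₂ , tr) ,
    agree-trans (agree-weaken 2 guesses) (agree-trans (agree-weaken 4 ag)
      (agree-trans (copy-agree ≤-refl c₁) (copy-agree (n≤1+n k) c₂)))
    where
    y′ : reg (1 + k) h′ ≡ reg (3 + k) h₂
    y′ = trans (copy-value (≤-trans (m≤n+m _ 2) k<R) c₂)
           (trans (copy-frame c₁ (<⇒≢ (≤-trans (n<1+n k) (m≤n+m _ 2)) ∘ ≡-sym)) (agreed ag (n<1+n _)))
    z′ : reg k h′ ≡ reg (2 + k) h₂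
    z′ = trans (copy-frame c₂ k≢1+k) (trans (copy-value (≤-trans (m≤n+m _ 3) k<R) c₁) (agreed ag (n≤1+n _)))

  transfer-runs : ∀ {k} (ψ : Form (4 + k)) → 4 + k ≤ R → Sound ψ → Complete ψ →
    ∀ ρ (h : Memory R) → width h ≡ L → Matches ρ h → ∀ yz → Update ψ ρ (reg (1 + k) h , reg k h) yz →
    ∃[ h′ ] Runs x (transfer k (compile ψ)) h h′ × yz ≡ (reg (1 + k) h′ , reg k h′)
  transfer-runs {k} ψ k<R sound complete ρ h w m (y′ , z′) (y< , z< , tr)
    with h₁ , g₁ , refl , w₁ ← guess-below {2 + k} (≤-trans (n≤1+n _) k<R) h w z<
    with h₂ , g₂ , refl , w₂ ← guess-below {3 + k} k<R h₁ w₁ y<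
    with guesses ← agree-trans (guess-agree {k = 2 + k} ≤-refl g₁) (guess-agree (n≤1+n _) g₂)
    with m₂ ← (refl , guess-frame g₂ k≢1+k , agreed guesses (n<1+n _) , agreed guesses (n≤1+n _) ,
               matches-agree (agree-weaken 2 guesses) m)
    with h₃ , r ← complete (reg (3 + k) h₂ Vec.∷ reg (2 + k) h₁ Vec.∷ reg (1 + k) h Vec.∷ reg k h Vec.∷ ρ) h₂ w₂ m₂ tr
    with _ , ag ← sound _ h₂ h₃ w₂ m₂ r
    with h₄ , c₁ ← copy-runs {x = x} {k} {2 + k} h₃
    with h₅ , c₂ ← copy-runs {x = x} {1 + k} {3 + k} h₄ =
    h₅ , (g₁ ⨾ g₂ ⨾ r ⨾ c₁ ⨾ c₂) , ≡-sym (cong₂ _,_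
      (trans (copy-value (≤-trans (m≤n+m _ 2) k<R) c₂)
        (trans (copy-frame c₁ (<⇒≢ (≤-trans (n<1+n k) (m≤n+m _ 2)) ∘ ≡-sym)) (agreed ag (n<1+n _))))
      (trans (copy-frame c₂ k≢1+k) (trans (copy-value (≤-trans (m≤n+m _ 3) k<R) c₁)
        (trans (agreed ag (n≤1+n _)) (guess-frame g₂ k≢1+k)))))

  transfers-sound : ∀ {k} (ψ : Form (4 + k)) → 4 + k ≤ R → Sound ψ →
    ∀ ρ (h h′ : Memory R) → width h ≡ L → Matches ρ h → Star (Runs x (transfer k (compile ψ))) h h′ →
    Star (Update ψ ρ) (reg (1 + k) h , reg k h) (reg (1 + k) h′ , reg k h′) × Agree k h h′
  transfers-sound ψ k<R sound ρ h h′ w m ε = ε , agree λ _ → refl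
  transfers-sound ψ k<R sound ρ h h′ w m (_◅_ {j = h₁} r rs)
    with up , ag ← transfer-sound ψ k<R sound ρ h h₁ w m r
    with ups , ag₁ ← transfers-sound ψ k<R sound ρ h₁ h′ (trans (runs-width r) w) (matches-agree ag m) rs =
    up ◅ ups , agree-trans ag ag₁

  transfers-run : ∀ {k} (ψ : Form (4 + k)) → 4 + k ≤ R → Sound ψ → Complete ψ →
    ∀ ρ (h : Memory R) → width h ≡ L → Matches ρ h → ∀ {p yz} → p ≡ (reg (1 + k) h , reg k h) → Star (Update ψ ρ) p yz →
    ∃[ h′ ] Star (Runs x (transfer k (compile ψ))) h h′ × yz ≡ (reg (1 + k) h′ , reg k h′)
  transfers-run ψ k<R sound complete ρ h w m eq ε = h , ε , eq
  transfers-run ψ k<R sound complete ρ h w m refl (up ◅ ups)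
    with h₁ , r , eq ← transfer-runs ψ k<R sound complete ρ h w m _ up
    with _ , ag ← transfer-sound ψ k<R sound ρ h h₁ w m r
    with h₂ , rs , eq₂ ← transfers-run ψ k<R sound complete ρ h₁ (trans (runs-width r) w) (matches-agree ag m) eq ups =
    h₂ , r ◅ rs , eq₂

  deeper : ∀ {k m n} j → j + m ≤ n → k + n ≤ R → j + k + m ≤ R
  deeper {k} {m} {n} j j+m≤n k≤R = ≤-trans (≤-reflexive (trans (cong (_+ m) (+-comm j k)) (+-assoc k j m)))
    (≤-trans (+-monoʳ-≤ k j+m≤n) k≤R)

  iter-room : ∀ {k} (φ : Form (2 + k)) (ψ : Form (4 + k)) (χ : Form (2 + k)) → k + scratch (iter φ ψ χ) ≤ R →
              2 + k + scratch φ ≤ R × 4 + k + scratch ψ ≤ R × 2 + k + scratch χ ≤ R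
  iter-room {k} φ ψ χ k≤R =
    deeper {k} {scratch φ} 2 (m≤m⊔n (2 + scratch φ) ((4 + scratch ψ) ⊔ (2 + scratch χ))) k≤R ,
    deeper {k} {scratch ψ} 4 (≤-trans (m≤m⊔n (4 + scratch ψ) (2 + scratch χ)) (m≤n⊔m (2 + scratch φ) _)) k≤R ,
    deeper {k} {scratch χ} 2 (≤-trans (m≤n⊔m (4 + scratch ψ) (2 + scratch χ)) (m≤n⊔m (2 + scratch φ) _)) k≤R

  sound : ∀ {k} (φ : Form k) → k + scratch φ ≤ R → Sound φ
  sound (sum a b c β) k≤R ρ h h′ w m run with refl , val ← check-sound {a = var a} {var b} {var c} run =
    trans (≡-sym (matches-lookup m a)) (trans val (cong₂ (λ u v → u + v + digit β) (matches-lookup m b) (matches-lookup m c))) ,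
    agree λ _ → refl
  sound {k} (at a f) k≤R ρ h h′ w m run = at-sound a f ρ h h′ (subst (_≤ R) (+-comm k 3) k≤R) m run
  sound {k} (φ ∧′ ψ) k≤R ρ h h′ w m (_⨾_ {h₁ = h₁} r r₁)
    with t , ag ← sound φ (deeper 0 (m≤m⊔n (scratch φ) _) k≤R) ρ h h₁ w m r
    with t₁ , ag₁ ← sound ψ (deeper 0 (m≤n⊔m (scratch φ) _) k≤R) ρ h₁ h′ (trans (runs-width r) w) (matches-agree ag m) r₁ =
    (t , t₁) , agree-trans ag ag₁
  sound (φ ∨′ ψ) k≤R ρ h h′ w m (⊕ˡ r)
    with t , ag ← sound φ (deeper 0 (m≤m⊔n (scratch φ) _) k≤R) ρ h h′ w m r = inj₁ t , ag
  sound (φ ∨′ ψ) k≤R ρ h h′ w m (⊕ʳ r)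
    with t , ag ← sound ψ (deeper 0 (m≤n⊔m (scratch φ) _) k≤R) ρ h h′ w m r = inj₂ t , ag
  sound {k} (ex φ) k≤R ρ h h′ w m (_⨾_ {h₁ = h₁} g r)
    with t , ag ← sound φ (deeper 1 ≤-refl k≤R) (reg k h₁ Vec.∷ ρ) h₁ h′ (trans (runs-width g) w)
                    (refl , matches-agree (guess-agree ≤-refl g) m) r =
    (reg k h₁ , reg<bound k h₁ (trans (runs-width g) w) , t) , agree-trans (guess-agree ≤-refl g) (agree-weaken 1 ag)
  sound {k} (iter φ ψ χ) k≤R ρ h h′ w m
    (_⨾_ {h₁ = h₁} g₁ (_⨾_ {h₁ = h₂} g₂ (_⨾_ {h₁ = h₃} r (_⨾_ {h₁ = h₄} (rs ✶) r₁))))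
    with φ≤ , ψ≤ , χ≤ ← iter-room φ ψ χ k≤R
    with ag ← agree-trans (guess-agree {k = k} ≤-refl g₁) (guess-agree (n≤1+n k) g₂)
    with w₂ ← trans (runs-width g₂) (trans (runs-width g₁) w)
    with tφ , agφ ← sound φ φ≤ (reg (1 + k) h₂ Vec.∷ reg k h₂ Vec.∷ ρ) h₂ h₃ w₂
                      (refl , refl , matches-agree ag m) r
    with ag₃ ← agree-trans ag (agree-weaken 2 agφ)
    with tψ , agψ ← transfers-sound ψ (m+n≤o⇒m≤o (4 + k) ψ≤)
                      (sound ψ ψ≤) ρ h₃ h₄ (trans (runs-width r) w₂)
                      (matches-agree ag₃ m) rs
    with ag₄ ← agree-trans ag₃ agψ
    with tχ , agχ ← sound χ χ≤
                      (reg (1 + k) h₄ Vec.∷ reg k h₄ Vec.∷ ρ) h₄ h′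
                      (trans (runs✶-width rs) (trans (runs-width r) w₂)) (refl , refl , matches-agree ag₄ m) r₁ =
    (reg (1 + k) h₂ , reg k h₂ , reg<bound _ h₂ w₂ , reg<bound _ h₂ w₂ , tφ , reg (1 + k) h₄ , reg k h₄ ,
      subst (λ p → Star (Update ψ ρ) p _) (cong₂ _,_ (agreed agφ (n<1+n _)) (agreed agφ (n≤1+n _))) tψ , tχ) ,
    agree-trans ag₄ (agree-weaken 2 agχ)

  complete : ∀ {k} (φ : Form k) → k + scratch φ ≤ R → Complete φ
  complete (sum a b c β) k≤R ρ h w m t =
    h , check-runs β h (trans (matches-lookup m a) (trans t
          (≡-sym (cong₂ (λ u v → u + v + digit β) (matches-lookup m b) (matches-lookup m c)))))
  complete {k} (at a f) k≤R ρ h w m t = at-runs a f ρ h (subst (_≤ R) (+-comm k 3) k≤R) w m t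
  complete (φ ∧′ ψ) k≤R ρ h w m (t , t₁)
    with h₁ , r ← complete φ (deeper 0 (m≤m⊔n (scratch φ) _) k≤R) ρ h w m t
    with _ , ag ← sound φ (deeper 0 (m≤m⊔n (scratch φ) _) k≤R) ρ h h₁ w m r
    with h₂ , r₁ ← complete ψ (deeper 0 (m≤n⊔m (scratch φ) _) k≤R) ρ h₁ (trans (runs-width r) w) (matches-agree ag m) t₁ =
    h₂ , (r ⨾ r₁)
  complete (φ ∨′ ψ) k≤R ρ h w m (inj₁ t)
    with h₁ , r ← complete φ (deeper 0 (m≤m⊔n (scratch φ) _) k≤R) ρ h w m t = h₁ , ⊕ˡ r
  complete (φ ∨′ ψ) k≤R ρ h w m (inj₂ t)
    with h₁ , r ← complete ψ (deeper 0 (m≤n⊔m (scratch φ) _) k≤R) ρ h w m t = h₁ , ⊕ʳ r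
  complete {k} (ex φ) k≤R ρ h w m (y , y< , t)
    with h₁ , g , refl , w₁ ← guess-below {k} (m+n≤o⇒m≤o (1 + k) (deeper 1 ≤-refl k≤R)) h w y<
    with h₂ , r ← complete φ (deeper 1 ≤-refl k≤R) _ h₁ w₁ (refl , matches-agree (guess-agree ≤-refl g) m) t =
    h₂ , (g ⨾ r)
  complete {k} (iter φ ψ χ) k≤R ρ h w m (y , z , y< , z< , tφ , y′ , z′ , tψ , tχ)
    with φ≤ , ψ≤ , χ≤ ← iter-room φ ψ χ k≤R
    with k<R ← m+n≤o⇒m≤o (2 + k) φ≤
    with h₁ , g₁ , refl , w₁ ← guess-below {k} (≤-trans (n≤1+n _) k<R) h w z<
    with h₂ , g₂ , refl , w₂ ← guess-below {1 + k} k<R h₁ w₁ y<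
    with ag ← agree-trans (guess-agree {k = k} ≤-refl g₁) (guess-agree (n≤1+n k) g₂)
    with m₂ ← (refl , guess-frame g₂ k≢1+k , matches-agree ag m)
    with h₃ , r ← complete φ φ≤ (reg (1 + k) h₂ Vec.∷ reg k h₁ Vec.∷ ρ) h₂ w₂ m₂ tφ
    with _ , agφ ← sound φ φ≤ _ h₂ h₃ w₂ m₂ r
    with m₃ ← matches-agree (agree-trans ag (agree-weaken 2 agφ)) m
    with w₃ ← trans (runs-width r) w₂
    with h₄ , rs , refl ← transfers-run ψ (m+n≤o⇒m≤o (4 + k) ψ≤) (sound ψ ψ≤) (complete ψ ψ≤) ρ h₃ w₃ m₃
           (≡-sym (cong₂ _,_ (agreed agφ (n<1+n _)) (trans (agreed agφ (n≤1+n _)) (guess-frame g₂ k≢1+k)))) tψ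
    with _ , agψ ← transfers-sound ψ (m+n≤o⇒m≤o (4 + k) ψ≤) (sound ψ ψ≤) ρ h₃ h₄ w₃ m₃ rs
    with h₅ , r₁ ← complete χ χ≤ _ h₄
           (trans (runs✶-width rs) w₃) (refl , refl , matches-agree agψ m₃) tχ =
    h₅ , (g₁ ⨾ g₂ ⨾ r ⨾ (rs ✶) ⨾ r₁)

-- B is the number of values of a register of the width that the machine
-- prepares.
definable : (φ : Form 0) → Σ[ M ∈ NTM Symbol ] LogSpace M × (∀ x →
  (Accepts M x → ∃[ B ] suc (length x) < B × Truth.⟦_⟧ x B φ []) ×
  ((∀ B → suc (length x) < B → Truth.⟦_⟧ x B φ []) → Accepts M x))
definable φ = machine P , logSpace P , λ x →
  (λ acc → let h , h′ , (lo , _) , r = accepts⇒runs P acc in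
     2 ^ width h , lo , proj₁ (Evaluation.sound x (width h) φ (n≤1+n _) [] h h′ refl _ r)) ,
  (λ tr → runs⇒accepts P λ h (lo , _) → Evaluation.complete x (width h) φ (n≤1+n _) [] h refl _ (tr _ lo))
  where
  P : Prog (suc (scratch φ))
  P = compile φ

-- Derived formulas

isZero : ∀ {k} → Fin k → Form k
isZero a = sum a a a false

infix 7 _≐_ _≐1+_ _≺_

_≐_ : ∀ {k} → Fin k → Fin k → Form k
a ≐ b = ex (isZero 0F ∧′ sum (suc a) (suc b) 0F false)

_≐1+_ : ∀ {k} → Fin k → Fin k → Form k
a ≐1+ b = ex (isZero 0F ∧′ sum (suc a) (suc b) 0F true)

_≺_ : ∀ {k} → Fin k → Fin k → Form k
a ≺ b = ex (sum (suc b) (suc a) 0F true)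

differ : ∀ {k} → Fin k → Fin k → Form k
differ a b = a ≺ b ∨′ b ≺ a

-- Runs t from `first` to `last` and m from `start` to `end`; the body sees
-- the new m, t + 1, the old m and t.
for : ∀ {k} (first last start end : Fin k) → Form (4 + k) → Form k
for first last start end φ = iter
  (0F ≐ (2 ↑ʳ start) ∧′ 1F ≐ (2 ↑ʳ first))
  (1F ≐1+ 3F ∧′ φ)
  (0F ≐ (2 ↑ʳ end) ∧′ 1F ≐ (2 ↑ʳ last))

-- The body sees t as variable 3.
allBelow : ∀ {k} → Fin k → Form (5 + k) → Form k
allBelow a φ = ex (isZero 0F ∧′ for 0F (suc a) 0F 0F φ)

product : ∀ {k} → Fin k → Fin k → Fin k → Form k
product p a b = ex (isZero 0F ∧′ for 0F (suc a) 0F (suc p) (sum 0F 2F (5 ↑ʳ b) false))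

-- Meaning of the derived formulas

data Chain (S : ℕ → ℕ → ℕ → Set) : (t m t′ m′ : ℕ) → Set where
  []  : ∀ {t m} → Chain S t m t m
  _∷_ : ∀ {t m m₁ t′ m′} → S t m m₁ → Chain S (suc t) m₁ t′ m′ → Chain S t m t′ m′

chain-≤ : ∀ {S t m t′ m′} → Chain S t m t′ m′ → t ≤ t′
chain-≤ []      = ≤-refl
chain-≤ (_ ∷ c) = ≤-trans (n≤1+n _) (chain-≤ c)

chain-map : ∀ {S S′ t m t′ m′} → (∀ {t m m₁} → S t m m₁ → S′ t m m₁) → Chain S t m t′ m′ → Chain S′ t m t′ m′
chain-map f []      = []
chain-map f (s ∷ c) = f s ∷ chain-map f c

module Macros (x : List Symbol) (B : ℕ) (0<B : 0 < B) where
  open Truth x B public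

  private variable
    k : ℕ

  isZero-sound : ∀ (ρ : Vec ℕ k) a → ⟦ isZero a ⟧ ρ → lookup ρ a ≡ 0
  isZero-sound ρ a = self-sum _

  isZero-complete : ∀ (ρ : Vec ℕ k) a → lookup ρ a ≡ 0 → ⟦ isZero a ⟧ ρ
  isZero-complete ρ a eq = trans eq (≡-sym (cong (λ z → z + z + 0) eq))

  ≐-sound : ∀ (ρ : Vec ℕ k) a b → ⟦ a ≐ b ⟧ ρ → lookup ρ a ≡ lookup ρ b
  ≐-sound ρ a b (z , _ , z≡0 , eq) with refl ← self-sum z z≡0 = trans eq (trans (+-identityʳ _) (+-identityʳ _))

  ≐-complete : ∀ (ρ : Vec ℕ k) a b → lookup ρ a ≡ lookup ρ b → ⟦ a ≐ b ⟧ ρ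
  ≐-complete ρ a b eq = 0 , 0<B , refl , trans eq (≡-sym (trans (+-identityʳ _) (+-identityʳ _)))

  ≐1+-sound : ∀ (ρ : Vec ℕ k) a b → ⟦ a ≐1+ b ⟧ ρ → lookup ρ a ≡ suc (lookup ρ b)
  ≐1+-sound ρ a b (z , _ , z≡0 , eq) with refl ← self-sum z z≡0 =
    trans eq (trans (cong (_+ 1) (+-identityʳ _)) (+-comm _ 1))

  ≐1+-complete : ∀ (ρ : Vec ℕ k) a b → lookup ρ a ≡ suc (lookup ρ b) → ⟦ a ≐1+ b ⟧ ρ
  ≐1+-complete ρ a b eq = 0 , 0<B , refl , trans eq (≡-sym (trans (cong (_+ 1) (+-identityʳ _)) (+-comm _ 1)))

  ≺-sound : ∀ (ρ : Vec ℕ k) a b → ⟦ a ≺ b ⟧ ρ → lookup ρ a < lookup ρ b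
  ≺-sound ρ a b (y , _ , eq) = ≤-trans (s≤s (m≤m+n _ y)) (≤-reflexive (≡-sym (trans eq (+-comm _ 1))))

  ≺-complete : ∀ (ρ : Vec ℕ k) a b → lookup ρ b < B → lookup ρ a < lookup ρ b → ⟦ a ≺ b ⟧ ρ
  ≺-complete ρ a b b<B a<b = lookup ρ b ∸ suc (lookup ρ a) , ≤-<-trans (m∸n≤m (lookup ρ b) (suc (lookup ρ a))) b<B ,
    ≡-sym (trans (+-comm _ 1) (m+[n∸m]≡n a<b))

  differ-sound : ∀ (ρ : Vec ℕ k) a b → ⟦ differ a b ⟧ ρ → lookup ρ a ≢ lookup ρ b
  differ-sound ρ a b (inj₁ t) = <⇒≢ (≺-sound ρ a b t)
  differ-sound ρ a b (inj₂ t) eq = <⇒≢ (≺-sound ρ b a t) (≡-sym eq)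

  differ-complete : ∀ (ρ : Vec ℕ k) a b → lookup ρ a < B → lookup ρ b < B → lookup ρ a ≢ lookup ρ b → ⟦ differ a b ⟧ ρ
  differ-complete ρ a b a<B b<B a≢b with ≤-total (lookup ρ a) (lookup ρ b)
  ... | inj₁ a≤b = inj₁ (≺-complete ρ a b b<B (≤∧≢⇒< a≤b a≢b))
  ... | inj₂ b≤a = inj₂ (≺-complete ρ b a a<B (≤∧≢⇒< b≤a (λ eq → a≢b (≡-sym eq))))

  Body : Form (4 + k) → Vec ℕ k → ℕ → ℕ → ℕ → Set
  Body φ ρ t m m′ = m′ < B × ⟦ φ ⟧ (m′ ∷ suc t ∷ m ∷ t ∷ ρ)

  for-sound : ∀ (ρ : Vec ℕ k) first last start end φ → ⟦ for first last start end φ ⟧ ρ →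
              Chain (Body φ ρ) (lookup ρ first) (lookup ρ start) (lookup ρ last) (lookup ρ end)
  for-sound {k} ρ first last start end φ (m , t , _ , _ , (m≡ , t≡) , m′ , t′ , st , m′≡ , t′≡)
    with refl ← ≐-sound (m ∷ t ∷ ρ) 0F (2 ↑ʳ start) m≡ with refl ← ≐-sound (m ∷ t ∷ ρ) 1F (2 ↑ʳ first) t≡
    with refl ← ≐-sound (m′ ∷ t′ ∷ ρ) 0F (2 ↑ʳ end) m′≡ with refl ← ≐-sound (m′ ∷ t′ ∷ ρ) 1F (2 ↑ʳ last) t′≡ = go st
    where
    go : ∀ {m t m′ t′} → Star _ (m , t) (m′ , t′) → Chain (Body φ ρ) t m t′ m′
    go ε = []
    go {m} {t} (_◅_ {j = m₁ , t₁} (m₁<B , _ , t₁≡ , tr) st)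
      with refl ← ≐1+-sound (m₁ ∷ t₁ ∷ m ∷ t ∷ ρ) 1F 3F t₁≡ = (m₁<B , tr) ∷ go st

  for-complete : ∀ (ρ : Vec ℕ k) first last start end φ → lookup ρ start < B → lookup ρ last < B →
                 Chain (Body φ ρ) (lookup ρ first) (lookup ρ start) (lookup ρ last) (lookup ρ end) →
                 ⟦ for first last start end φ ⟧ ρ
  for-complete {k} ρ first last start end φ start<B last<B c =
    _ , _ , start<B , ≤-<-trans (chain-≤ c) last<B ,
    (≐-complete (lookup ρ start ∷ lookup ρ first ∷ ρ) 0F (2 ↑ʳ start) refl ,
     ≐-complete (lookup ρ start ∷ lookup ρ first ∷ ρ) 1F (2 ↑ʳ first) refl) ,
    _ , _ , go last<B c ,
    (≐-complete (lookup ρ end ∷ lookup ρ last ∷ ρ) 0F (2 ↑ʳ end) refl ,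
     ≐-complete (lookup ρ end ∷ lookup ρ last ∷ ρ) 1F (2 ↑ʳ last) refl)
    where
    go : ∀ {m t m′ t′} → t′ < B → Chain (Body φ ρ) t m t′ m′ → Star _ (m , t) (m′ , t′)
    go t′<B []                 = ε
    go {m} {t} t′<B (_∷_ {m₁ = m₁} (m₁<B , tr) c) =
      (m₁<B , ≤-<-trans (chain-≤ c) t′<B , ≐1+-complete (m₁ ∷ suc t ∷ m ∷ t ∷ ρ) 1F 3F refl , tr) ◅ go t′<B c

  -- The loop cannot skip a round, so its success is a universal statement. The accumulator is
  -- arbitrary in each round, whence the existentials; the bodies in use do not mention it.
  allBelow-sound : ∀ (ρ : Vec ℕ k) a φ → ⟦ allBelow a φ ⟧ ρ →
                   ∀ t → t < lookup ρ a → ∃[ m ] ∃[ m′ ] ⟦ φ ⟧ (m′ ∷ suc t ∷ m ∷ t ∷ 0 ∷ ρ)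
  allBelow-sound {k} ρ a φ (z , _ , z≡0 , loop) t t<a with refl ← self-sum z z≡0 =
    go (for-sound (0 ∷ ρ) 0F (suc a) 0F 0F φ loop) z≤n t<a
    where
    go : ∀ {s m s′ m′} → Chain (Body φ (0 ∷ ρ)) s m s′ m′ → s ≤ t → t < s′ →
         ∃[ m ] ∃[ m′ ] ⟦ φ ⟧ (m′ ∷ suc t ∷ m ∷ t ∷ 0 ∷ ρ)
    go [] s≤t t<s = ⊥-elim (<⇒≱ t<s s≤t)
    go {s} ((_ , tr) ∷ c) s≤t t<s′ with m≤n⇒m<n∨m≡n s≤t
    ... | inj₁ s<t  = go c s<t t<s′
    ... | inj₂ refl = _ , _ , tr

  allBelow-complete : ∀ (ρ : Vec ℕ k) a φ → lookup ρ a < B →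
                      (∀ t → t < lookup ρ a → ⟦ φ ⟧ (0 ∷ suc t ∷ 0 ∷ t ∷ 0 ∷ ρ)) → ⟦ allBelow a φ ⟧ ρ
  allBelow-complete {k} ρ a φ a<B hyp =
    0 , 0<B , refl , for-complete (0 ∷ ρ) 0F (suc a) 0F 0F φ 0<B a<B (go _ 0 (+-identityʳ _))
    where
    go : ∀ j s → j + s ≡ lookup ρ a → Chain (Body φ (0 ∷ ρ)) s 0 (lookup ρ a) 0
    go zero    s refl = []
    go (suc j) s eq   = (0<B , hyp s (≤-trans (s≤s (m≤n+m s j)) (≤-reflexive eq))) ∷ go j (suc s) (trans (+-suc j s) eq)

  product-sound : ∀ (ρ : Vec ℕ k) p a b → ⟦ product p a b ⟧ ρ → lookup ρ p ≡ lookup ρ a * lookup ρ b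
  product-sound {k} ρ p a b (z , _ , z≡0 , loop) with refl ← self-sum z z≡0 =
    go (for-sound (0 ∷ ρ) 0F (suc a) 0F (suc p) (sum 0F 2F (5 ↑ʳ b) false) loop) refl
    where
    go : ∀ {t m t′ m′} → Chain (Body (sum 0F 2F (5 ↑ʳ b) false) (0 ∷ ρ)) t m t′ m′ →
         m ≡ t * lookup ρ b → m′ ≡ t′ * lookup ρ b
    go []             eq = eq
    go ((_ , s) ∷ c)  eq = go c (trans s (trans (+-identityʳ _) (trans (+-comm _ (lookup ρ b)) (cong (lookup ρ b +_) eq))))

  product-complete : ∀ (ρ : Vec ℕ k) p a b → lookup ρ a < B → lookup ρ p < B →
                     lookup ρ p ≡ lookup ρ a * lookup ρ b → ⟦ product p a b ⟧ ρ
  product-complete {k} ρ p a b a<B p<B eq =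
    0 , 0<B , refl , for-complete (0 ∷ ρ) 0F (suc a) 0F (suc p) (sum 0F 2F (5 ↑ʳ b) false) 0<B a<B
      (subst (Chain _ 0 0 (lookup ρ a)) (≡-sym eq) (go (lookup ρ a) 0 (+-identityʳ _)))
    where
    n : ℕ
    n = lookup ρ b
    go : ∀ j t → j + t ≡ lookup ρ a → Chain (Body (sum 0F 2F (5 ↑ʳ b) false) (0 ∷ ρ)) t (t * n) (lookup ρ a) (lookup ρ a * n)
    go zero    t refl = []
    go (suc j) t j≡ =
      -- A partial product is at most the whole one and therefore fits into a register.
      (≤-<-trans (*-monoˡ-≤ n (≤-trans (s≤s (m≤n+m t j)) (≤-reflexive j≡))) (subst (_< B) eq p<B) ,
       trans (+-comm n _) (≡-sym (+-identityʳ _))) ∷ go j (suc t) (trans (+-suc j t) j≡)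

-- Distances and inductive counting

is𝟎 is𝟏 is# is⊣ : InputSymbol Symbol → Bool
is𝟎 (sym 𝟎) = true
is𝟎 _       = false
is𝟏 (sym 𝟏) = true
is𝟏 _       = false
is# (sym #) = true
is# _       = false
is⊣ ⊣       = true
is⊣ _       = false

-- The matrix entry (a , b) is the input symbol number n + 2 + a n + b.
entryIs : ∀ {k} → (InputSymbol Symbol → Bool) → (n a b : Fin k) → Form k
entryIs f n a b =
  ex (product 0F (1 ↑ʳ a) (1 ↑ʳ n) ∧′ ex (sum 0F 1F (2 ↑ʳ b) true ∧′ ex (sum 0F 1F (3 ↑ʳ n) true ∧′ at 0F f)))

-- For vertices, `far` is the negation of `near`: it is available in a positive logic because the
-- input displays the absence of an edge as a symbol of its own. Equality in `near` is the pause of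
-- a walk.
near far : ∀ {k} → (n a b : Fin k) → Form k
near n a b = a ≐ b ∨′ entryIs is𝟏 n a b
far  n a b = differ a b ∧′ entryIs is𝟎 n a b

reach : ∀ {k} → (n d a b : Fin k) → Form k
reach n d a b = ex (isZero 0F ∧′ for 0F (suc d) (suc a) (suc b) (0F ≺ (5 ↑ʳ n) ∧′ near (5 ↑ʳ n) 2F 0F))

-- There are c vertices at distance ≤ d from w that are neither equal nor
-- adjacent to u. If c is the number of all vertices at distance ≤ d from w,
-- then this certifies that u is not at distance ≤ d + 1.
avoid : ∀ {k} → (n w d c u : Fin k) → Form k
avoid n w d c u = ex (isZero 0F ∧′ for 0F (suc n) 0F (suc c)
  (0F ≐ 2F ∨′ (0F ≐1+ 2F ∧′ reach (5 ↑ʳ n) (5 ↑ʳ d) 3F (5 ↑ʳ w) ∧′ far (5 ↑ʳ n) (5 ↑ʳ u) 3F)))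

-- One round of inductive counting. Each vertex t must be either counted, with a guessed walk as
-- evidence, or left out, with `avoid` as evidence; as both choices are certified, only the correct
-- count can come out.
recount : ∀ {k} → (n w d d′ c c′ : Fin k) → Form k
recount n w d d′ c c′ = ex (isZero 0F ∧′ for 0F (suc n) 0F (suc c′)
  ((reach (5 ↑ʳ n) (5 ↑ʳ d′) 3F (5 ↑ʳ w) ∧′ 0F ≐1+ 2F) ∨′
   (avoid (5 ↑ʳ n) (5 ↑ʳ w) (5 ↑ʳ d) (5 ↑ʳ c) 3F ∧′ 0F ≐ 2F)))

counted : ∀ {k} → (n w d c : Fin k) → Form k
-- The loop starts from the count 1: at distance 0 there is just `w` itself.
counted n w d c = ex (isZero 0F ∧′ ex (0F ≐1+ 1F ∧′ for 1F (2 ↑ʳ d) 0F (2 ↑ʳ c)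
  (recount (6 ↑ʳ n) (6 ↑ʳ w) 3F 1F 2F 0F)))

-- `avoid` refutes only distances of the form j + 1, so distance 0 is treated as inequality.
unreach : ∀ {k} → (n d a w : Fin k) → Form k
unreach n d a w = isZero d ∧′ differ a w ∨′
  ex (ex ((2 ↑ʳ d) ≐1+ 1F ∧′ counted (2 ↑ʳ n) (2 ↑ʳ w) 1F 0F ∧′ avoid (2 ↑ʳ n) (2 ↑ʳ w) 1F 0F (2 ↑ʳ a)))

-- Cardinalities and walks

count : {P : ℕ → Set} → Decidable P → ℕ → ℕ
count P? zero    = 0
count P? (suc k) with P? k
... | yes _ = suc (count P? k)
... | no  _ = count P? k

module _ {P : ℕ → Set} (P? : Decidable P) where

  count-yes : ∀ {k} → P k → count P? (suc k) ≡ suc (count P? k)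
  count-yes {k} p with P? k
  ... | yes _ = refl
  ... | no ¬p = ⊥-elim (¬p p)

  count-no : ∀ {k} → ¬ P k → count P? (suc k) ≡ count P? k
  count-no {k} ¬p with P? k
  ... | yes p = ⊥-elim (¬p p)
  ... | no _  = refl

  count-step : ∀ k → count P? k ≤ count P? (suc k)
  count-step k with P? k
  ... | yes _ = n≤1+n _
  ... | no  _ = ≤-refl

  count≤ : ∀ k → count P? k ≤ k
  count≤ zero    = z≤n
  count≤ (suc k) with P? k
  ... | yes _ = s≤s (count≤ k)
  ... | no  _ = m≤n⇒m≤1+n (count≤ k)

module _ {P Q : ℕ → Set} (P? : Decidable P) (Q? : Decidable Q) where

  count-mono : (∀ {y} → P y → Q y) → ∀ k → count P? k ≤ count Q? k
  count-mono P⊆Q zero = z≤n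
  count-mono P⊆Q (suc k) with P? k | Q? k
  ... | yes p | yes _ = s≤s (count-mono P⊆Q k)
  ... | yes p | no ¬q = ⊥-elim (¬q (P⊆Q p))
  ... | no  _ | yes _ = m≤n⇒m≤1+n (count-mono P⊆Q k)
  ... | no  _ | no  _ = count-mono P⊆Q k

  -- Here a number certifies a negative fact: once P is seen to have as many elements below k as the
  -- larger set Q, no element of Q below k can be outside P.
  count-squeeze : (∀ {y} → P y → Q y) → ∀ k → count Q? k ≤ count P? k → ∀ {y} → y < k → Q y → P y
  count-squeeze P⊆Q (suc k) #Q≤#P {y} y<1+k q with P? k | Q? k | m≤n⇒m<n∨m≡n (≤-pred y<1+k)
  ... | yes p | _     | inj₂ refl = p
  ... | no _  | yes _ | _         = ⊥-elim (<⇒≱ #Q≤#P (count-mono P⊆Q k))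
  ... | no _  | no ¬q | inj₂ refl = ⊥-elim (¬q q)
  ... | yes _ | yes _ | inj₁ y<k  = count-squeeze P⊆Q k (≤-pred #Q≤#P) y<k q
  ... | yes p | no ¬q | inj₁ y<k  = ⊥-elim (¬q (P⊆Q p))
  ... | no _  | no _  | inj₁ y<k  = count-squeeze P⊆Q k #Q≤#P y<k q

count-≡ : ∀ w k → w < k → count (λ y → y ≟ w) k ≡ 1
count-≡ w (suc k) w<1+k with m≤n⇒m<n∨m≡n (≤-pred w<1+k)
... | inj₁ w<k  = trans (count-no (_≟ w) (λ eq → <⇒≢ w<k (≡-sym eq))) (count-≡ w k w<k)
... | inj₂ refl = trans (count-yes (_≟ w) refl) (cong suc (none k ≤-refl))
  where
  none : ∀ j → j ≤ w → count (λ y → y ≟ w) j ≡ 0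
  none zero    _   = refl
  none (suc j) j<w = trans (count-no (_≟ w) (<⇒≢ j<w)) (none j (<⇒≤ j<w))

module Walks (n : ℕ) (e : ℕ → ℕ → Bool) where

  Near : ℕ → ℕ → Set
  Near a b = a ≡ b ⊎ e a b ≡ true

  near? : ∀ a b → Dec (Near a b)
  near? a b = (a ≟ b) ⊎-dec (e a b ≟ᵇ true)

  Walk : ℕ → ℕ → ℕ → Set
  Walk zero    a b = a ≡ b
  Walk (suc d) a b = ∃[ c ] c < n × Near a c × Walk d c b

  walk? : ∀ d a b → Dec (Walk d a b)
  walk? zero    a b = a ≟ b
  walk? (suc d) a b = anyUpTo? (λ c → near? a c ×-dec walk? d c b) n

  #within : ℕ → ℕ → ℕ
  #within d w = count (λ y → walk? d y w) n

module DistanceFormulas (x : List Symbol) (B n : ℕ) (e : ℕ → ℕ → Bool)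
  -- The summands stand in the order in which `entryIs` adds them, by two sums with carry 1.
  (matrix : ∀ {a b} → a < n → b < n → readInput x (a * n + b + 1 + n + 1) ≡ sym (bit (e a b)))
  -- The last matrix entry stands at position n² + n + 1, which must be a register value.
  (large  : n * n + n + 2 ≤ B) where

  n<B : n < B
  n<B = ≤-trans (≤-trans (≤-reflexive (+-comm 1 n)) (≤-trans (m≤n+m (n + 1) (n * n))
    (≤-trans (≤-reflexive (≡-sym (+-assoc (n * n) n 1))) (+-monoʳ-≤ (n * n + n) (n≤1+n 1))))) large

  open Macros x B (≤-<-trans z≤n n<B) public
  open Walks n e public

  0<B : 0 < B
  0<B = ≤-<-trans z≤n n<B

  private variable
    k : ℕ

  entryIs-sound : ∀ f (ρ : Vec ℕ k) N a b → lookup ρ N ≡ n → lookup ρ a < n → lookup ρ b < n →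
                  ⟦ entryIs f N a b ⟧ ρ → f (sym (bit (e (lookup ρ a) (lookup ρ b)))) ≡ true
  entryIs-sound f ρ N a b N≡ a< b< (p , _ , pr , q , _ , q≡ , r , _ , r≡ , ok) =
    trans (cong f (≡-sym (trans (cong (readInput x) r≡′) (matrix a< b<)))) ok
    where
    r≡′ : r ≡ lookup ρ a * n + lookup ρ b + 1 + n + 1
    r≡′ = trans r≡ (cong₂ (λ q n → q + n + 1)
      (trans q≡ (cong (λ p → p + lookup ρ b + 1) (trans (product-sound (p ∷ ρ) 0F (suc a) (suc N) pr) (cong (lookup ρ a *_) N≡)))) N≡)

  entryIs-complete : ∀ f (ρ : Vec ℕ k) N a b → lookup ρ N ≡ n → lookup ρ a < n → lookup ρ b < n →
                     f (sym (bit (e (lookup ρ a) (lookup ρ b)))) ≡ true → ⟦ entryIs f N a b ⟧ ρ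
  entryIs-complete f ρ N a b N≡ a< b< ok =
    a′ * n , ≤-<-trans (≤-trans (m≤m+n _ b′) (≤-trans (m≤m+n _ 1) (≤-trans (m≤m+n _ n) (m≤m+n _ 1)))) r<B ,
    product-complete (a′ * n ∷ ρ) 0F (suc a) (suc N) (<-trans a< n<B)
      (≤-<-trans (≤-trans (m≤m+n _ b′) (≤-trans (m≤m+n _ 1) (≤-trans (m≤m+n _ n) (m≤m+n _ 1)))) r<B)
      (cong (a′ *_) (≡-sym N≡)) ,
    a′ * n + b′ + 1 , ≤-<-trans (≤-trans (m≤m+n _ n) (m≤m+n _ 1)) r<B , refl ,
    a′ * n + b′ + 1 + n + 1 , r<B , cong (λ n′ → a′ * n + b′ + 1 + n′ + 1) (≡-sym N≡) ,
    trans (cong f (matrix a< b<)) ok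
    where
    a′ b′ : ℕ
    a′ = lookup ρ a
    b′ = lookup ρ b
    r<B : a′ * n + b′ + 1 + n + 1 < B
    r<B = begin-strict
      a′ * n + b′ + 1 + n + 1       ≡⟨ cong (λ z → z + n + 1) (+-assoc (a′ * n) b′ 1) ⟩
      a′ * n + (b′ + 1) + n + 1     ≤⟨ +-monoˡ-≤ 1 (+-monoˡ-≤ n (+-monoʳ-≤ (a′ * n) (≤-trans (≤-reflexive (+-comm b′ 1)) b<))) ⟩
      a′ * n + n + n + 1            ≡⟨ cong (λ z → z + n + 1) (+-comm (a′ * n) n) ⟩
      suc a′ * n + n + 1            ≤⟨ +-monoˡ-≤ 1 (+-monoˡ-≤ n (*-monoˡ-≤ n a<)) ⟩
      n * n + n + 1                 <⟨ +-monoʳ-< (n * n + n) (n<1+n 1) ⟩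
      n * n + n + 2                 ≤⟨ large ⟩
      B                             ∎
      where open ≤-Reasoning

  is𝟏-bit : ∀ b → is𝟏 (sym (bit b)) ≡ true → b ≡ true
  is𝟏-bit true _ = refl

  is𝟎-bit : ∀ b → is𝟎 (sym (bit b)) ≡ true → b ≡ false
  is𝟎-bit false _ = refl

  linked-sound : ∀ (ρ : Vec ℕ k) N a b → lookup ρ N ≡ n → lookup ρ a < n → lookup ρ b < n →
                 ⟦ entryIs is𝟏 N a b ⟧ ρ → e (lookup ρ a) (lookup ρ b) ≡ true
  linked-sound ρ N a b N≡ a< b< t = is𝟏-bit _ (entryIs-sound is𝟏 ρ N a b N≡ a< b< t)

  linked-complete : ∀ (ρ : Vec ℕ k) N a b → lookup ρ N ≡ n → lookup ρ a < n → lookup ρ b < n →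
                    e (lookup ρ a) (lookup ρ b) ≡ true → ⟦ entryIs is𝟏 N a b ⟧ ρ
  linked-complete ρ N a b N≡ a< b< eq =
    entryIs-complete is𝟏 ρ N a b N≡ a< b< (cong (λ b → is𝟏 (sym (bit b))) eq)

  unlinked-sound : ∀ (ρ : Vec ℕ k) N a b → lookup ρ N ≡ n → lookup ρ a < n → lookup ρ b < n →
                   ⟦ entryIs is𝟎 N a b ⟧ ρ → e (lookup ρ a) (lookup ρ b) ≡ false
  unlinked-sound ρ N a b N≡ a< b< t = is𝟎-bit _ (entryIs-sound is𝟎 ρ N a b N≡ a< b< t)

  unlinked-complete : ∀ (ρ : Vec ℕ k) N a b → lookup ρ N ≡ n → lookup ρ a < n → lookup ρ b < n →
                      e (lookup ρ a) (lookup ρ b) ≡ false → ⟦ entryIs is𝟎 N a b ⟧ ρ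
  unlinked-complete ρ N a b N≡ a< b< eq =
    entryIs-complete is𝟎 ρ N a b N≡ a< b< (cong (λ b → is𝟎 (sym (bit b))) eq)

  near-sound : ∀ (ρ : Vec ℕ k) N a b → lookup ρ N ≡ n → lookup ρ a < n → lookup ρ b < n →
               ⟦ near N a b ⟧ ρ → Near (lookup ρ a) (lookup ρ b)
  near-sound ρ N a b N≡ a< b< (inj₁ eq) = inj₁ (≐-sound ρ a b eq)
  near-sound ρ N a b N≡ a< b< (inj₂ t)  = inj₂ (linked-sound ρ N a b N≡ a< b< t)

  near-complete : ∀ (ρ : Vec ℕ k) N a b → lookup ρ N ≡ n → lookup ρ a < n → lookup ρ b < n →
                  Near (lookup ρ a) (lookup ρ b) → ⟦ near N a b ⟧ ρ
  near-complete ρ N a b N≡ a< b< (inj₁ eq) = inj₁ (≐-complete ρ a b eq)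
  near-complete ρ N a b N≡ a< b< (inj₂ t)  = inj₂ (linked-complete ρ N a b N≡ a< b< t)

  far-sound : ∀ (ρ : Vec ℕ k) N a b → lookup ρ N ≡ n → lookup ρ a < n → lookup ρ b < n →
              ⟦ far N a b ⟧ ρ → ¬ Near (lookup ρ a) (lookup ρ b)
  far-sound ρ N a b N≡ a< b< (d , t) (inj₁ eq) = differ-sound ρ a b d eq
  far-sound ρ N a b N≡ a< b< (d , t) (inj₂ eq) with () ← trans (≡-sym eq) (unlinked-sound ρ N a b N≡ a< b< t)

  far-complete : ∀ (ρ : Vec ℕ k) N a b → lookup ρ N ≡ n → lookup ρ a < n → lookup ρ b < n →
                 ¬ Near (lookup ρ a) (lookup ρ b) → ⟦ far N a b ⟧ ρ
  far-complete ρ N a b N≡ a< b< ¬near =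
    differ-complete ρ a b (<-trans a< n<B) (<-trans b< n<B) (λ eq → ¬near (inj₁ eq)) ,
    unlinked-complete ρ N a b N≡ a< b< (not-true _ (λ eq → ¬near (inj₂ eq)))
    where
    not-true : ∀ b → b ≢ true → b ≡ false
    not-true false _ = refl
    not-true true  h = ⊥-elim (h refl)

  ReachStep : Fin k → Form (5 + k)
  ReachStep N = 0F ≺ (5 ↑ʳ N) ∧′ near (5 ↑ʳ N) 2F 0F

  reach-chain : ∀ (ρ : Vec ℕ k) N → lookup ρ N ≡ n → ∀ {t m t′ m′} →
                Chain (Body (ReachStep N) (0 ∷ ρ)) t m t′ m′ → m < n → ∃[ j ] j + t ≡ t′ × Walk j m m′
  reach-chain ρ N N≡ [] _ = 0 , refl , refl
  reach-chain ρ N N≡ {t} {m} (_∷_ {m₁ = m₁} (_ , lt , nr) c) m<n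
    with m₁<n ← subst (m₁ <_) N≡ (≺-sound (m₁ ∷ suc t ∷ m ∷ t ∷ 0 ∷ ρ) 0F (5 ↑ʳ N) lt)
    with j , refl , w ← reach-chain ρ N N≡ c m₁<n =
    suc j , ≡-sym (+-suc j t) , m₁ , m₁<n , near-sound (m₁ ∷ suc t ∷ m ∷ t ∷ 0 ∷ ρ) (5 ↑ʳ N) 2F 0F N≡ m<n m₁<n nr , w

  reach-sound : ∀ (ρ : Vec ℕ k) N d a b → lookup ρ N ≡ n → lookup ρ a < n →
                ⟦ reach N d a b ⟧ ρ → Walk (lookup ρ d) (lookup ρ a) (lookup ρ b)
  reach-sound ρ N d a b N≡ a< (z , _ , z≡0 , loop)
    with refl ← self-sum z z≡0
    with j , j≡ , w ← reach-chain ρ N N≡ (for-sound (0 ∷ ρ) 0F (suc d) (suc a) (suc b) (ReachStep N) loop) a< =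
    subst (λ d → Walk d (lookup ρ a) (lookup ρ b)) (trans (≡-sym (+-identityʳ j)) j≡) w

  reach-complete : ∀ (ρ : Vec ℕ k) N d a b → lookup ρ N ≡ n → lookup ρ a < n → lookup ρ d < B →
                   Walk (lookup ρ d) (lookup ρ a) (lookup ρ b) → ⟦ reach N d a b ⟧ ρ
  reach-complete ρ N d a b N≡ a< d< w =
    0 , 0<B , refl , for-complete (0 ∷ ρ) 0F (suc d) (suc a) (suc b) (ReachStep N) (<-trans a< n<B) d<
      (subst (λ t → Chain (Body (ReachStep N) (0 ∷ ρ)) 0 (lookup ρ a) t (lookup ρ b)) (+-identityʳ _) (go (lookup ρ d) 0 a< w))
    where
    go : ∀ j t {m m′} → m < n → Walk j m m′ → Chain (Body (ReachStep N) (0 ∷ ρ)) t m (j + t) m′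
    go zero t m< refl = []
    go (suc j) t {m} {m′} m< (c , c< , nr , w) =
      (<-trans c< n<B , ≺-complete ρ′ 0F (5 ↑ʳ N) (subst (_< B) (≡-sym N≡) n<B) (subst (c <_) (≡-sym N≡) c<) ,
       near-complete ρ′ (5 ↑ʳ N) 2F 0F N≡ m< c< nr) ∷
      subst (λ t′ → Chain (Body (ReachStep N) (0 ∷ ρ)) (suc t) c t′ m′) (+-suc j t) (go j (suc t) c< w)
      where
      ρ′ : Vec ℕ _
      ρ′ = c ∷ suc t ∷ m ∷ t ∷ 0 ∷ ρ

  AvoidStep : (N W D C U : Fin k) → Form (5 + k)
  AvoidStep N W D C U = 0F ≐ 2F ∨′ (0F ≐1+ 2F ∧′ reach (5 ↑ʳ N) (5 ↑ʳ D) 3F (5 ↑ʳ W) ∧′ far (5 ↑ʳ N) (5 ↑ʳ U) 3F)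

  avoid-sound : ∀ (ρ : Vec ℕ k) N W D C U → lookup ρ N ≡ n → lookup ρ U < n →
                lookup ρ C ≡ #within (lookup ρ D) (lookup ρ W) →
                ⟦ avoid N W D C U ⟧ ρ → ¬ Walk (suc (lookup ρ D)) (lookup ρ U) (lookup ρ W)
  avoid-sound {k} ρ N W D C U N≡ u< C≡ (z , _ , z≡0 , loop) (y , y< , nr , walk) with refl ← self-sum z z≡0 =
    proj₂ (count-squeeze Q? P? proj₁ n enough y< walk) nr
    where
    d w u : ℕ
    d = lookup ρ D
    w = lookup ρ W
    u = lookup ρ U
    P? : Decidable (λ y → Walk d y w)
    P? y = walk? d y w
    Q? : Decidable (λ y → Walk d y w × ¬ Near u y)
    Q? y = walk? d y w ×-dec ¬? (near? u y)
    -- A round may pass over a vertex that qualifies, so the accumulator is only bounded by the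
    -- count; `count-squeeze` needs no more.
    go : ∀ {t m m′} → t ≤ n → Chain (Body (AvoidStep N W D C U) (0 ∷ ρ)) t m n m′ → m ≤ count Q? t → m′ ≤ count Q? n
    go _ [] m≤ = m≤
    go {t} {m} _ (_∷_ {m₁ = m₁} (_ , inj₁ eq) c) m≤ with refl ← ≐-sound (m₁ ∷ suc t ∷ m ∷ t ∷ 0 ∷ ρ) 0F 2F eq =
      go (chain-≤ c) c (≤-trans m≤ (count-step Q? t))
    go {t} {m} _ (_∷_ {m₁ = m₁} (_ , inj₂ (eq , r , f)) c) m≤
      with refl ← ≐1+-sound (m₁ ∷ suc t ∷ m ∷ t ∷ 0 ∷ ρ) 0F 2F eq =
      -- The remaining chain leads from t + 1 to n, so `chain-≤ c` also says t < n.
      go (chain-≤ c) c (≤-trans (s≤s m≤) (≤-reflexive (≡-sym (count-yes Q?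
        (reach-sound ρ′ (5 ↑ʳ N) (5 ↑ʳ D) 3F (5 ↑ʳ W) N≡ (chain-≤ c) r ,
         far-sound ρ′ (5 ↑ʳ N) (5 ↑ʳ U) 3F N≡ u< (chain-≤ c) f)))))
      where
      ρ′ : Vec ℕ _
      ρ′ = suc m ∷ suc t ∷ m ∷ t ∷ 0 ∷ ρ
    enough : count P? n ≤ count Q? n
    enough = subst (_≤ count Q? n) C≡ (go z≤n (subst (λ l → Chain (Body (AvoidStep N W D C U) (0 ∷ ρ)) 0 0 l (lookup ρ C)) N≡
      (for-sound (0 ∷ ρ) 0F (suc N) 0F (suc C) (AvoidStep N W D C U) loop)) z≤n)

  avoid-complete : ∀ (ρ : Vec ℕ k) N W D C U → lookup ρ N ≡ n → lookup ρ U < n → lookup ρ D < B →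
                   lookup ρ C ≡ #within (lookup ρ D) (lookup ρ W) →
                   ¬ Walk (suc (lookup ρ D)) (lookup ρ U) (lookup ρ W) → ⟦ avoid N W D C U ⟧ ρ
  avoid-complete {k} ρ N W D C U N≡ u< d< C≡ ¬walk =
    0 , 0<B , refl , for-complete (0 ∷ ρ) 0F (suc N) 0F (suc C) (AvoidStep N W D C U) 0<B (subst (_< B) (≡-sym N≡) n<B)
      (subst₂ (Chain (Body (AvoidStep N W D C U) (0 ∷ ρ)) 0 0) (≡-sym N≡) (≡-sym C≡) (go n 0 (+-identityʳ n)))
    where
    d w u : ℕ
    d = lookup ρ D
    w = lookup ρ W
    u = lookup ρ U
    P? : Decidable (λ y → Walk d y w)
    P? y = walk? d y w
    small : ∀ t → t ≤ n → count P? t < B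
    small t t≤n = ≤-<-trans (≤-trans (count≤ P? t) t≤n) n<B
    step : ∀ t → t < n → Body (AvoidStep N W D C U) (0 ∷ ρ) t (count P? t) (count P? (suc t))
    step t t<n with P? t
    ... | yes walk = ≤-<-trans (s≤s (count≤ P? t)) (≤-<-trans t<n n<B) , inj₂
      (≐1+-complete ρ′ 0F 2F refl , reach-complete ρ′ (5 ↑ʳ N) (5 ↑ʳ D) 3F (5 ↑ʳ W) N≡ t<n d< walk ,
       far-complete ρ′ (5 ↑ʳ N) (5 ↑ʳ U) 3F N≡ u< t<n (λ nr → ¬walk (t , t<n , nr , walk)))
      where
      ρ′ : Vec ℕ _
      ρ′ = suc (count P? t) ∷ suc t ∷ count P? t ∷ t ∷ 0 ∷ ρ
    ... | no _ = small t (<⇒≤ t<n) , inj₁ (≐-complete (count P? t ∷ suc t ∷ count P? t ∷ t ∷ 0 ∷ ρ) 0F 2F refl)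
    go : ∀ j t → j + t ≡ n → Chain (Body (AvoidStep N W D C U) (0 ∷ ρ)) t (count P? t) n (count P? n)
    go zero    t refl = []
    go (suc j) t eq   = step t (≤-trans (s≤s (m≤n+m t j)) (≤-reflexive eq)) ∷ go j (suc t) (trans (+-suc j t) eq)

  RecountStep : (N W D D′ C : Fin k) → Form (5 + k)
  RecountStep N W D D′ C = (reach (5 ↑ʳ N) (5 ↑ʳ D′) 3F (5 ↑ʳ W) ∧′ 0F ≐1+ 2F) ∨′
    (avoid (5 ↑ʳ N) (5 ↑ʳ W) (5 ↑ʳ D) (5 ↑ʳ C) 3F ∧′ 0F ≐ 2F)

  recount-sound : ∀ (ρ : Vec ℕ k) N W D D′ C C′ → lookup ρ N ≡ n → lookup ρ D′ ≡ suc (lookup ρ D) →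
                  lookup ρ C ≡ #within (lookup ρ D) (lookup ρ W) →
                  ⟦ recount N W D D′ C C′ ⟧ ρ → lookup ρ C′ ≡ #within (suc (lookup ρ D)) (lookup ρ W)
  recount-sound {k} ρ N W D D′ C C′ N≡ D′≡ C≡ (z , _ , z≡0 , loop) with refl ← self-sum z z≡0 =
    go (subst (λ l → Chain (Body (RecountStep N W D D′ C) (0 ∷ ρ)) 0 0 l (lookup ρ C′)) N≡
      (for-sound (0 ∷ ρ) 0F (suc N) 0F (suc C′) (RecountStep N W D D′ C) loop)) refl
    where
    P? : Decidable (λ y → Walk (suc (lookup ρ D)) y (lookup ρ W))
    P? y = walk? (suc (lookup ρ D)) y (lookup ρ W)
    go : ∀ {t m m′} → Chain (Body (RecountStep N W D D′ C) (0 ∷ ρ)) t m n m′ → m ≡ count P? t → m′ ≡ count P? n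
    go [] m≡ = m≡
    go {t} {m} (_∷_ {m₁ = m₁} (_ , inj₁ (r , eq)) c) refl =
      go c (trans (≐1+-sound ρ′ 0F 2F eq) (≡-sym (count-yes P?
        (subst (λ d → Walk d t (lookup ρ W)) D′≡ (reach-sound ρ′ (5 ↑ʳ N) (5 ↑ʳ D′) 3F (5 ↑ʳ W) N≡ (chain-≤ c) r)))))
      where
      ρ′ : Vec ℕ _
      ρ′ = m₁ ∷ suc t ∷ m ∷ t ∷ 0 ∷ ρ
    go {t} {m} (_∷_ {m₁ = m₁} (_ , inj₂ (av , eq)) c) refl =
      go c (trans (≐-sound ρ′ 0F 2F eq) (≡-sym (count-no P?
        (avoid-sound ρ′ (5 ↑ʳ N) (5 ↑ʳ W) (5 ↑ʳ D) (5 ↑ʳ C) 3F N≡ (chain-≤ c) C≡ av))))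
      where
      ρ′ : Vec ℕ _
      ρ′ = m₁ ∷ suc t ∷ m ∷ t ∷ 0 ∷ ρ

  recount-complete : ∀ (ρ : Vec ℕ k) N W D D′ C C′ → lookup ρ N ≡ n → lookup ρ D′ ≡ suc (lookup ρ D) → lookup ρ D′ < B →
                     lookup ρ C ≡ #within (lookup ρ D) (lookup ρ W) →
                     lookup ρ C′ ≡ #within (suc (lookup ρ D)) (lookup ρ W) → ⟦ recount N W D D′ C C′ ⟧ ρ
  recount-complete {k} ρ N W D D′ C C′ N≡ D′≡ d′< C≡ C′≡ =
    0 , 0<B , refl , for-complete (0 ∷ ρ) 0F (suc N) 0F (suc C′) (RecountStep N W D D′ C) 0<B (subst (_< B) (≡-sym N≡) n<B)
      (subst₂ (Chain (Body (RecountStep N W D D′ C) (0 ∷ ρ)) 0 0) (≡-sym N≡) (≡-sym C′≡) (go n 0 (+-identityʳ n)))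
    where
    P? : Decidable (λ y → Walk (suc (lookup ρ D)) y (lookup ρ W))
    P? y = walk? (suc (lookup ρ D)) y (lookup ρ W)
    step : ∀ t → t < n → Body (RecountStep N W D D′ C) (0 ∷ ρ) t (count P? t) (count P? (suc t))
    step t t<n with P? t
    ... | yes walk = ≤-<-trans (s≤s (count≤ P? t)) (≤-<-trans t<n n<B) , inj₁
      (reach-complete ρ′ (5 ↑ʳ N) (5 ↑ʳ D′) 3F (5 ↑ʳ W) N≡ t<n d′< (subst (λ d → Walk d t (lookup ρ W)) (≡-sym D′≡) walk) ,
       ≐1+-complete ρ′ 0F 2F refl)
      where
      ρ′ : Vec ℕ _
      ρ′ = suc (count P? t) ∷ suc t ∷ count P? t ∷ t ∷ 0 ∷ ρ
    ... | no ¬walk = ≤-<-trans (count≤ P? t) (<-trans t<n n<B) , inj₂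
      (avoid-complete ρ′ (5 ↑ʳ N) (5 ↑ʳ W) (5 ↑ʳ D) (5 ↑ʳ C) 3F N≡ t<n
         (<-trans (≤-reflexive (≡-sym D′≡)) d′<) C≡ ¬walk ,
       ≐-complete ρ′ 0F 2F refl)
      where
      ρ′ : Vec ℕ _
      ρ′ = count P? t ∷ suc t ∷ count P? t ∷ t ∷ 0 ∷ ρ
    go : ∀ j t → j + t ≡ n → Chain (Body (RecountStep N W D D′ C) (0 ∷ ρ)) t (count P? t) n (count P? n)
    go zero    t refl = []
    go (suc j) t eq   = step t (≤-trans (s≤s (m≤n+m t j)) (≤-reflexive eq)) ∷ go j (suc t) (trans (+-suc j t) eq)

  CountStep : (N W : Fin k) → Form (6 + k)
  CountStep N W = recount (6 ↑ʳ N) (6 ↑ʳ W) 3F 1F 2F 0F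

  counted-sound : ∀ (ρ : Vec ℕ k) N W D C → lookup ρ N ≡ n → lookup ρ W < n →
                  ⟦ counted N W D C ⟧ ρ → lookup ρ C ≡ #within (lookup ρ D) (lookup ρ W)
  counted-sound {k} ρ N W D C N≡ w< (z , _ , z≡0 , o , _ , o≡1 , loop)
    with refl ← self-sum z z≡0 with refl ← ≐1+-sound (o ∷ 0 ∷ ρ) 0F 1F o≡1 =
    go (for-sound (1 ∷ 0 ∷ ρ) 1F (2 ↑ʳ D) 0F (2 ↑ʳ C) (CountStep N W) loop) (≡-sym (count-≡ (lookup ρ W) n w<))
    where
    go : ∀ {t m t′ m′} → Chain (Body (CountStep N W) (1 ∷ 0 ∷ ρ)) t m t′ m′ →
         m ≡ #within t (lookup ρ W) → m′ ≡ #within t′ (lookup ρ W)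
    go [] m≡ = m≡
    go {t} {m} (_∷_ {m₁ = m₁} (_ , r) c) m≡ =
      go c (recount-sound (m₁ ∷ suc t ∷ m ∷ t ∷ 1 ∷ 0 ∷ ρ) (6 ↑ʳ N) (6 ↑ʳ W) 3F 1F 2F 0F N≡ refl m≡ r)

  counted-complete : ∀ (ρ : Vec ℕ k) N W D C → lookup ρ N ≡ n → lookup ρ W < n → lookup ρ D < B →
                     lookup ρ C ≡ #within (lookup ρ D) (lookup ρ W) → ⟦ counted N W D C ⟧ ρ
  counted-complete {k} ρ N W D C N≡ w< d< C≡ =
    0 , 0<B , refl , 1 , 1<B , ≐1+-complete (1 ∷ 0 ∷ ρ) 0F 1F refl ,
    for-complete (1 ∷ 0 ∷ ρ) 1F (2 ↑ʳ D) 0F (2 ↑ʳ C) (CountStep N W) 1<B d<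
      (subst₂ (λ m m′ → Chain (Body (CountStep N W) (1 ∷ 0 ∷ ρ)) 0 m d m′) (count-≡ w n w<) (≡-sym C≡) (go d 0 (+-identityʳ d)))
    where
    d w : ℕ
    d = lookup ρ D
    w = lookup ρ W
    1<B : 1 < B
    1<B = ≤-<-trans (≤-<-trans z≤n w<) n<B
    go : ∀ j t → j + t ≡ d → Chain (Body (CountStep N W) (1 ∷ 0 ∷ ρ)) t (#within t w) d (#within d w)
    go zero    t refl = []
    go (suc j) t eq   =
      (≤-<-trans (count≤ (λ y → walk? (suc t) y w) n) n<B ,
       recount-complete (#within (suc t) w ∷ suc t ∷ #within t w ∷ t ∷ 1 ∷ 0 ∷ ρ) (6 ↑ʳ N) (6 ↑ʳ W) 3F 1F 2F 0F N≡ refl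
         (≤-<-trans (≤-trans (s≤s (m≤n+m t j)) (≤-reflexive eq)) d<) refl refl) ∷
      go j (suc t) (trans (+-suc j t) eq)

  unreach-sound : ∀ (ρ : Vec ℕ k) N D A W → lookup ρ N ≡ n → lookup ρ A < n → lookup ρ W < n →
                  ⟦ unreach N D A W ⟧ ρ → ¬ Walk (lookup ρ D) (lookup ρ A) (lookup ρ W)
  unreach-sound ρ N D A W N≡ a< w< (inj₁ (d≡0 , df)) walk rewrite isZero-sound ρ D d≡0 = differ-sound ρ A W df walk
  unreach-sound ρ N D A W N≡ a< w< (inj₂ (j , _ , c , _ , d≡ , cn , av)) walk =
    avoid-sound (c ∷ j ∷ ρ) (2 ↑ʳ N) (2 ↑ʳ W) 1F 0F (2 ↑ʳ A) N≡ a<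
      (counted-sound (c ∷ j ∷ ρ) (2 ↑ʳ N) (2 ↑ʳ W) 1F 0F N≡ w< cn) av
      (subst (λ d → Walk d (lookup ρ A) (lookup ρ W)) (≐1+-sound (c ∷ j ∷ ρ) (2 ↑ʳ D) 1F d≡) walk)

  unreach-complete : ∀ (ρ : Vec ℕ k) N D A W → lookup ρ N ≡ n → lookup ρ A < n → lookup ρ W < n → lookup ρ D < B →
                     ¬ Walk (lookup ρ D) (lookup ρ A) (lookup ρ W) → ⟦ unreach N D A W ⟧ ρ
  unreach-complete ρ N D A W N≡ a< w< d< ¬walk = cases (lookup ρ D) refl
    where
    cases : ∀ d → lookup ρ D ≡ d → ⟦ unreach N D A W ⟧ ρ
    cases zero D≡ = inj₁ (isZero-complete ρ D D≡ , differ-complete ρ A W (<-trans a< n<B) (<-trans w< n<B)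
      (λ walk → ¬walk (subst (λ d → Walk d (lookup ρ A) (lookup ρ W)) (≡-sym D≡) walk)))
    cases (suc j) D≡ = inj₂ (j , j< , c , ≤-<-trans (count≤ (λ y → walk? j y (lookup ρ W)) n) n<B ,
      ≐1+-complete (c ∷ j ∷ ρ) (2 ↑ʳ D) 1F D≡ ,
      counted-complete (c ∷ j ∷ ρ) (2 ↑ʳ N) (2 ↑ʳ W) 1F 0F N≡ w< j< refl ,
      avoid-complete (c ∷ j ∷ ρ) (2 ↑ʳ N) (2 ↑ʳ W) 1F 0F (2 ↑ʳ A) N≡ a< j< refl
        (λ walk → ¬walk (subst (λ d → Walk d (lookup ρ A) (lookup ρ W)) (≡-sym D≡) walk)))
      where
      c : ℕ
      c = #within j (lookup ρ W)
      j< : j < B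
      j< = <-trans (n<1+n j) (subst (_< B) D≡ d<)

-- Comparison of two vertices

missed : ∀ {k} → (n d w : Fin k) → Form (5 + k)
missed n d w = unreach (5 ↑ʳ n) (5 ↑ʳ d) 3F (5 ↑ʳ w)

noneBelow : ∀ {k} → (n d a w : Fin k) → Form k
noneBelow n d a w = allBelow a (missed n d w)

noNeighbourBelow : ∀ {k} → (n d c a w : Fin k) → Form k
noNeighbourBelow n d c a w = allBelow a (entryIs is𝟎 (5 ↑ʳ n) (5 ↑ʳ c) 3F ∨′ missed n d w)

-- Variable 0 is the remaining distance d - t, guessed through d = t + r; variables 3 and 1 are the
-- old and the new vertex of the path to `w`.
raceStep : ∀ {k} → (n v w d : Fin k) → Form (4 + k)
raceStep n v w d = ex (sum (5 ↑ʳ d) 4F 0F false ∧′ 1F ≺ (5 ↑ʳ n) ∧′ entryIs is𝟏 (5 ↑ʳ n) 3F 1F ∧′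
  reach (5 ↑ʳ n) 0F 1F (5 ↑ʳ w) ∧′ reach (5 ↑ʳ n) 0F 1F (5 ↑ʳ v) ∧′ noNeighbourBelow (5 ↑ʳ n) 0F 3F 1F (5 ↑ʳ w))

raceEnd : ∀ {k} → (n v w d c : Fin k) → Form k
raceEnd n v w d c = ex (0F ≺ (1 ↑ʳ n) ∧′ entryIs is𝟏 (1 ↑ʳ n) (1 ↑ʳ c) 0F ∧′ reach (1 ↑ʳ n) (1 ↑ʳ d) 0F (1 ↑ʳ v) ∧′
  noNeighbourBelow (1 ↑ʳ n) (1 ↑ʳ d) (1 ↑ʳ c) 0F (1 ↑ʳ w) ∧′ unreach (1 ↑ʳ n) (1 ↑ʳ d) 0F (1 ↑ʳ w))

-- Three numbers are guessed after the zero: how many edges the walk to `v` shares with the path to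
-- `w`, the vertex where they part, and the rest of d.
race : ∀ {k} → (n v w d c : Fin k) → Form k
race n v w d c = ex (isZero 0F ∧′ ex (ex (ex (
  sum (4 ↑ʳ d) 2F 0F false ∧′ 1F ≺ (4 ↑ʳ n) ∧′
  for 3F 2F (4 ↑ʳ c) 1F (raceStep (4 ↑ʳ n) (4 ↑ʳ v) (4 ↑ʳ w) (4 ↑ʳ d)) ∧′
  raceEnd (4 ↑ʳ n) (4 ↑ʳ v) (4 ↑ʳ w) 0F 1F))))

-- v₀ is never determined. In the first disjunct any vertex of the component of `v` below w₀ will
-- do. In the second, the least vertex of the component of `w` reaches `v`, so it is v₀ as well.
-- Distance n stands for connectedness. The innermost variable d is less than the distance to `w`;
-- in the race it is exactly one less.
precedes : ∀ {k} → (n v w : Fin k) → Form k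
precedes n v w =
  ex (0F ≺ (1 ↑ʳ n) ∧′ reach (1 ↑ʳ n) (1 ↑ʳ n) 0F (1 ↑ʳ v) ∧′ noneBelow (1 ↑ʳ n) (1 ↑ʳ n) 0F (1 ↑ʳ w) ∧′
      unreach (1 ↑ʳ n) (1 ↑ʳ n) 0F (1 ↑ʳ w)) ∨′
  ex (0F ≺ (1 ↑ʳ n) ∧′ reach (1 ↑ʳ n) (1 ↑ʳ n) 0F (1 ↑ʳ v) ∧′ reach (1 ↑ʳ n) (1 ↑ʳ n) 0F (1 ↑ʳ w) ∧′
      noneBelow (1 ↑ʳ n) (1 ↑ʳ n) 0F (1 ↑ʳ w) ∧′
      ex (unreach (2 ↑ʳ n) 0F 1F (2 ↑ʳ w) ∧′
        (reach (2 ↑ʳ n) 0F 1F (2 ↑ʳ v) ∨′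
         ex (0F ≐1+ 1F ∧′ reach (3 ↑ʳ n) 0F 2F (3 ↑ʳ w)) ∧′ race (2 ↑ʳ n) (2 ↑ʳ v) (2 ↑ʳ w) 0F 1F)))

-- The comparison as a statement on walks

module Comparison (n : ℕ) (e : ℕ → ℕ → Bool) where
  open Walks n e

  NoneBelow : ℕ → ℕ → ℕ → Set
  NoneBelow w d a = ∀ u → u < a → ¬ Walk d u w

  NoNeighbourBelow : ℕ → ℕ → ℕ → ℕ → Set
  NoNeighbourBelow w d c a = ∀ u → u < a → e c u ≡ true → ¬ Walk d u w

  -- Race v w d c: some walk of length ≤ d + 1 from c to v precedes the least
  -- shortest path from c to w, where w is at distance d + 1 from c.
  data Race (v w : ℕ) : ℕ → ℕ → Set where
    overtake : ∀ {d c} a → a < n → e c a ≡ true → Walk d a v → NoNeighbourBelow w d c a → ¬ Walk d a w → Race v w d c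
    follow   : ∀ {d c} c′ → c′ < n → e c c′ ≡ true → Walk (suc d) c′ w → Walk (suc d) c′ v →
               NoNeighbourBelow w (suc d) c c′ → Race v w d c′ → Race v w (suc d) c

  -- The bound on d is a parameter because a true formula yields only d < B, whereas the opposite
  -- direction supplies d < n, which fits into a register.
  Precedes : ℕ → ℕ → ℕ → Set
  Precedes bound v w =
    (∃[ a ] a < n × Walk n a v × NoneBelow w n a × ¬ Walk n a w) ⊎
    (∃[ c ] c < n × Walk n c v × Walk n c w × NoneBelow w n c ×
      ∃[ d ] d < bound × ¬ Walk d c w × (Walk d c v ⊎ Walk (suc d) c w × Race v w d c))

module ComparisonFormulas (x : List Symbol) (B n : ℕ) (e : ℕ → ℕ → Bool)
  (matrix : ∀ {a b} → a < n → b < n → readInput x (a * n + b + 1 + n + 1) ≡ sym (bit (e a b)))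
  (large  : n * n + n + 2 ≤ B) where
  open DistanceFormulas x B n e matrix large public
  open Comparison n e

  private variable
    k : ℕ

  noneBelow-sound : ∀ (ρ : Vec ℕ k) N D A W → lookup ρ N ≡ n → lookup ρ A < n → lookup ρ W < n →
                    ⟦ noneBelow N D A W ⟧ ρ → NoneBelow (lookup ρ W) (lookup ρ D) (lookup ρ A)
  noneBelow-sound ρ N D A W N≡ a< w< all u u<a with m , m′ , t ← allBelow-sound ρ A (missed N D W) all u u<a =
    unreach-sound (m′ ∷ suc u ∷ m ∷ u ∷ 0 ∷ ρ) (5 ↑ʳ N) (5 ↑ʳ D) 3F (5 ↑ʳ W) N≡ (<-trans u<a a<) w< t

  noneBelow-complete : ∀ (ρ : Vec ℕ k) N D A W → lookup ρ N ≡ n → lookup ρ A < n → lookup ρ W < n → lookup ρ D < B →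
                       NoneBelow (lookup ρ W) (lookup ρ D) (lookup ρ A) → ⟦ noneBelow N D A W ⟧ ρ
  noneBelow-complete ρ N D A W N≡ a< w< d< none = allBelow-complete ρ A (missed N D W) (<-trans a< n<B) λ u u<a →
    unreach-complete (0 ∷ suc u ∷ 0 ∷ u ∷ 0 ∷ ρ) (5 ↑ʳ N) (5 ↑ʳ D) 3F (5 ↑ʳ W) N≡ (<-trans u<a a<) w< d< (none u u<a)

  noNeighbourBelow-sound : ∀ (ρ : Vec ℕ k) N D C A W → lookup ρ N ≡ n → lookup ρ C < n → lookup ρ A < n → lookup ρ W < n →
    ⟦ noNeighbourBelow N D C A W ⟧ ρ → NoNeighbourBelow (lookup ρ W) (lookup ρ D) (lookup ρ C) (lookup ρ A)
  noNeighbourBelow-sound ρ N D C A W N≡ c< a< w< all u u<a edge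
    with allBelow-sound ρ A (entryIs is𝟎 (5 ↑ʳ N) (5 ↑ʳ C) 3F ∨′ missed N D W) all u u<a
  ... | m , m′ , inj₁ t with () ← trans (≡-sym edge)
        (unlinked-sound (m′ ∷ suc u ∷ m ∷ u ∷ 0 ∷ ρ) (5 ↑ʳ N) (5 ↑ʳ C) 3F N≡ c< (<-trans u<a a<) t)
  ... | m , m′ , inj₂ t =
    unreach-sound (m′ ∷ suc u ∷ m ∷ u ∷ 0 ∷ ρ) (5 ↑ʳ N) (5 ↑ʳ D) 3F (5 ↑ʳ W) N≡ (<-trans u<a a<) w< t

  noNeighbourBelow-complete : ∀ (ρ : Vec ℕ k) N D C A W →
    lookup ρ N ≡ n → lookup ρ C < n → lookup ρ A < n → lookup ρ W < n → lookup ρ D < B →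
    NoNeighbourBelow (lookup ρ W) (lookup ρ D) (lookup ρ C) (lookup ρ A) → ⟦ noNeighbourBelow N D C A W ⟧ ρ
  noNeighbourBelow-complete ρ N D C A W N≡ c< a< w< d< none =
    allBelow-complete ρ A (entryIs is𝟎 (5 ↑ʳ N) (5 ↑ʳ C) 3F ∨′ missed N D W) (<-trans a< n<B) body-holds
    where
    body-holds : ∀ u → u < lookup ρ A → ⟦ entryIs is𝟎 (5 ↑ʳ N) (5 ↑ʳ C) 3F ∨′ missed N D W ⟧
                                          (0 ∷ suc u ∷ 0 ∷ u ∷ 0 ∷ ρ)
    body-holds u u<a with e (lookup ρ C) u in edge
    ... | false = inj₁ (unlinked-complete (0 ∷ suc u ∷ 0 ∷ u ∷ 0 ∷ ρ) (5 ↑ʳ N) (5 ↑ʳ C) 3F N≡ c< (<-trans u<a a<) edge)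
    ... | true  = inj₂ (unreach-complete (0 ∷ suc u ∷ 0 ∷ u ∷ 0 ∷ ρ) (5 ↑ʳ N) (5 ↑ʳ D) 3F (5 ↑ʳ W) N≡ (<-trans u<a a<) w< d<
                          (none u u<a edge))

  raceEnd-sound : ∀ (ρ : Vec ℕ k) N V W D C → lookup ρ N ≡ n → lookup ρ C < n → lookup ρ W < n →
                  ⟦ raceEnd N V W D C ⟧ ρ → Race (lookup ρ V) (lookup ρ W) (lookup ρ D) (lookup ρ C)
  raceEnd-sound ρ N V W D C N≡ c< w< (a , _ , lt , edge , r , none , un)
    with a< ← subst (a <_) N≡ (≺-sound (a ∷ ρ) 0F (suc N) lt) =
    overtake a a< (linked-sound (a ∷ ρ) (suc N) (suc C) 0F N≡ c< a< edge)
      (reach-sound (a ∷ ρ) (suc N) (suc D) 0F (suc V) N≡ a< r)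
      (noNeighbourBelow-sound (a ∷ ρ) (suc N) (suc D) (suc C) 0F (suc W) N≡ c< a< w< none)
      (unreach-sound (a ∷ ρ) (suc N) (suc D) 0F (suc W) N≡ a< w< un)

  -- The loop is read from its end, since the innermost constructor of `Race` is the parting of the
  -- two walks, which `end` provides.
  race-chain : ∀ (ρ : Vec ℕ k) N V W D → lookup ρ N ≡ n → lookup ρ W < n → ∀ {t m t′ m′ r} →
    Chain (Body (raceStep N V W D) ρ) t m t′ m′ → m < n → lookup ρ D ≡ t′ + r →
    (m′ < n → Race (lookup ρ V) (lookup ρ W) r m′) →
    ∃[ r′ ] lookup ρ D ≡ t + r′ × Race (lookup ρ V) (lookup ρ W) r′ m
  race-chain ρ N V W D N≡ w< [] m< d≡ end = _ , d≡ , end m<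
  race-chain {k} ρ N V W D N≡ w< {t} {m} (_∷_ {m₁ = c} (_ , s , _ , s≡ , lt , edge , rw , rv , none) ch) m< d≡ end
    with c< ← subst (c <_) N≡ (≺-sound (s ∷ c ∷ suc t ∷ m ∷ t ∷ ρ) 1F (5 ↑ʳ N) lt)
    with r′ , d≡′ , rest ← race-chain ρ N V W D N≡ w< ch c< d≡ end
    -- The guessed remaining distance s is r′ + 1, as both complete t to d.
    with refl ← +-cancelˡ-≡ t s (suc r′) (trans (≡-sym (trans s≡ (+-identityʳ _))) (trans d≡′ (≡-sym (+-suc t r′)))) =
    suc r′ , trans d≡′ (≡-sym (+-suc t r′)) ,
    follow c c< (linked-sound ρ′ (5 ↑ʳ N) 3F 1F N≡ m< c< edge) (reach-sound ρ′ (5 ↑ʳ N) 0F 1F (5 ↑ʳ W) N≡ c< rw)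
      (reach-sound ρ′ (5 ↑ʳ N) 0F 1F (5 ↑ʳ V) N≡ c< rv)
      (noNeighbourBelow-sound ρ′ (5 ↑ʳ N) 0F 3F 1F (5 ↑ʳ W) N≡ m< c< w< none) rest
    where
    ρ′ : Vec ℕ (5 + k)
    ρ′ = suc r′ ∷ c ∷ suc t ∷ m ∷ t ∷ ρ

  race-sound : ∀ (ρ : Vec ℕ k) N V W D C → lookup ρ N ≡ n → lookup ρ C < n → lookup ρ W < n →
               ⟦ race N V W D C ⟧ ρ → Race (lookup ρ V) (lookup ρ W) (lookup ρ D) (lookup ρ C)
  race-sound ρ N V W D C N≡ c< w< (z , _ , z≡0 , T , _ , c′ , _ , r , _ , d≡ , lt , loop , end)
    with refl ← self-sum z z≡0
    with r′ , refl , rc ← race-chain (r ∷ c′ ∷ T ∷ 0 ∷ ρ) (4 ↑ʳ N) (4 ↑ʳ V) (4 ↑ʳ W) (4 ↑ʳ D) N≡ w<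
           (for-sound (r ∷ c′ ∷ T ∷ 0 ∷ ρ) 3F 2F (4 ↑ʳ C) 1F (raceStep (4 ↑ʳ N) (4 ↑ʳ V) (4 ↑ʳ W) (4 ↑ʳ D)) loop)
           c< (trans d≡ (+-identityʳ _))
           (λ c′< → raceEnd-sound (r ∷ c′ ∷ T ∷ 0 ∷ ρ) (4 ↑ʳ N) (4 ↑ʳ V) (4 ↑ʳ W) 0F 1F N≡ c′< w< end) = rc

  raceEnd-complete : ∀ (ρ : Vec ℕ k) N V W D C a → lookup ρ N ≡ n → lookup ρ C < n → lookup ρ W < n → lookup ρ D < B →
    a < n → e (lookup ρ C) a ≡ true → Walk (lookup ρ D) a (lookup ρ V) →
    NoNeighbourBelow (lookup ρ W) (lookup ρ D) (lookup ρ C) a → ¬ Walk (lookup ρ D) a (lookup ρ W) →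
    ⟦ raceEnd N V W D C ⟧ ρ
  raceEnd-complete ρ N V W D C a N≡ c< w< d< a< edge wv none un =
    a , <-trans a< n<B , ≺-complete (a ∷ ρ) 0F (suc N) (subst (_< B) (≡-sym N≡) n<B) (subst (a <_) (≡-sym N≡) a<) ,
    linked-complete (a ∷ ρ) (suc N) (suc C) 0F N≡ c< a< edge ,
    reach-complete (a ∷ ρ) (suc N) (suc D) 0F (suc V) N≡ a< d< wv ,
    noNeighbourBelow-complete (a ∷ ρ) (suc N) (suc D) (suc C) 0F (suc W) N≡ c< a< w< d< none ,
    unreach-complete (a ∷ ρ) (suc N) (suc D) 0F (suc W) N≡ a< w< d< un

  RaceEnd : ℕ → ℕ → ℕ → ℕ → Set
  RaceEnd v w r c = ∃[ a ] a < n × e c a ≡ true × Walk r a v × NoNeighbourBelow w r c a × ¬ Walk r a w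

  RaceStep : ℕ → ℕ → ℕ → ℕ → ℕ → ℕ → Set
  RaceStep v w d t c c′ = ∃[ r ] d ≡ t + r × c < n × c′ < n × e c c′ ≡ true × Walk r c′ w × Walk r c′ v × NoNeighbourBelow w r c c′

  race⇒chain : ∀ {v w d r t c} → d ≡ t + r → c < n → Race v w r c →
    ∃[ t′ ] ∃[ c′ ] ∃[ r′ ] Chain (RaceStep v w d) t c t′ c′ × c′ < n × d ≡ t′ + r′ × RaceEnd v w r′ c′
  race⇒chain d≡ c< (overtake a a< edge wv none un) = _ , _ , _ , [] , c< , d≡ , a , a< , edge , wv , none , un
  race⇒chain {t = t} d≡ c< (follow c′ c′< edge ww wv none rest)
    with t′ , c″ , r′ , ch , end ← race⇒chain (trans d≡ (+-suc t _)) c′< rest =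
    t′ , c″ , r′ , (_ , d≡ , c< , c′< , edge , ww , wv , none) ∷ ch , end

  raceStep-complete : ∀ (ρ : Vec ℕ k) N V W D → lookup ρ N ≡ n → lookup ρ W < n → lookup ρ D < B → ∀ {t c c′} →
                      RaceStep (lookup ρ V) (lookup ρ W) (lookup ρ D) t c c′ → Body (raceStep N V W D) ρ t c c′
  raceStep-complete {k} ρ N V W D N≡ w< d< {t} {c} {c′} (r , d≡ , c< , c′< , edge , ww , wv , none) =
    <-trans c′< n<B , r , r<B , trans d≡ (≡-sym (+-identityʳ _)) ,
    ≺-complete ρ′ 1F (5 ↑ʳ N) (subst (_< B) (≡-sym N≡) n<B) (subst (c′ <_) (≡-sym N≡) c′<) ,
    linked-complete ρ′ (5 ↑ʳ N) 3F 1F N≡ c< c′< edge ,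
    reach-complete ρ′ (5 ↑ʳ N) 0F 1F (5 ↑ʳ W) N≡ c′< r<B ww , reach-complete ρ′ (5 ↑ʳ N) 0F 1F (5 ↑ʳ V) N≡ c′< r<B wv ,
    noNeighbourBelow-complete ρ′ (5 ↑ʳ N) 0F 3F 1F (5 ↑ʳ W) N≡ c< c′< w< r<B none
    where
    ρ′ : Vec ℕ (5 + k)
    ρ′ = r ∷ c′ ∷ suc t ∷ c ∷ t ∷ ρ
    r<B : r < B
    r<B = ≤-<-trans (≤-trans (m≤n+m r t) (≤-reflexive (≡-sym d≡))) d<

  race-complete : ∀ (ρ : Vec ℕ k) N V W D C → lookup ρ N ≡ n → lookup ρ C < n → lookup ρ W < n → lookup ρ D < B →
                  Race (lookup ρ V) (lookup ρ W) (lookup ρ D) (lookup ρ C) → ⟦ race N V W D C ⟧ ρ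
  race-complete ρ N V W D C N≡ c< w< d< rc
    with T , c′ , r , ch , c′< , d≡ , a , a< , edge , wv , none , un ← race⇒chain {t = 0} refl c< rc
    with T<B ← ≤-<-trans (≤-trans (m≤m+n T r) (≤-reflexive (≡-sym d≡))) d<
    with r<B ← ≤-<-trans (≤-trans (m≤n+m r T) (≤-reflexive (≡-sym d≡))) d< =
    0 , 0<B , refl , T , T<B , c′ , <-trans c′< n<B , r , r<B , trans d≡ (≡-sym (+-identityʳ _)) ,
    ≺-complete (r ∷ c′ ∷ T ∷ 0 ∷ ρ) 1F (4 ↑ʳ N) (subst (_< B) (≡-sym N≡) n<B) (subst (c′ <_) (≡-sym N≡) c′<) ,
    for-complete (r ∷ c′ ∷ T ∷ 0 ∷ ρ) 3F 2F (4 ↑ʳ C) 1F (raceStep (4 ↑ʳ N) (4 ↑ʳ V) (4 ↑ʳ W) (4 ↑ʳ D))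
      (<-trans c< n<B) T<B
      (chain-map (raceStep-complete (r ∷ c′ ∷ T ∷ 0 ∷ ρ) (4 ↑ʳ N) (4 ↑ʳ V) (4 ↑ʳ W) (4 ↑ʳ D) N≡ w< d<) ch) ,
    raceEnd-complete (r ∷ c′ ∷ T ∷ 0 ∷ ρ) (4 ↑ʳ N) (4 ↑ʳ V) (4 ↑ʳ W) 0F 1F a N≡ c′< w< r<B a< edge wv none un

  precedes-sound : ∀ (ρ : Vec ℕ k) N V W → lookup ρ N ≡ n → lookup ρ W < n →
                   ⟦ precedes N V W ⟧ ρ → Precedes B (lookup ρ V) (lookup ρ W)
  precedes-sound ρ N V W N≡ w< (inj₁ (a , _ , lt , rv , none , un))
    with a< ← subst (a <_) N≡ (≺-sound (a ∷ ρ) 0F (suc N) lt) = inj₁ (a , a< ,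
      subst (λ d → Walk d a (lookup ρ V)) N≡ (reach-sound (a ∷ ρ) (suc N) (suc N) 0F (suc V) N≡ a< rv) ,
      subst (λ d → NoneBelow (lookup ρ W) d a) N≡ (noneBelow-sound (a ∷ ρ) (suc N) (suc N) 0F (suc W) N≡ a< w< none) ,
      subst (λ d → ¬ Walk d a (lookup ρ W)) N≡ (unreach-sound (a ∷ ρ) (suc N) (suc N) 0F (suc W) N≡ a< w< un))
  precedes-sound ρ N V W N≡ w< (inj₂ (c , _ , lt , rv , rw , none , d , d<B , un , rest))
    with c< ← subst (c <_) N≡ (≺-sound (c ∷ ρ) 0F (suc N) lt) = inj₂ (c , c< ,
      subst (λ d → Walk d c (lookup ρ V)) N≡ (reach-sound (c ∷ ρ) (suc N) (suc N) 0F (suc V) N≡ c< rv) ,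
      subst (λ d → Walk d c (lookup ρ W)) N≡ (reach-sound (c ∷ ρ) (suc N) (suc N) 0F (suc W) N≡ c< rw) ,
      subst (λ d → NoneBelow (lookup ρ W) d c) N≡ (noneBelow-sound (c ∷ ρ) (suc N) (suc N) 0F (suc W) N≡ c< w< none) ,
      d , d<B , unreach-sound (d ∷ c ∷ ρ) (2 ↑ʳ N) 0F 1F (2 ↑ʳ W) N≡ c< w< un , cases c< rest)
    where
    cases : c < n → _ → Walk d c (lookup ρ V) ⊎ Walk (suc d) c (lookup ρ W) × Race (lookup ρ V) (lookup ρ W) d c
    cases c< (inj₁ r) = inj₁ (reach-sound (d ∷ c ∷ ρ) (2 ↑ʳ N) 0F 1F (2 ↑ʳ V) N≡ c< r)
    cases c< (inj₂ ((d′ , _ , d′≡ , r) , rc)) = inj₂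
      (subst (λ d → Walk d c (lookup ρ W)) (≐1+-sound (d′ ∷ d ∷ c ∷ ρ) 0F 1F d′≡)
         (reach-sound (d′ ∷ d ∷ c ∷ ρ) (3 ↑ʳ N) 0F 2F (3 ↑ʳ W) N≡ c< r) ,
       race-sound (d ∷ c ∷ ρ) (2 ↑ʳ N) (2 ↑ʳ V) (2 ↑ʳ W) 0F 1F N≡ c< w< rc)

  precedes-complete : ∀ (ρ : Vec ℕ k) N V W → lookup ρ N ≡ n → lookup ρ W < n →
                      Precedes n (lookup ρ V) (lookup ρ W) → ⟦ precedes N V W ⟧ ρ
  precedes-complete ρ N V W N≡ w< = cases
    where
    N<B : lookup ρ N < B
    N<B = subst (_< B) (≡-sym N≡) n<B
    cases : Precedes n (lookup ρ V) (lookup ρ W) → ⟦ precedes N V W ⟧ ρ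
    cases (inj₁ (a , a< , wv , none , un)) = inj₁ (a , <-trans a< n<B ,
      ≺-complete (a ∷ ρ) 0F (suc N) N<B (subst (a <_) (≡-sym N≡) a<) ,
      reach-complete (a ∷ ρ) (suc N) (suc N) 0F (suc V) N≡ a< N<B (subst (λ d → Walk d a (lookup ρ V)) (≡-sym N≡) wv) ,
      noneBelow-complete (a ∷ ρ) (suc N) (suc N) 0F (suc W) N≡ a< w< N<B
        (subst (λ d → NoneBelow (lookup ρ W) d a) (≡-sym N≡) none) ,
      unreach-complete (a ∷ ρ) (suc N) (suc N) 0F (suc W) N≡ a< w< N<B
        (subst (λ d → ¬ Walk d a (lookup ρ W)) (≡-sym N≡) un))
    cases (inj₂ (c , c< , wv , ww , none , d , d< , un , rest)) = inj₂ (c , <-trans c< n<B ,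
      ≺-complete (c ∷ ρ) 0F (suc N) N<B (subst (c <_) (≡-sym N≡) c<) ,
      reach-complete (c ∷ ρ) (suc N) (suc N) 0F (suc V) N≡ c< N<B (subst (λ d → Walk d c (lookup ρ V)) (≡-sym N≡) wv) ,
      reach-complete (c ∷ ρ) (suc N) (suc N) 0F (suc W) N≡ c< N<B (subst (λ d → Walk d c (lookup ρ W)) (≡-sym N≡) ww) ,
      noneBelow-complete (c ∷ ρ) (suc N) (suc N) 0F (suc W) N≡ c< w< N<B
        (subst (λ d → NoneBelow (lookup ρ W) d c) (≡-sym N≡) none) ,
      d , d<B , unreach-complete (d ∷ c ∷ ρ) (2 ↑ʳ N) 0F 1F (2 ↑ʳ W) N≡ c< w< d<B un , ending rest)
      where
      d<B : d < B
      d<B = <-trans d< n<B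
      ending : Walk d c (lookup ρ V) ⊎ Walk (suc d) c (lookup ρ W) × Race (lookup ρ V) (lookup ρ W) d c → _
      ending (inj₁ wv) = inj₁ (reach-complete (d ∷ c ∷ ρ) (2 ↑ʳ N) 0F 1F (2 ↑ʳ V) N≡ c< d<B wv)
      ending (inj₂ (ww , rc)) = inj₂
        ((suc d , ≤-<-trans d< n<B , ≐1+-complete (suc d ∷ d ∷ c ∷ ρ) 0F 1F refl ,
          reach-complete (suc d ∷ d ∷ c ∷ ρ) (3 ↑ʳ N) 0F 2F (3 ↑ʳ W) N≡ c< (≤-<-trans d< n<B) ww) ,
         race-complete (d ∷ c ∷ ρ) (2 ↑ʳ N) (2 ↑ʳ V) (2 ↑ʳ W) 0F 1F N≡ c< w< d<B rc)

-- Parsing the input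

-- Horner's rule, with the most significant digit first as in `binary`.
bitStep : ∀ {k} → Form (4 + k)
bitStep = (at 1F is𝟎 ∧′ sum 0F 2F 2F false) ∨′ (at 1F is𝟏 ∧′ sum 0F 2F 2F true)

-- v is the number written in binary at the positions first < i ≤ last.
number : ∀ {k} → (first last v : Fin k) → Form k
number first last v = ex (isZero 0F ∧′ for (suc first) (suc last) 0F (suc v) bitStep)

-- The bound variables are, from the outside: n, n², n² + n + 1, the position
-- of the first #, the end of v, v, the position of the second #, the end of
-- w, w, and the position of ⊣.
query : Form 0
query = ex (allBelow 0F (at 1F is𝟎) ∧′ ex (0F ≐1+ 1F ∧′ at 0F is𝟏) ∧′
  ex (ex (ex (product 2F 3F 3F ∧′ sum 1F 2F 3F true ∧′ 0F ≐1+ 1F ∧′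
    ex (ex (ex (number 3F 2F 1F ∧′ 0F ≐1+ 2F ∧′ at 0F is# ∧′
      ex (ex (ex (number 3F 2F 1F ∧′ 0F ≐1+ 2F ∧′ at 0F is⊣ ∧′ precedes 9F 4F 1F))))))))))

value : ℕ → List Bool → ℕ
value m []       = m
value m (b ∷ bs) = value (m + m + digit b) bs

value-≥ : ∀ m bs → m ≤ value m bs
value-≥ m []       = ≤-refl
value-≥ m (b ∷ bs) = ≤-trans (≤-trans (m≤m+n m m) (m≤m+n _ (digit b))) (value-≥ _ bs)

Reads : List Symbol → ℕ → List Bool → Set
Reads x i []       = ⊤
Reads x i (b ∷ bs) = readInput x (suc i) ≡ sym (bit b) × Reads x (suc i) bs

Stops : (InputSymbol Symbol → Bool) → Set
Stops f = ∀ b → f (sym (bit b)) ≡ false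

-- The encoding enters only through what is read at each position; `EncodedQuery` establishes these
-- facts.
module Parsing (x : List Symbol) (B n : ℕ) (e : ℕ → ℕ → Bool) (vs ws : List Bool)
  (zeros  : ∀ {t} → t < n → readInput x (suc t) ≡ sym 𝟎)
  (one    : readInput x (suc n) ≡ sym 𝟏)
  (matrix : ∀ {a b} → a < n → b < n → readInput x (a * n + b + 1 + n + 1) ≡ sym (bit (e a b)))
  (v-bits : Reads x (suc (n * n + n + 1)) vs)
  (hash   : readInput x (suc (suc (n * n + n + 1) + length vs)) ≡ sym #)
  (w-bits : Reads x (suc (suc (n * n + n + 1) + length vs)) ws)
  (end    : readInput x (suc (suc (suc (n * n + n + 1) + length vs) + length ws)) ≡ ⊣)
  (inside : suc (suc (suc (n * n + n + 1) + length vs) + length ws) < B)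
  (v<n    : value 0 vs < n)
  (w<n    : value 0 ws < n) where

  #₁ #₂ : ℕ
  #₁ = suc (n * n + n + 1)
  #₂ = suc (#₁ + length vs)

  last₁<B : #₁ + length vs < B
  last₁<B = <-trans (n<1+n _) (≤-<-trans (m≤m+n #₂ (length ws)) (<-trans (n<1+n _) inside))

  #₁<B : #₁ < B
  #₁<B = ≤-<-trans (m≤m+n #₁ (length vs)) last₁<B

  open ComparisonFormulas x B n e matrix (<⇒≤ (≤-<-trans (≤-reflexive (+-suc (n * n + n) 1)) #₁<B))
  open Comparison n e using (Precedes)

  private variable
    k : ℕ

  symbol-clash : ∀ (f : InputSymbol Symbol → Bool) {τ σ} → τ ≡ σ → f σ ≡ false → f τ ≡ true → ⊥
  symbol-clash f refl f≡false f≡true with () ← trans (≡-sym f≡false) f≡true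

  digit-read : ∀ (ρ : Vec ℕ k) {i m m₁} b → readInput x (suc i) ≡ sym (bit b) →
               ⟦ bitStep ⟧ (m₁ ∷ suc i ∷ m ∷ i ∷ ρ) → m₁ ≡ m + m + digit b
  digit-read ρ false now (inj₁ (_ , eq))  = eq
  digit-read ρ false now (inj₂ (is1 , _)) = ⊥-elim (symbol-clash is𝟏 now refl is1)
  digit-read ρ true  now (inj₁ (is0 , _)) = ⊥-elim (symbol-clash is𝟎 now refl is0)
  digit-read ρ true  now (inj₂ (_ , eq))  = eq

  -- The guessed end of a number is forced: an early end contradicts the separator test `f`, which
  -- rejects digits, and a late one contradicts `bitStep`, which accepts nothing else.
  number-chain : ∀ {f} → Stops f → ∀ (ρ : Vec ℕ k) bs {i m l v σ} →
    Chain (Body bitStep ρ) i m l v → f (readInput x (suc l)) ≡ true →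
    Reads x i bs → readInput x (suc (i + length bs)) ≡ σ → is𝟎 σ ≡ false → is𝟏 σ ≡ false →
    l ≡ i + length bs × v ≡ value m bs
  number-chain stops ρ [] [] fin reads σ≡ ¬𝟎 ¬𝟏 = ≡-sym (+-identityʳ _) , refl
  number-chain {f = f} stops ρ (b ∷ bs) {i} [] fin (now , _) σ≡ ¬𝟎 ¬𝟏 = ⊥-elim (symbol-clash f now (stops b) fin)
  number-chain stops ρ [] {i} ((_ , inj₁ (is0 , _)) ∷ ch) fin reads σ≡ ¬𝟎 ¬𝟏 =
    ⊥-elim (symbol-clash is𝟎 (trans (cong (λ j → readInput x (suc j)) (≡-sym (+-identityʳ i))) σ≡) ¬𝟎 is0)
  number-chain stops ρ [] {i} ((_ , inj₂ (is1 , _)) ∷ ch) fin reads σ≡ ¬𝟎 ¬𝟏 =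
    ⊥-elim (symbol-clash is𝟏 (trans (cong (λ j → readInput x (suc j)) (≡-sym (+-identityʳ i))) σ≡) ¬𝟏 is1)
  number-chain {f = f} stops ρ (b ∷ bs) {i} {m} {l} {v} {σ} (_∷_ {m₁ = m₁} (_ , tr) ch) fin (now , reads) σ≡ ¬𝟎 ¬𝟏
    with refl ← digit-read ρ {i} {m} b now tr
    with l≡ , v≡ ← number-chain {f = f} stops ρ bs ch fin reads (trans (cong (λ j → readInput x (suc j)) (≡-sym (+-suc i _))) σ≡) ¬𝟎 ¬𝟏 =
    trans l≡ (≡-sym (+-suc i _)) , v≡

  number-run : ∀ (ρ : Vec ℕ k) bs i m → Reads x i bs → value m bs < B →
               Chain (Body bitStep ρ) i m (i + length bs) (value m bs)
  number-run ρ [] i m reads v< = subst (λ l → Chain (Body bitStep ρ) i m l m) (≡-sym (+-identityʳ i)) []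
  number-run ρ (b ∷ bs) i m (now , reads) v< =
    (≤-<-trans (value-≥ _ bs) v< , digit-step b now) ∷
    subst (λ l → Chain (Body bitStep ρ) (suc i) (m + m + digit b) l (value m (b ∷ bs))) (≡-sym (+-suc i _)) (number-run ρ bs (suc i) _ reads v<)
    where
    digit-step : ∀ b → readInput x (suc i) ≡ sym (bit b) → ⟦ bitStep ⟧ (m + m + digit b ∷ suc i ∷ m ∷ i ∷ ρ)
    digit-step false now = inj₁ (cong is𝟎 now , refl)
    digit-step true  now = inj₂ (cong is𝟏 now , refl)

  number-sound : ∀ {f} → Stops f → ∀ (ρ : Vec ℕ k) F L V bs {σ} → ⟦ number F L V ⟧ ρ → f (readInput x (suc (lookup ρ L))) ≡ true →
    Reads x (lookup ρ F) bs → readInput x (suc (lookup ρ F + length bs)) ≡ σ → is𝟎 σ ≡ false → is𝟏 σ ≡ false →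
    lookup ρ L ≡ lookup ρ F + length bs × lookup ρ V ≡ value 0 bs
  number-sound {f = f} stops ρ F L V bs (z , _ , z≡0 , loop) fin with refl ← self-sum z z≡0 =
    number-chain {f = f} stops (0 ∷ ρ) bs (for-sound (0 ∷ ρ) (suc F) (suc L) 0F (suc V) bitStep loop) fin

  number-complete : ∀ (ρ : Vec ℕ k) F L V bs → Reads x (lookup ρ F) bs → lookup ρ L ≡ lookup ρ F + length bs →
    lookup ρ L < B → lookup ρ V ≡ value 0 bs → value 0 bs < B → ⟦ number F L V ⟧ ρ
  number-complete ρ F L V bs reads l≡ l<B v≡ v<B = 0 , 0<B , refl ,
    for-complete (0 ∷ ρ) (suc F) (suc L) 0F (suc V) bitStep 0<B l<B
      (subst₂ (Chain (Body bitStep (0 ∷ ρ)) (lookup ρ F) 0) (≡-sym l≡) (≡-sym v≡) (number-run (0 ∷ ρ) bs (lookup ρ F) 0 reads v<B))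

  size-unique : ∀ N → (∀ t → t < N → is𝟎 (readInput x (suc t)) ≡ true) → is𝟏 (readInput x (suc N)) ≡ true → N ≡ n
  size-unique N zeros′ one′ with <-cmp N n
  ... | tri< N<n _ _ = ⊥-elim (symbol-clash is𝟏 (zeros N<n) refl one′)
  ... | tri≈ _ eq _  = eq
  ... | tri> _ _ n<N = ⊥-elim (symbol-clash is𝟎 one refl (zeros′ n n<N))

  #-stops : Stops is#
  #-stops false = refl
  #-stops true  = refl

  ⊣-stops : Stops is⊣
  ⊣-stops false = refl
  ⊣-stops true  = refl

  -- Each guess turns out to be forced: the size by the unary prefix, the positions by arithmetic,
  -- the two numbers by the separators. Only `precedes` is left to interpret.
  query-sound : ⟦ query ⟧ [] → Precedes B (value 0 vs) (value 0 ws)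
  query-sound (N , _ , zs , (N₁ , _ , N₁≡ , at₁) , p , _ , q , _ , h₁ , _ , p≡ , q≡ , h₁≡ ,
      l₁ , _ , v , _ , h₂ , _ , num₁ , h₂≡ , at₂ , l₂ , _ , w , _ , h₃ , _ , num₂ , h₃≡ , at₃ , prec)
    with refl ← ≐1+-sound (N₁ ∷ N ∷ []) 0F 1F N₁≡
    with refl ← size-unique N (λ t t<N → proj₂ (proj₂ (allBelow-sound (N ∷ []) 0F (at 1F is𝟎) zs t t<N))) at₁
    with refl ← product-sound (h₁ ∷ q ∷ p ∷ N ∷ []) 2F 3F 3F p≡
    with refl ← q≡
    with refl ← ≐1+-sound (h₁ ∷ q ∷ p ∷ N ∷ []) 0F 1F h₁≡
    with refl ← ≐1+-sound (h₂ ∷ v ∷ l₁ ∷ h₁ ∷ q ∷ p ∷ N ∷ []) 0F 2F h₂≡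
    with refl , refl ← number-sound {f = is#} #-stops (h₂ ∷ v ∷ l₁ ∷ h₁ ∷ q ∷ p ∷ N ∷ []) 3F 2F 1F vs num₁ at₂ v-bits hash refl refl
    with refl ← ≐1+-sound (h₃ ∷ w ∷ l₂ ∷ h₂ ∷ v ∷ l₁ ∷ h₁ ∷ q ∷ p ∷ N ∷ []) 0F 2F h₃≡
    with refl , refl ← number-sound {f = is⊣} ⊣-stops (h₃ ∷ w ∷ l₂ ∷ h₂ ∷ v ∷ l₁ ∷ h₁ ∷ q ∷ p ∷ N ∷ []) 3F 2F 1F ws num₂ at₃ w-bits end refl refl =
    precedes-sound (h₃ ∷ w ∷ l₂ ∷ h₂ ∷ v ∷ l₁ ∷ h₁ ∷ q ∷ p ∷ N ∷ []) 9F 4F 1F refl w<n prec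

  query-complete : Precedes n (value 0 vs) (value 0 ws) → ⟦ query ⟧ []
  query-complete prec =
    n , n<B , allBelow-complete (n ∷ []) 0F (at 1F is𝟎) n<B (λ t t<n → cong is𝟎 (zeros t<n)) ,
    (suc n , n+1<B , ≐1+-complete (suc n ∷ n ∷ []) 0F 1F refl , cong is𝟏 one) ,
    n * n , n²<B , n * n + n + 1 , <-trans (n<1+n _) #₁<B , #₁ , #₁<B ,
    product-complete ρ₁ 2F 3F 3F n<B n²<B refl , refl , ≐1+-complete ρ₁ 0F 1F refl ,
    #₁ + length vs , last₁<B , value 0 vs , <-trans v<n n<B , #₂ , #₂<B ,
    number-complete ρ₂ 3F 2F 1F vs v-bits refl last₁<B refl (<-trans v<n n<B) , ≐1+-complete ρ₂ 0F 2F refl , cong is# hash ,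
    #₂ + length ws , <-trans (n<1+n _) inside , value 0 ws , <-trans w<n n<B , suc (#₂ + length ws) , inside ,
    number-complete ρ₃ 3F 2F 1F ws w-bits refl (<-trans (n<1+n _) inside) refl (<-trans w<n n<B) ,
    ≐1+-complete ρ₃ 0F 2F refl , cong is⊣ end , precedes-complete ρ₃ 9F 4F 1F refl w<n prec
    where
    ρ₁ : Vec ℕ 4
    ρ₁ = #₁ ∷ n * n + n + 1 ∷ n * n ∷ n ∷ []
    ρ₂ : Vec ℕ 7
    ρ₂ = #₂ ∷ value 0 vs ∷ #₁ + length vs ∷ ρ₁
    ρ₃ : Vec ℕ 10
    ρ₃ = suc (#₂ + length ws) ∷ value 0 ws ∷ #₂ + length ws ∷ ρ₂
    #₂<B : #₂ < B
    #₂<B = ≤-<-trans (m≤m+n #₂ (length ws)) (<-trans (n<1+n _) inside)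
    n²<B : n * n < B
    n²<B = ≤-<-trans (≤-trans (m≤m+n (n * n) n) (≤-trans (m≤m+n _ 1) (n≤1+n _))) #₁<B
    n+1<B : suc n < B
    n+1<B = ≤-<-trans (s≤s (≤-trans (m≤n+m n (n * n)) (m≤m+n _ 1))) #₁<B

-- Least paths

least-below : {P : ℕ → Set} → Decidable P → ∀ k → (∀ j → j < k → ¬ P j) ⊎ ∃[ j ] j < k × P j × (∀ i → i < j → ¬ P i)
least-below P? zero = inj₁ λ _ ()
least-below P? (suc k) with least-below P? k
... | inj₂ (j , j<k , rest) = inj₂ (j , m≤n⇒m≤1+n j<k , rest)
... | inj₁ none with P? k
...   | yes p = inj₂ (k , ≤-refl , p , none)
...   | no ¬p = inj₁ λ j j<1+k p → case-≤ j (m≤n⇒m<n∨m≡n (≤-pred j<1+k)) p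
  where
  case-≤ : ∀ j → j < k ⊎ j ≡ k → ¬ _
  case-≤ j (inj₁ j<k)  p = none j j<k p
  case-≤ j (inj₂ refl) p = ¬p p

least : {P : ℕ → Set} → Decidable P → ∀ {j} → P j → ∃[ i ] i ≤ j × P i × (∀ h → h < i → ¬ P h)
least P? {j} p with least-below P? (suc j)
... | inj₁ none                = ⊥-elim (none j ≤-refl p)
... | inj₂ (i , i<1+j , rest)  = i , ≤-pred i<1+j , rest

module Ranks (G : OrderedGraph) where
  open OrderedGraph G renaming (_<_ to _⊏_)
  open IsStrictTotalOrder isStrictTotalOrder public using (compare) renaming (trans to ⊏-trans; irrefl to ⊏-irrefl; asym to ⊏-asym)

  rank : Vertex → ℕ
  rank u = toℕ (index u)

  rank< : ∀ u → rank u < size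
  rank< u = toℕ<n (index u)

  rank-injective : ∀ {u v} → rank u ≡ rank v → u ≡ v
  rank-injective {u} {v} eq = trans (≡-sym (Inverse.strictlyInverseˡ enumeration u))
    (trans (cong vertexAt (toℕ-injective eq)) (Inverse.strictlyInverseˡ enumeration v))

  ranked : ∀ {i} → i < size → ∃[ u ] rank u ≡ i
  ranked i<n = vertexAt (fromℕ< i<n) , trans (cong toℕ (Inverse.strictlyInverseʳ enumeration _)) (toℕ-fromℕ< i<n)

  rank-reflects : ∀ {u v} → rank u < rank v → u ⊏ v
  rank-reflects {u} {v} lt = subst₂ _⊏_ (Inverse.strictlyInverseˡ enumeration u) (Inverse.strictlyInverseˡ enumeration v) (increasing lt)

  rank-mono : ∀ {u v} → u ⊏ v → rank u < rank v
  rank-mono {u} {v} u<v with <-cmp (rank u) (rank v)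
  ... | tri< lt _ _ = lt
  ... | tri≈ _ eq _ = ⊥-elim (⊏-irrefl (rank-injective eq) u<v)
  ... | tri> _ _ gt = ⊥-elim (⊏-asym u<v (rank-reflects gt))

  -- Formulas range over numbers, so adjacency is carried over along `rank` and made total by
  -- `false`.
  adjacent : ℕ → ℕ → Bool
  adjacent a b with a <? size | b <? size
  ... | yes a< | yes b< = does (vertexAt (fromℕ< a<) ~? vertexAt (fromℕ< b<))
  ... | _      | _      = false

  adjacent-entry : ∀ i j → adjacent (toℕ i) (toℕ j) ≡ does (vertexAt i ~? vertexAt j)
  adjacent-entry i j with toℕ i <? size | toℕ j <? size
  ... | yes i< | yes j< = cong₂ (λ i j → does (vertexAt i ~? vertexAt j)) (fromℕ<-toℕ i i<) (fromℕ<-toℕ j j<)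
  ... | yes _  | no j≮  = ⊥-elim (j≮ (toℕ<n j))
  ... | no i≮  | _      = ⊥-elim (i≮ (toℕ<n i))

  adjacent-rank : ∀ u v → adjacent (rank u) (rank v) ≡ does (u ~? v)
  adjacent-rank u v = trans (adjacent-entry (index u) (index v))
    (cong₂ (λ u v → does (u ~? v)) (Inverse.strictlyInverseˡ enumeration u) (Inverse.strictlyInverseˡ enumeration v))

  adjacent⇒~ : ∀ {u v} → adjacent (rank u) (rank v) ≡ true → u ~ v
  adjacent⇒~ {u} {v} eq with u ~? v | trans (≡-sym (adjacent-rank u v)) eq
  ... | yes u~v | _ = u~v

  ~⇒adjacent : ∀ {u v} → u ~ v → adjacent (rank u) (rank v) ≡ true
  ~⇒adjacent {u} {v} u~v = trans (adjacent-rank u v) (dec-true (u ~? v) u~v)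

  atRank? : {P : Vertex → Set} → (∀ u → Dec (P u)) → Decidable (λ i → ∃[ u ] rank u ≡ i × P u)
  atRank? {P} P? i with i <? size
  ... | no i≮ = no λ { (u , refl , _) → i≮ (rank< u) }
  ... | yes i< with u , refl ← ranked i< with P? u
  ...   | yes p = yes (u , refl , p)
  ...   | no ¬p = no λ (y , eq , p) → ¬p (subst P (rank-injective eq) p)

lookup-injective : {A : Set} {xs : List A} → Unique xs → ∀ {i j} → List.lookup xs i ≡ List.lookup xs j → i ≡ j
lookup-injective (_ ∷ _)    {Fin.zero}  {Fin.zero}  _  = refl
lookup-injective (x∉ ∷ _)   {Fin.zero}  {Fin.suc j} eq = ⊥-elim (All.lookup x∉ (∈-lookup j) eq)
lookup-injective (x∉ ∷ _)   {Fin.suc i} {Fin.zero}  eq = ⊥-elim (All.lookup x∉ (∈-lookup i) (≡-sym eq))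
lookup-injective (_ ∷ uniq) {Fin.suc i} {Fin.suc j} eq = cong Fin.suc (lookup-injective uniq eq)

-- Greedy paths and the breadth-first order

module LeastPaths (G : OrderedGraph) where
  open OrderedGraph G renaming (_<_ to _⊏_)
  open BreadthFirst G
  open Ranks G
  open Walks size adjacent
  open Comparison size adjacent

  W : ℕ → Vertex → Vertex → Set
  W d u v = Walk d (rank u) (rank v)

  W? : ∀ d u v → Dec (W d u v)
  W? d u v = walk? d (rank u) (rank v)

  W-near : ∀ {d u y v} → u ~ y → W d y v → W (suc d) u v
  W-near {y = y} u~y walk = rank y , rank< y , inj₂ (~⇒adjacent u~y) , walk

  W-suc : ∀ {d u v} → W d u v → W (suc d) u v
  W-suc {u = u} walk = rank u , rank< u , inj₁ refl , walk

  W-mono : ∀ {d d′ u v} → d ≤ d′ → W d u v → W d′ u v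
  W-mono {d} {d′} {u} {v} d≤d′ walk = subst (λ d → W d u v) (m∸n+n≡m d≤d′) (go (d′ ∸ d))
    where
    go : ∀ j → W (j + d) u v
    go zero    = walk
    go (suc j) = W-suc {j + d} {u} {v} (go j)

  W-uncons : ∀ {d u v} → W (suc d) u v → ∃[ y ] (u ≡ y ⊎ u ~ y) × W d y v
  W-uncons (c , c< , near , walk) with y , refl ← ranked c< = y , step near , walk
    where
    step : Near _ (rank y) → _ ≡ y ⊎ _ ~ y
    step (inj₁ eq)   = inj₁ (rank-injective eq)
    step (inj₂ edge) = inj₂ (adjacent⇒~ edge)

  W-trans : ∀ {d d′ u y v} → W d u y → W d′ y v → W (d + d′) u v
  W-trans {zero} {d′} {v = v} eq walk = subst (λ a → Walk d′ a (rank v)) (≡-sym eq) walk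
  W-trans {suc d} {d′} {u} {y} {v} walk walk′ with W-uncons {d} {u} {y} walk
  ... | z , inj₁ refl , rest = W-suc {d + d′} {u} {v} (W-trans {d} {d′} {u} {y} {v} rest walk′)
  ... | z , inj₂ u~z  , rest = W-near {d + d′} {u} {z} {v} u~z (W-trans {d} {d′} {z} {y} {v} rest walk′)

  W-sym : ∀ {d u v} → W d u v → W d v u
  W-sym {zero} eq = ≡-sym eq
  W-sym {suc d} {u} {v} walk with W-uncons {d} {u} {v} walk
  ... | z , inj₁ refl , rest = W-suc {d} {v} {u} (W-sym {d} {u} {v} rest)
  ... | z , inj₂ u~z  , rest = subst (λ j → W j v u) (+-comm d 1)
    (W-trans {d} {1} {v} {z} {u} (W-sym {d} {z} {v} rest) (W-near {0} {z} {u} {u} (~-sym u~z) refl))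

  -- Vertices may repeat. The least path is least even among these, so walks found in a race need
  -- not be made simple before they are compared with it.
  record IsWalk (u v : Vertex) (p : List Vertex) : Set where
    constructor isWalk
    field
      from   : head p ≡ just u
      to     : last p ≡ just v
      linked : Linked _~_ p

  path⇒walk : ∀ {u v p} → IsPath u v p → IsWalk u v p
  path⇒walk record { from = f ; to = t ; adjacent = a } = isWalk f t a

  walk-length : ∀ {u v} p → IsWalk u v (u ∷ p) → W (length p) u v
  walk-length []      (isWalk _ refl _) = refl
  walk-length {u} {v} (y ∷ p) (isWalk _ to (u~y ∷ linked)) = W-near {length p} {u} {y} {v} u~y (walk-length p (isWalk refl to linked))

  walk-view : ∀ {u v p} → IsWalk u v p → ∃[ p′ ] p ≡ u ∷ p′
  walk-view {p = _ ∷ p} (isWalk refl _ _) = p , refl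

  -- The greedily traced path; it replaces `IsLeastPath`, whose minimality quantifies over all
  -- paths. In `step`, ¬ W d c w makes d + 1 the exact distance.
  data Least (w : Vertex) : ℕ → Vertex → List Vertex → Set where
    stop : Least w 0 w (w ∷ [])
    step : ∀ {d c c′ p} → c ~ c′ → ¬ W d c w → (∀ u → u ⊏ c′ → c ~ u → ¬ W d u w) → Least w d c′ p →
           Least w (suc d) c (c ∷ p)

  Least-head : ∀ {w d c p} → Least w d c p → ∃[ p′ ] p ≡ c ∷ p′ × length p′ ≡ d
  Least-head stop = [] , refl , refl
  Least-head (step _ _ _ rest) with p′ , refl , len ← Least-head rest = _ , refl , cong suc len

  Least-length : ∀ {w d c p} → Least w d c p → length p ≡ suc d
  Least-length lp with _ , refl , len ← Least-head lp = cong suc len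

  Least-W : ∀ {w d c p} → Least w d c p → W d c w
  Least-W stop = refl
  Least-W {w} (step {d} {c} {c′} c~c′ _ _ rest) = W-near {d} {c} {c′} {w} c~c′ (Least-W rest)

  Least-walk : ∀ {w d c p} → Least w d c p → IsWalk c w p
  Least-walk stop = isWalk refl refl [-]
  Least-walk (step c~c′ _ _ rest) with p′ , refl , _ ← Least-head rest with isWalk _ to linked ← Least-walk rest =
    isWalk refl to (c~c′ ∷ linked)

  Least-all : ∀ {w d c p} → Least w d c p → All (λ y → W d y w) p
  Least-all stop = refl ∷ []
  Least-all {w} {suc d} {c} lp@(step _ _ _ rest) = Least-W lp ∷ All.map (λ {y} → W-suc {d} {y} {w}) (Least-all rest)

  -- The first vertex is farther than d from `w`, while the rest of the path stays within distance d
  -- by `Least-all`.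
  Least-unique : ∀ {w d c p} → Least w d c p → Unique p
  Least-unique stop = [] ∷ []
  Least-unique (step _ ¬W _ rest) = All.map (λ { walk refl → ¬W walk }) (Least-all rest) ∷ Least-unique rest

  Least-path : ∀ {w d c p} → Least w d c p → IsPath c w p
  Least-path lp with isWalk from to linked ← Least-walk lp =
    record { from = from ; to = to ; adjacent = linked ; distinct = Least-unique lp }

  <⋆-cons : ∀ {u p q} → p <⋆ q → (u ∷ p) <⋆ (u ∷ q)
  <⋆-cons (inj₁ lt)         = inj₁ (s≤s lt)
  <⋆-cons (inj₂ (eq , lex)) = inj₂ (cong suc eq , next refl lex)

  <⋆-trans : ∀ {p q r} → p <⋆ q → q <⋆ r → p <⋆ r
  <⋆-trans (inj₁ lt) (inj₁ lt′) = inj₁ (<-trans lt lt′)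
  <⋆-trans (inj₁ lt) (inj₂ (eq , _)) = inj₁ (subst (_ <_) eq lt)
  <⋆-trans {r = r} (inj₂ (eq , _)) (inj₁ lt) = inj₁ (subst (_< length r) (≡-sym eq) lt)
  <⋆-trans (inj₂ (eq , lex)) (inj₂ (eq′ , lex′)) = inj₂ (trans eq eq′ , lex-trans lex lex′)
    where
    open IsStrictTotalOrder isStrictTotalOrder using (isEquivalence; <-resp-≈)
    lex-trans : ∀ {p q r} → Lex-< _≡_ _⊏_ p q → Lex-< _≡_ _⊏_ q r → Lex-< _≡_ _⊏_ p r
    lex-trans = <-transitive isEquivalence <-resp-≈ ⊏-trans

  <⋆-irrefl : ∀ {p} → ¬ p <⋆ p
  <⋆-irrefl (inj₁ lt) = <-irrefl refl lt
  <⋆-irrefl (inj₂ (_ , lex)) = <-irreflexive ⊏-irrefl (Pointwise.refl refl) lex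

  -- Let y be the second vertex of q. If y < c′, then y is farther than d from `w`, so q is longer.
  -- If c′ < y, then q cannot be shorter because d + 1 is the distance, and at equal length c′
  -- decides. If y = c′, induction applies.
  Least-least : ∀ {w d c p} → Least w d c p → ∀ q → IsWalk c w q → p ≡ q ⊎ p <⋆ q
  Least-least stop (_ ∷ [])    (isWalk refl _ _) = inj₁ refl
  Least-least stop (_ ∷ _ ∷ q) (isWalk refl _ _) = inj₂ (inj₁ (s≤s (s≤s z≤n)))
  Least-least {w} (step {d} {c} _ ¬W _ _) (_ ∷ []) (isWalk refl refl _) = ⊥-elim (¬W (W-mono {0} {d} {c} {w} z≤n refl))
  Least-least {w} (step {d} {c} {c′} {p} c~c′ ¬W none rest) (_ ∷ y ∷ q) (isWalk refl to (c~y ∷ linked))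
    with p′ , refl , len ← Least-head rest with y-walk ← isWalk refl to linked with compare c′ y
  ... | tri≈ _ refl _ with Least-least rest (y ∷ q) y-walk
  ...   | inj₁ refl = inj₁ refl
  ...   | inj₂ lt   = inj₂ (<⋆-cons lt)
  Least-least {w} (step {d} {c} {c′} {p} c~c′ ¬W none rest) (_ ∷ y ∷ q) (isWalk refl to (c~y ∷ linked))
    | tri> _ _ y<c′ = inj₂ (inj₁ (s≤s (s≤s (subst (_< length q) (≡-sym len)
        (≰⇒> λ q≤d → none y y<c′ c~y (W-mono {length q} {d} {y} {w} q≤d (walk-length q y-walk)))))))
  Least-least {w} (step {d} {c} {c′} {p} c~c′ ¬W none rest) (_ ∷ y ∷ q) (isWalk refl to (c~y ∷ linked))
    | tri< c′<y _ _ with <-cmp (length q) d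
  ...   | tri< q<d _ _ = ⊥-elim (¬W (W-mono {suc (length q)} {d} {c} {w} q<d (W-near {length q} {c} {y} {w} c~y (walk-length q y-walk))))
  ...   | tri≈ _ q≡d _ = inj₂ (inj₂ (cong (2 +_) (trans len (≡-sym q≡d)) , next refl (this c′<y)))
  ...   | tri> _ _ d<q = inj₂ (inj₁ (s≤s (s≤s (subst (_< length q) (≡-sym len) d<q))))

  least-vertex : {P : Vertex → Set} → (∀ u → Dec (P u)) → ∀ {u} → P u → ∃[ y ] P y × (∀ z → z ⊏ y → ¬ P z)
  least-vertex {P} P? {u} p with i , _ , (y , refl , py) , below ← least (atRank? P?) {rank u} (u , refl , p) =
    y , py , λ z z<y pz → below (rank z) (rank-mono z<y) (z , refl , pz)

  least-exists : ∀ d {c w} → W d c w → (∀ d′ → d′ < d → ¬ W d′ c w) → ∃[ p ] Least w d c p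
  least-exists zero {c} {w} eq _ with refl ← rank-injective eq = _ , stop
  least-exists (suc d) {c} {w} walk min
    with W-uncons {d} {c} {w} walk
  -- A walk of minimal length does not pause.
  ... | _ , inj₁ refl , rest = ⊥-elim (min d ≤-refl rest)
  ... | _ , inj₂ c~y , rest
    with c′ , (c~c′ , walk′) , below ← least-vertex (λ y → (c ~? y) ×-dec W? d y w) (c~y , rest)
    with p , lp ← least-exists d {c′} {w} walk′ (λ d′ d′<d walk″ →
           min (suc d′) (s≤s d′<d) (W-near {d′} {c} {c′} {w} c~c′ walk″)) =
    c ∷ p , step c~c′ (min d ≤-refl) (λ u u<c′ c~u walk″ → below u u<c′ (c~u , walk″)) lp

  shortest : ∀ d {c w} → W d c w → ∃[ d′ ] ∃[ p ] d′ ≤ d × Least w d′ c p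
  shortest d {c} {w} walk with d′ , d′≤d , walk′ , min ← least (λ d → W? d c w) walk
    with p , lp ← least-exists d′ {c} {w} walk′ min = d′ , p , d′≤d , lp

  -- Pigeonhole principle. It makes size a sufficient distance for connectedness.
  path-length : ∀ {u v p} → IsPath u v p → length p ≤ size
  path-length {p = p} path = injective⇒≤ {f = λ i → index (List.lookup p i)} λ {i} {j} eq →
    lookup-injective (IsPath.distinct path) (rank-injective (cong toℕ eq))

  connected⇒W : ∀ {u v} → Connected u v → W size u v
  connected⇒W {u} {v} (p , path) with p′ , refl ← walk-view (path⇒walk path) =
    W-mono {length p′} {size} {u} {v} (≤-trans (n≤1+n _) (path-length path)) (walk-length p′ (path⇒walk path))

  W⇒connected : ∀ {d u v} → W d u v → Connected u v
  W⇒connected {d} {u} {v} walk with _ , p , _ , lp ← shortest d {u} {v} walk = p , Least-path lp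

  Least⇒leastPath : ∀ {w d c p} → Least w d c p → IsLeastPath c w p
  Least⇒leastPath lp = record { isPath = Least-path lp ; least = λ q path → Least-least lp q (path⇒walk path) }

  -- The greedy path exists and is least too; two least paths coincide because the order is
  -- irreflexive and transitive.
  leastPath⇒Least : ∀ {w c q} → IsLeastPath c w q → ∃[ d ] d ≤ size × Least w d c q
  leastPath⇒Least {w} {c} {q} lq
    with d , p , d≤n , lp ← shortest size {c} {w} (connected⇒W (q , IsLeastPath.isPath lq))
    with IsLeastPath.least lq p (Least-path lp) | Least-least lp q (path⇒walk (IsLeastPath.isPath lq))
  ... | inj₁ refl | _         = d , d≤n , lp
  ... | inj₂ _    | inj₁ refl = d , d≤n , lp
  ... | inj₂ q<p  | inj₂ p<q  = ⊥-elim (<⋆-irrefl (<⋆-trans q<p p<q))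

  not-below : ∀ {u v} → ¬ u ⊏ v → v ≡ u ⊎ v ⊏ u
  not-below {u} {v} u≮v with compare u v
  ... | tri< u<v _ _ = ⊥-elim (u≮v u<v)
  ... | tri≈ _ eq _  = inj₁ (≡-sym eq)
  ... | tri> _ _ v<u = inj₂ v<u

  race⇒walk : ∀ {v w d c p} → Race (rank v) (rank w) d (rank c) → Least w (suc d) c p → ∃[ q ] IsWalk c v q × q <⋆ p
  race⇒walk {v} {w} {d} {c} (overtake a a< edge av none ¬aw) (step {c′ = c′} c~c′ _ _ rest)
    with y , refl ← ranked a<
    with d′ , q , d′≤d , lq ← shortest d {y} {v} av
    with q′ , refl , len-q ← Least-head lq
    with p′ , refl , len-p ← Least-head rest
    with isWalk _ to linked ← Least-walk lq =
    _ , isWalk refl to (adjacent⇒~ edge ∷ linked) , smaller (m≤n⇒m<n∨m≡n d′≤d)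
    where
    -- A race does not mention c′. But c′ is a neighbour of `c` at distance at most d from `w`: so
    -- it is not below y, and it differs from y, which is farther.
    y<c′ : y ⊏ c′
    y<c′ with compare y c′
    ... | tri< lt _ _   = lt
    ... | tri≈ _ refl _ = ⊥-elim (¬aw (Least-W rest))
    ... | tri> _ _ gt   = ⊥-elim (none (rank c′) (rank-mono gt) (~⇒adjacent c~c′) (Least-W rest))
    smaller : d′ < d ⊎ d′ ≡ d → (c ∷ y ∷ q′) <⋆ (c ∷ c′ ∷ p′)
    smaller (inj₁ d′<d) = inj₁ (s≤s (s≤s (subst₂ _<_ (≡-sym len-q) (≡-sym len-p) d′<d)))
    smaller (inj₂ d′≡d) = inj₂ (cong (2 +_) (trans len-q (trans d′≡d (≡-sym len-p))) , next refl (this y<c′))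
  race⇒walk {v} {w} (follow {d} c₁ c₁< edge c₁w c₁v none rc) (step {c = c} {c′} c~c′ _ none′ rest)
    with y , refl ← ranked c₁< with compare y c′
  ... | tri< lt _ _ = ⊥-elim (none′ y lt (adjacent⇒~ edge) c₁w)
  ... | tri> _ _ gt = ⊥-elim (none (rank c′) (rank-mono gt) (~⇒adjacent c~c′) (Least-W rest))
  ... | tri≈ _ refl _ with q , wq@(isWalk _ to linked) , q<p ← race⇒walk {v} {w} rc rest
    with q′ , refl ← walk-view wq = _ , isWalk refl to (c~c′ ∷ linked) , <⋆-cons q<p

  -- The common vertices become `follow` and the first difference `overtake`. Shorter walks need no
  -- race: `Precedes` has an alternative for them.
  walk⇒race : ∀ {v w d c p} q → Least w (suc d) c p → IsWalk c v q → length q ≡ length p → Lex-< _≡_ _⊏_ q p →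
              Race (rank v) (rank w) d (rank c)
  walk⇒race (_ ∷ _) (step _ _ _ _) (isWalk refl _ _) _ (this c<c) = ⊥-elim (⊏-irrefl refl c<c)
  walk⇒race (_ ∷ []) (step _ _ _ rest) _ len (next _ _) with p′ , refl , _ ← Least-head rest with () ← len
  walk⇒race {v} {w} (c ∷ a ∷ q) (step {d} {c′ = c′} c~c′ ¬W none rest) (isWalk refl to (c~a ∷ linked)) len (next _ lex)
    with p′ , refl , len-p ← Least-head rest
    with walk ← isWalk refl to linked
    with av ← subst (λ d → W d a v) (trans (suc-injective (suc-injective len)) len-p) (walk-length q walk) | lex
  ... | this a<c′ = overtake (rank a) (rank< a) (~⇒adjacent c~a) av
          (λ u u<a edge uw → below u u<a edge uw) (none a a<c′ c~a)
    where
    below : NoNeighbourBelow (rank w) d (rank c) (rank a)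
    below u u<a edge uw with y , refl ← ranked (<-trans u<a (rank< a)) =
      none y (⊏-trans (rank-reflects u<a) a<c′) (adjacent⇒~ edge) uw
  -- The walks agree up to `w`, where the path ends; no list precedes its empty rest.
  walk⇒race {v} {w} (c ∷ a ∷ q) (step {zero} c~c′ ¬W none stop) (isWalk refl to (c~a ∷ linked)) len (next _ lex)
    | next refl lex′ with q | lex′
  ...   | [] | base ()
  walk⇒race {v} {w} (c ∷ a ∷ q) (step {suc d} c~c′ ¬W none rest) (isWalk refl to (c~a ∷ linked)) len (next _ lex)
    | next refl lex′ =
    follow (rank a) (rank< a) (~⇒adjacent c~a) (Least-W rest) av below
      (walk⇒race (a ∷ q) rest walk (suc-injective len) lex)
    where
    below : NoNeighbourBelow (rank w) (suc d) (rank c) (rank a)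
    below u u<a edge uw with y , refl ← ranked (<-trans u<a (rank< a)) =
      none y (rank-reflects u<a) (adjacent⇒~ edge) uw

  component : ∀ v → ∃[ v₀ ] W size v₀ v × (∀ u → u ⊏ v₀ → ¬ W size u v)
  component v = least-vertex (λ u → W? size u v) {v} (W-mono {0} {size} {v} {v} z≤n refl)

  leastInComponent : ∀ {v v₀} → W size v₀ v → (∀ u → u ⊏ v₀ → ¬ W size u v) → IsLeastInComponent v v₀
  leastInComponent {v} {v₀} walk below = record
    { connected = W⇒connected {size} (W-sym {size} {v₀} {v} walk)
    ; least     = λ u conn → not-below λ u<v₀ → below u u<v₀ (W-sym {size} {v} {u} (connected⇒W conn))
    }

  fromRanks : ∀ {P : ℕ → Set} {a} → (∀ i → i < rank a → ¬ P i) → ∀ u → u ⊏ a → ¬ P (rank u)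
  fromRanks below u u<a = below (rank u) (rank-mono u<a)

  toRanks : ∀ {P : ℕ → Set} {a} → (∀ u → u ⊏ a → ¬ P (rank u)) → ∀ i → i < rank a → ¬ P i
  toRanks {P} {a} below i i<a p with u , refl ← ranked (<-trans i<a (rank< a)) = below u (rank-reflects i<a) p

  precedes⇒≺B : ∀ {bound v w} → Precedes bound (rank v) (rank w) → v ≺B w
  precedes⇒≺B {v = v} {w} (inj₁ (i , i< , av , none , ¬aw))
    with a , refl ← ranked i<
    with v₀ , v₀v , v-below ← component v
    with w₀ , w₀w , w-below ← component w =
    v₀ , w₀ , leastInComponent {v} v₀v v-below , leastInComponent {w} w₀w w-below ,
    inj₁ ((λ { refl → ⊏-irrefl refl v₀<w₀ }) , v₀<w₀)
    where
    a<w₀ : a ⊏ w₀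
    a<w₀ with compare a w₀
    ... | tri< lt _ _   = lt
    ... | tri≈ _ refl _ = ⊥-elim (¬aw w₀w)
    ... | tri> _ _ gt   = ⊥-elim (none (rank w₀) (rank-mono gt) w₀w)
    v₀<w₀ : v₀ ⊏ w₀
    v₀<w₀ with not-below (λ a<v₀ → v-below a a<v₀ av)
    ... | inj₁ refl = a<w₀
    ... | inj₂ v₀<a = ⊏-trans v₀<a a<w₀
  precedes⇒≺B {v = v} {w} (inj₂ (i , i< , cv , cw , none , d , _ , ¬W , rest))
    with c , refl ← ranked i<
    with dw , p , _ , lp ← shortest size {c} {w} cw
    with dv , q , _ , lq ← shortest size {c} {v} cv =
    c , c , leastInComponent {v} cv v-below , leastInComponent {w} cw w-below ,
    inj₂ (refl , q , p , Least⇒leastPath lq , Least⇒leastPath lp , cases rest)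
    where
    w-below : ∀ u → u ⊏ c → ¬ W size u w
    w-below = fromRanks {λ i → Walk size i (rank w)} none
    v-below : ∀ u → u ⊏ c → ¬ W size u v
    -- The walk from u through `v` and c to `w` is only bounded by three times the size; passing to
    -- a simple path restores the bound.
    v-below u u<c uv = w-below u u<c (connected⇒W (W⇒connected {size + (size + size)} {u} {w}
      (W-trans {size} {size + size} {u} {v} {w} uv (W-trans {size} {size} {v} {c} {w} (W-sym {size} {c} {v} cv) cw))))
    minimal : ∀ {v d p j} → Least v d c p → W j c v → d ≤ j
    minimal {v} {zero} _ _ = z≤n
    minimal {v} {suc d} {j = j} (step _ ¬walk _ _) walk = ≰⇒> λ j≤d → ¬walk (W-mono {j} {d} {c} {v} j≤d walk)
    d<dw : d < dw
    d<dw = ≰⇒> λ dw≤d → ¬W (W-mono {dw} {d} {c} {w} dw≤d (Least-W lp))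
    cases : W d c v ⊎ W (suc d) c w × Race (rank v) (rank w) d (rank c) → q <⋆ p
    cases (inj₁ walk) = inj₁ (subst₂ _<_ (≡-sym (Least-length lq)) (≡-sym (Least-length lp))
      (s≤s (≤-trans (s≤s (minimal lq walk)) d<dw)))
    -- A walk of length d + 1 exists and d is below the distance, so the path to `w` has the length
    -- that the race presupposes.
    cases (inj₂ (walk , rc)) with refl ← ≤-antisym (minimal lp walk) d<dw
      with r , wr , r<p ← race⇒walk {v} {w} rc lp
      with Least-least lq r wr
    ... | inj₁ refl = r<p
    ... | inj₂ q<r  = <⋆-trans q<r r<p

  ≺B⇒precedes : ∀ {v w} → v ≺B w → Precedes size (rank v) (rank w)
  ≺B⇒precedes {v} {w} (v₀ , w₀ , lv , lw , inj₁ (_ , v₀<w₀)) =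
    inj₁ (rank v₀ , rank< v₀ , W-sym {size} {v} {v₀} (connected⇒W (IsLeastInComponent.connected lv)) ,
      toRanks {λ i → Walk size i (rank w)} (λ u u<v₀ → unreached u (⊏-trans u<v₀ v₀<w₀)) , unreached v₀ v₀<w₀)
    where
    unreached : ∀ u → u ⊏ w₀ → ¬ W size u w
    unreached u u<w₀ uw with IsLeastInComponent.least lw u (W⇒connected {size} {w} {u} (W-sym {size} {u} {w} uw))
    ... | inj₁ refl = ⊏-irrefl refl u<w₀
    ... | inj₂ w₀<u = ⊏-asym u<w₀ w₀<u
  ≺B⇒precedes {v} {w} (c , _ , lv , lw , inj₂ (refl , p , q , lp , lq , p<q)) with leastPath⇒Least lq
  -- Here `w` is the least vertex of its component and its path is a single vertex.
  ... | zero , _ , stop = ⊥-elim (nothing-precedes p<q)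
    where
    nothing-precedes : ¬ p <⋆ (w ∷ [])
    nothing-precedes lt with p′ , refl ← walk-view (path⇒walk (IsLeastPath.isPath lp)) with lt
    ... | inj₁ (s≤s ())
    ... | inj₂ (_ , this c<c) = ⊏-irrefl refl c<c
    ... | inj₂ (_ , next _ (base ()))
  ... | suc d , d<n , least-q@(step _ ¬W _ _) =
    inj₂ (rank c , rank< c , W-sym {size} {v} {c} (connected⇒W (IsLeastInComponent.connected lv)) ,
      W-sym {size} {w} {c} (connected⇒W (IsLeastInComponent.connected lw)) ,
      toRanks {λ i → Walk size i (rank w)} unreached , d , d<n , ¬W , cases p<q)
    where
    unreached : ∀ u → u ⊏ c → ¬ W size u w
    unreached u u<c uw with IsLeastInComponent.least lw u (W⇒connected {size} {w} {u} (W-sym {size} {u} {w} uw))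
    ... | inj₁ refl = ⊏-irrefl refl u<c
    ... | inj₂ c<u  = ⊏-asym u<c c<u
    p-walk : IsWalk c v p
    p-walk = path⇒walk (IsLeastPath.isPath lp)
    cases : p <⋆ q → W d c v ⊎ W (suc d) c w × Race (rank v) (rank w) d (rank c)
    cases (inj₂ (len , lex)) = inj₂ (Least-W least-q , walk⇒race p least-q p-walk len lex)
    cases (inj₁ lt) with p′ , refl ← walk-view p-walk = inj₁ (W-mono {length p′} {d} {c} {v}
      (≤-pred (≤-pred (subst (suc (length p′) <_) (Least-length least-q) lt))) (walk-length p′ p-walk))

-- The encoding

-- By halving: n ≤ 2⌈n/2⌉, and the logarithm of ⌈n/2⌉ is smaller by one. So the digits provided by
-- the encoding suffice for every vertex.
n≤2^⌈log₂n⌉ : ∀ n → n ≤ 2 ^ ⌈log₂ n ⌉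
n≤2^⌈log₂n⌉ = <-rec _ bound
  where
  bound : ∀ n → (∀ {m} → m < n → m ≤ 2 ^ ⌈log₂ m ⌉) → n ≤ 2 ^ ⌈log₂ n ⌉
  bound zero          _   = z≤n
  bound (suc zero)    _   = s≤s z≤n
  bound n@(suc (suc m)) rec = begin
    n                       ≡⟨ ≡-sym (⌊n/2⌋+⌈n/2⌉≡n n) ⟩
    ⌊ n /2⌋ + ⌈ n /2⌉       ≤⟨ +-monoˡ-≤ ⌈ n /2⌉ (⌊n/2⌋≤⌈n/2⌉ n) ⟩
    ⌈ n /2⌉ + ⌈ n /2⌉       ≡⟨ cong (⌈ n /2⌉ +_) (≡-sym (+-identityʳ _)) ⟩
    2 * ⌈ n /2⌉             ≤⟨ *-monoʳ-≤ 2 (subst (λ l → ⌈ n /2⌉ ≤ 2 ^ l) (⌈log₂⌈n/2⌉⌉≡⌈log₂n⌉∸1 n) (rec (⌈n/2⌉<n m))) ⟩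
    2 ^ ⌈log₂ n ⌉           ∎
    where open ≤-Reasoning

digits : ℕ → ℕ → List Bool
digits zero    m = []
digits (suc k) m = digits k (m / 2) ∷ʳ (m % 2 ≡ᵇ 1)

binary-digits : ∀ k m → binary k m ≡ map bit (digits k m)
binary-digits zero    m = refl
binary-digits (suc k) m = trans (cong (_∷ʳ _) (binary-digits k (m / 2))) (≡-sym (map-++ bit (digits k (m / 2)) _))

value-∷ʳ : ∀ m bs b → value m (bs ∷ʳ b) ≡ value m bs + value m bs + digit b
value-∷ʳ m []       b = refl
value-∷ʳ m (c ∷ bs) b = value-∷ʳ _ bs b

value-digits : ∀ k m → m < 2 ^ k → value 0 (digits k m) ≡ m
value-digits zero    zero    _ = refl
value-digits zero    (suc m) (s≤s ())
value-digits (suc k) m m< = begin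
  value 0 (digits (suc k) m)                                     ≡⟨ value-∷ʳ 0 (digits k (m / 2)) _ ⟩
  value 0 (digits k (m / 2)) + value 0 (digits k (m / 2)) + b    ≡⟨ cong (λ v → v + v + b) (value-digits k (m / 2) m/2<) ⟩
  m / 2 + m / 2 + b                                              ≡⟨ cong (m / 2 + m / 2 +_) (last-digit (m % 2) (m%n<n m 2)) ⟩
  m / 2 + m / 2 + m % 2                                          ≡⟨ solve 2 (λ q r → q :+ q :+ r := r :+ q :* con 2) refl (m / 2) (m % 2) ⟩
  m % 2 + (m / 2) * 2                                            ≡⟨ ≡-sym (m≡m%n+[m/n]*n m 2) ⟩
  m                                                              ∎
  where
  open ≡-Reasoning
  b : ℕ
  b = digit (m % 2 ≡ᵇ 1)
  m/2< : m / 2 < 2 ^ k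
  m/2< = m<n*o⇒m/o<n (subst (m <_) (*-comm 2 (2 ^ k)) m<)
  last-digit : ∀ r → r < 2 → digit (r ≡ᵇ 1) ≡ r
  last-digit zero          _ = refl
  last-digit (suc zero)    _ = refl
  last-digit (suc (suc r)) (s≤s (s≤s ()))

readInput-++ : ∀ {A : Set} (as y : List A) j → readInput (as ++ y) (suc (length as + j)) ≡ readInput y (suc j)
readInput-++ []       y j = refl
readInput-++ (a ∷ as) y j = readInput-++ as y j

readInput-replicate : ∀ {A : Set} n (a : A) y {j} → j < n → readInput (replicate n a ++ y) (suc j) ≡ sym a
readInput-replicate (suc n) a y {zero}  _         = refl
readInput-replicate (suc n) a y {suc j} (s≤s j<n) = readInput-replicate n a y j<n

readInput-map-tabulate : ∀ {A B : Set} {n} (g : A → B) (h : Fin n → A) y j →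
                         readInput (map g (tabulate h) ++ y) (suc (toℕ j)) ≡ sym (g (h j))
readInput-map-tabulate g h y Fin.zero    = refl
readInput-map-tabulate g h y (Fin.suc j) = readInput-map-tabulate g (h ∘ Fin.suc) y j

module _ {A B : Set} (f : A → List B) (k : ℕ) (len : ∀ a → length (f a) ≡ k) where

  -- z is whatever follows row i; it may remain unknown because only positions inside the row are
  -- read afterwards.
  readInput-concatMap : ∀ {m} (h : Fin m → A) y i j →
    ∃[ z ] readInput (concatMap f (tabulate h) ++ y) (suc (toℕ i * k + j)) ≡ readInput (f (h i) ++ z) (suc j)
  readInput-concatMap h y Fin.zero j =
    concatMap f (tabulate (h ∘ Fin.suc)) ++ y , cong (λ x → readInput x (suc j)) (++-assoc (f (h Fin.zero)) _ y)
  readInput-concatMap h y (Fin.suc i) j with z , eq ← readInput-concatMap (h ∘ Fin.suc) y i j = z , (begin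
    readInput ((f (h Fin.zero) ++ rest) ++ y) (suc (k + toℕ i * k + j))
      ≡⟨ cong₂ readInput (++-assoc (f (h Fin.zero)) rest y) (cong suc (trans (+-assoc k _ j) (cong (_+ (toℕ i * k + j)) (≡-sym (len _))))) ⟩
    readInput (f (h Fin.zero) ++ (rest ++ y)) (suc (length (f (h Fin.zero)) + (toℕ i * k + j)))
      ≡⟨ readInput-++ (f (h Fin.zero)) (rest ++ y) _ ⟩
    readInput (rest ++ y) (suc (toℕ i * k + j))
      ≡⟨ eq ⟩
    readInput (f (h (Fin.suc i)) ++ z) (suc j) ∎)
    where
    open ≡-Reasoning
    rest : List B
    rest = concatMap f (tabulate (h ∘ Fin.suc))

  length-concatMap : ∀ {m} (h : Fin m → A) → length (concatMap f (tabulate h)) ≡ m * k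
  length-concatMap {zero}  h = refl
  length-concatMap {suc m} h = trans (length-++ (f (h Fin.zero))) (cong₂ _+_ (len _) (length-concatMap (h ∘ Fin.suc)))

reads-++ : ∀ as y i bs → Reads y i bs → Reads (as ++ y) (length as + i) bs
reads-++ as y i []       _              = tt
reads-++ as y i (b ∷ bs) (now , reads) =
  trans (readInput-++ as y i) now , subst (λ j → Reads (as ++ y) j bs) (+-suc (length as) i) (reads-++ as y (suc i) bs reads)

reads-bits : ∀ bs y → Reads (map bit bs ++ y) 0 bs
reads-bits []       y = tt
reads-bits (b ∷ bs) y = refl , reads-++ (bit b ∷ []) (map bit bs ++ y) 0 bs (reads-bits bs y)

module EncodedQuery (G : OrderedGraph) (v w : OrderedGraph.Vertex G) where
  open OrderedGraph G renaming (_<_ to _⊏_)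
  open Encoding G
  open Ranks G
  open LeastPaths G using (precedes⇒≺B; ≺B⇒precedes)
  open BreadthFirst G

  n : ℕ
  n = size

  row : Fin n → List Symbol
  row i = map (λ j → bit (does (vertexAt i ~? vertexAt j))) (allFin n)

  entries : List Symbol
  entries = concatMap row (allFin n)

  vs ws : List Bool
  vs = digits ⌈log₂ n ⌉ (rank v)
  ws = digits ⌈log₂ n ⌉ (rank w)

  length-row : ∀ i → length (row i) ≡ n
  length-row i = trans (length-map _ (allFin n)) (length-tabulate id)

  -- The empty tail allows both numbers to be read by `reads-bits`, which expects a continuation.
  tail₂ tail₁ : List Symbol
  tail₂ = map bit ws ++ []
  tail₁ = map bit vs ++ # ∷ tail₂

  word : List Symbol
  word = encodeGraph ++ # ∷ tail₁

  encode≡word : encode v w ≡ word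
  encode≡word = cong₂ (λ a b → encodeGraph ++ # ∷ a ++ # ∷ b) (binary-digits ⌈log₂ n ⌉ (rank v))
    (trans (binary-digits ⌈log₂ n ⌉ (rank w)) (≡-sym (++-identityʳ _)))

  value-rank : ∀ u → value 0 (digits ⌈log₂ n ⌉ (rank u)) ≡ rank u
  value-rank u = value-digits ⌈log₂ n ⌉ (rank u) (<-≤-trans (rank< u) (n≤2^⌈log₂n⌉ n))

  length-encodeGraph : length encodeGraph ≡ n * n + n + 1
  length-encodeGraph = trans (length-++ (replicate n 𝟎)) (trans
    (cong₂ (λ a b → a + suc b) (length-replicate n) (length-concatMap row n length-row id))
    (solve 2 (λ n m → n :+ (con 1 :+ m) := m :+ n :+ con 1) refl n (n * n)))

  word≡ : word ≡ replicate n 𝟎 ++ 𝟏 ∷ (entries ++ # ∷ tail₁)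
  word≡ = ++-assoc (replicate n 𝟎) (𝟏 ∷ entries) (# ∷ tail₁)

  zeros : ∀ {t} → t < n → readInput word (suc t) ≡ sym 𝟎
  zeros {t} t<n = trans (cong (λ x → readInput x (suc t)) word≡) (readInput-replicate n 𝟎 _ t<n)

  after-zeros : ∀ j → readInput word (suc (n + j)) ≡ readInput (𝟏 ∷ (entries ++ # ∷ tail₁)) (suc j)
  after-zeros j = trans (cong₂ (λ x m → readInput x (suc (m + j))) word≡ (≡-sym (length-replicate n)))
    (readInput-++ (replicate n 𝟎) _ j)

  one : readInput word (suc n) ≡ sym 𝟏
  one = trans (cong (λ m → readInput word (suc m)) (≡-sym (+-identityʳ n))) (after-zeros 0)

  entry-at : ∀ i j → readInput word (toℕ i * n + toℕ j + 1 + n + 1) ≡ sym (bit (adjacent (toℕ i) (toℕ j)))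
  entry-at i j with z , eq ← readInput-concatMap row n length-row id (# ∷ tail₁) i (toℕ j) = begin
    readInput word (toℕ i * n + toℕ j + 1 + n + 1)
      ≡⟨ cong (readInput word) (solve 2 (λ m n → m :+ con 1 :+ n :+ con 1 := con 1 :+ (n :+ (con 1 :+ m))) refl (toℕ i * n + toℕ j) n) ⟩
    readInput word (suc (n + suc (toℕ i * n + toℕ j)))
      ≡⟨ after-zeros _ ⟩
    readInput (entries ++ # ∷ tail₁) (suc (toℕ i * n + toℕ j))
      ≡⟨ eq ⟩
    readInput (row i ++ z) (suc (toℕ j))
      ≡⟨ readInput-map-tabulate _ id z j ⟩
    sym (bit (does (vertexAt i ~? vertexAt j)))
      ≡⟨ cong (λ b → sym (bit b)) (≡-sym (adjacent-entry i j)) ⟩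
    sym (bit (adjacent (toℕ i) (toℕ j))) ∎
    where open ≡-Reasoning

  matrix : ∀ {a b} → a < n → b < n → readInput word (a * n + b + 1 + n + 1) ≡ sym (bit (adjacent a b))
  matrix a< b< = subst₂ (λ a b → readInput word (a * n + b + 1 + n + 1) ≡ sym (bit (adjacent a b)))
    (toℕ-fromℕ< a<) (toℕ-fromℕ< b<) (entry-at (fromℕ< a<) (fromℕ< b<))

  #₁ #₂ : ℕ
  #₁ = suc (n * n + n + 1)
  #₂ = suc (#₁ + length vs)

  after-#₁ : ∀ {bs} i → Reads tail₁ i bs → Reads word (#₁ + i) bs
  after-#₁ {bs} i reads = subst (λ p → Reads word p bs)
    (trans (+-suc (length encodeGraph) i) (cong (λ l → suc (l + i)) length-encodeGraph))
    (reads-++ encodeGraph (# ∷ tail₁) (suc i) bs (reads-++ (# ∷ []) tail₁ i bs reads))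

  v-bits : Reads word #₁ vs
  v-bits = subst (λ p → Reads word p vs) (+-identityʳ #₁) (after-#₁ 0 (reads-bits vs (# ∷ tail₂)))

  w-bits : Reads word #₂ ws
  w-bits = subst (λ p → Reads word p ws)
    (trans (cong (#₁ +_) (trans (cong (_+ 1) (length-map bit vs)) (+-comm _ 1))) (+-suc #₁ (length vs)))
    (after-#₁ (length (map bit vs) + 1)
      (reads-++ (map bit vs) (# ∷ tail₂) 1 ws (reads-++ (# ∷ []) tail₂ 0 ws (reads-bits ws []))))

  hash : readInput word #₂ ≡ sym #
  hash = begin
    readInput word (suc (#₁ + length vs))
      ≡⟨ cong (λ l → readInput word (suc l)) (trans (≡-sym (+-suc (n * n + n + 1) (length vs))) (cong (_+ suc (length vs)) (≡-sym length-encodeGraph))) ⟩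
    readInput word (suc (length encodeGraph + suc (length vs)))
      ≡⟨ readInput-++ encodeGraph (# ∷ tail₁) (suc (length vs)) ⟩
    readInput tail₁ (suc (length vs))
      ≡⟨ cong (λ l → readInput tail₁ (suc l)) (trans (≡-sym (length-map bit vs)) (≡-sym (+-identityʳ _))) ⟩
    readInput tail₁ (suc (length (map bit vs) + 0))
      ≡⟨ readInput-++ (map bit vs) (# ∷ tail₂) 0 ⟩
    sym # ∎
    where open ≡-Reasoning

  length-word : length word ≡ #₂ + length ws
  length-word = begin
    length word
      ≡⟨ length-++ encodeGraph ⟩
    length encodeGraph + suc (length tail₁)
      ≡⟨ cong₂ (λ a b → a + suc b) length-encodeGraph (length-++ (map bit vs)) ⟩
    n * n + n + 1 + suc (length (map bit vs) + suc (length tail₂))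
      ≡⟨ cong₂ (λ a b → n * n + n + 1 + suc (a + suc b)) (length-map bit vs) (trans (length-++ (map bit ws)) (trans (+-identityʳ _) (length-map bit ws))) ⟩
    n * n + n + 1 + suc (length vs + suc (length ws))
      ≡⟨ solve 3 (λ m a b → m :+ (con 1 :+ (a :+ (con 1 :+ b))) := con 2 :+ (m :+ a :+ b)) refl (n * n + n + 1) (length vs) (length ws) ⟩
    #₂ + length ws ∎
    where open ≡-Reasoning

  end : readInput word (suc (#₂ + length ws)) ≡ ⊣
  end = readInput-outside word _ (≤-reflexive length-word)

  module _ (B : ℕ) (large : suc (length word) < B) where

    open Parsing word B n adjacent vs ws zeros one matrix v-bits hash w-bits end
      (subst (λ l → suc l < B) length-word large)
      (subst (_< n) (≡-sym (value-rank v)) (rank< v)) (subst (_< n) (≡-sym (value-rank w)) (rank< w))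
      using (query-sound; query-complete)

    query⇒≺B : Truth.⟦_⟧ word B query [] → v ≺B w
    query⇒≺B t = precedes⇒≺B {B} {v} {w} (subst₂ (Comparison.Precedes n adjacent B) (value-rank v) (value-rank w) (query-sound t))

    ≺B⇒query : v ≺B w → Truth.⟦_⟧ word B query []
    ≺B⇒query v≺w = query-complete (subst₂ (Comparison.Precedes n adjacent n) (≡-sym (value-rank v)) (≡-sym (value-rank w)) (≺B⇒precedes v≺w))

-- Acceptance gives truth for one large B and follows from truth for all of them. The two agree
-- since, by hypothesis, truth means the same for every large B.
decidedBy : (φ : Form 0) →
  (∀ G v w B → suc (length (Encoding.encode G v w)) < B →
    Truth.⟦_⟧ (Encoding.encode G v w) B φ [] ⇔ BreadthFirst._≺B_ G v w) →
  Σ[ M ∈ NTM Symbol ] LogSpace M × ((G : OrderedGraph) (v w : OrderedGraph.Vertex G) → Accepts M (Encoding.encode G v w) ⇔ BreadthFirst._≺B_ G v w)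
decidedBy φ spec = proj₁ (definable φ) , proj₁ (proj₂ (definable φ)) , λ G v w →
  let sound , complete = proj₂ (proj₂ (definable φ)) (Encoding.encode G v w) in
  mk⇔ (λ acc → let B , large , t = sound acc in Equivalence.to (spec G v w B large) t)
      (λ v≺w → complete λ B large → Equivalence.from (spec G v w B large) v≺w)

query-decides : ∀ G v w B → suc (length (Encoding.encode G v w)) < B →
  Truth.⟦_⟧ (Encoding.encode G v w) B query [] ⇔ BreadthFirst._≺B_ G v w
query-decides G v w B = subst (λ x → suc (length x) < B → Truth.⟦_⟧ x B query [] ⇔ _≺B_ v w)
  (≡-sym encode≡word) λ large → mk⇔ (query⇒≺B B large) (≺B⇒query B large)
  where
  open EncodedQuery G v w
  open BreadthFirst G

theorem7 : Σ[ M ∈ NTM Symbol ] LogSpace M × ((G : OrderedGraph) (v w : OrderedGraph.Vertex G) → Accepts M (Encoding.encode G v w) ⇔ BreadthFirst._≺B_ G v w)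
theorem7 = decidedBy query query-decides
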